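{- Let $p$ be a prime and let $r\ge 0$ be an integer. (i) If $p>r+3$ then $$\sum_{k=1}^{p-1}\frac{\binom{2k}{k}}{k\,4^k}\,S_k(\{1\}^r)\equiv\begin{cases}-H^{(r+1)}_{(p-1)/2}&\text{if } r \text{ is even},\\[2mm] \dfrac{2^{r+2}-1}{2(r+2)}\,p\,B_{p-r-2}&\text{if } r\text{ is odd},\end{cases}\pmod{p^2}.$$ (ii) If $p>2r+3$ then $$\sum_{k=1}^{p-1}\frac{\binom{2k}{k}^2}{k\,16^k}\,S_k(\{2\}^r)\equiv -2H^{(2r+1)}_{(p-1)/2}-\frac{r(2^{2r+3}-1)}{2}\,p^2B_{p-2r-3}\pmod{p^3}.$$
   Context: Congruences modulo $p^a$ are between rational numbers with denominators prime to $p$ (equivalently, in the $p$-adic integers $\mathbb{Z}_p$). $B_n$ is the $n$-th Bernoulli number. For $t\ge1$, $H_n^{(t)}:=\sum_{j=1}^n\frac1{j^t}$. For positive integers $t_1,\dots,t_r$, $$S_n(t_1,\dots,t_r):=\sum_{1\le j_1\le\cdots\le j_r\le n}\frac{1}{j_1^{t_1}\cdots j_r^{t_r}},$$ and $S_n(\{t\}^r)$ denotes $S_n(t,\dots,t)$ with $t$ repeated $r$ times; for $r=0$, $S_n(\{t\}^0)=1$. -}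

module Defs where

open import Data.Fin.Base using (Fin; toℕ)
open import Data.Fin.Properties using (toℕ<n)
open import Data.Integer.Base using (ℤ; +_)
open import Data.List.Base using (List; foldl)
open import Data.Nat.Base using (ℕ; zero; suc; NonZero; _*_; _^_)
open import Data.Nat.Combinatorics using (_C_)
open import Data.Nat.Coprimality using (Coprime)
open import Data.Nat.Induction using (<-rec; <-Rec; <-wellFounded)
open import Data.Nat.Properties using (m*n≢0; m^n≢0)
open import Data.Product.Base using (_×_; ∃-syntax)
open import Data.Rational.Base as ℚ using (ℚ; _/_; 0ℚ; 1ℚ; ↧ₙ_)
open import Data.Rational.Properties using (+-0-monoid)
open import Induction.WellFounded using (module FixPoint)
open import Relation.Binary.PropositionalEquality.Core using (_≡_; refl; cong)
open import Algebra.Properties.Monoid.Sum +-0-monoid using (sum; sum-cong-≗)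

infix 7 _/[_*_^_]

_/[_*_^_] : ℤ → (k b n : ℕ) .{{_ : NonZero k}} .{{_ : NonZero b}} → ℚ
c /[ k * b ^ n ] = c / (k * b ^ n)
  where
  instance
    _ = m^n≢0 b n
    _ = m*n≢0 k (b ^ n)

-- 1 / jᵗ
recipPow : (j t : ℕ) .{{_ : NonZero j}} → ℚ
recipPow j t = (+ 1) / (j ^ t)
  where instance _ = m^n≢0 j t

-- f 1 + f 2 + ⋯ + f n; the summand may use that its index is nonzero.
sumFrom1 : (n : ℕ) → ((k : ℕ) .{{_ : NonZero k}} → ℚ) → ℚ
sumFrom1 n f = sum {n} (λ i → f (suc (toℕ i)))

infixl 5 sumFrom1-syntax

sumFrom1-syntax : (n : ℕ) → ((k : ℕ) .{{_ : NonZero k}} → ℚ) → ℚ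
sumFrom1-syntax = sumFrom1

syntax sumFrom1-syntax n (λ k → e) = ∑[1≤ k ≤ n ] e

H : (t n : ℕ) → ℚ
H t n = ∑[1≤ j ≤ n ] recipPow j t

-- S (t₁ ∷ ⋯ ∷ tᵣ ∷ []) n, written as the iterated sum
--   Σ_{jᵣ ≤ n} 1/jᵣ^tᵣ · ( ⋯ Σ_{j₂ ≤ j₃} 1/j₂^t₂ · ( Σ_{j₁ ≤ j₂} 1/j₁^t₁ )),
-- where all indices start at 1.
S : List ℕ → ℕ → ℚ
S = foldl (λ inner t n → ∑[1≤ j ≤ n ] (inner j ℚ.* recipPow j t)) (λ _ → 1ℚ)

bernoulli-step : ∀ n → <-Rec (λ _ → ℚ) n → ℚ
bernoulli-step zero    B = 1ℚ
bernoulli-step (suc n) B =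
  ℚ.- ((+ 1 / suc (suc n)) ℚ.*
       sum {suc n} (λ j → (+ (suc (suc n) C toℕ j) / 1) ℚ.* B (toℕ<n j)))

bernoulli : ℕ → ℚ
bernoulli = <-rec (λ _ → ℚ) bernoulli-step

-- The defining recursion, B₀ = 1 and
--   Bₙ₊₁ = - 1/(n+2) · Σ_{j ≤ n} (n+2 choose j) · Bⱼ   (so B₁ = -1/2).
bernoulli-zero : bernoulli 0 ≡ 1ℚ
bernoulli-zero = refl

bernoulli-suc : ∀ n → bernoulli (suc n) ≡
  ℚ.- ((+ 1 / suc (suc n)) ℚ.*
       sum {suc n} (λ j → (+ (suc (suc n) C toℕ j) / 1) ℚ.* bernoulli (toℕ j)))
bernoulli-suc n = unfold-wfRec {x = suc n}
  where
  step-ext : ∀ m {B B′ : <-Rec (λ _ → ℚ) m} →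
             (∀ {y} y<m → B {y} y<m ≡ B′ y<m) →
             bernoulli-step m B ≡ bernoulli-step m B′
  step-ext zero    eq = refl
  step-ext (suc m) eq =
    cong (λ x → ℚ.- ((+ 1 / suc (suc m)) ℚ.* x))
         (sum-cong-≗ λ j → cong ((+ (suc (suc m) C toℕ j) / 1) ℚ.*_) (eq (toℕ<n j)))
  open FixPoint <-wellFounded (λ _ → ℚ) bernoulli-step step-ext

-- ↧ₙ x is the denominator in lowest terms.
_IntegralAt_ : ℚ → ℕ → Set
x IntegralAt p = Coprime (↧ₙ x) p

infix 4 _≋_[mod_^_]

-- A congruence includes the claim that both sides have denominator prime to p.
_≋_[mod_^_] : ℚ → ℚ → ℕ → ℕ → Set
x ≋ y [mod p ^ a ] =
  x IntegralAt p × y IntegralAt p ×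
  ∃[ z ] (z IntegralAt p × x ℚ.- y ≡ (+ (p ^ a) / 1) ℚ.* z)

{-# OPTIONS --safe #-}
module Submission where

-- For a parameter α, consider the sums Φᵣ(α) = Σ_{k<p} (α)ₖ/k! · Sₖ({1}ʳ)/k and
-- Ψᵣ(α) = Σ_{k<p} (α)ₖ(1-α)ₖ/k!² · Sₖ({2}ʳ)/k; the theorem is about α = 1/2, where
-- (1/2)ₖ/k! = C(2k,k)/4ᵏ. Generating functions in r telescope, so Φᵣ(α+1) - Φᵣ(α) is
-- -(-1/α)^{r+1}·((1+α)ₚ₋₁/(p-1)! - 1) up to terms divisible by the modulus, and similarly for Ψ.
-- Descending from p/2 to 1/2 in steps of 1 expresses Φᵣ(1/2) and Ψᵣ(1/2) through harmonic sums up to (p-1)/2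
-- and the values at p/2; descending from p to 1 evaluates the latter. The remaining sums H⁽ᵗ⁾ up to p-1 and
-- up to (p-1)/2 are related by j ↦ p - j and by separating even and odd j, and Newton's identities applied to
-- 1, …, p-1 and to their inverses give H⁽ᵗ⁾_{p-1} ≡ t/(t+1) · p B_{p-1-t} (mod p²), because the
-- recursions of Faulhaber and Bernoulli show Σ_{j<p} jⁿ ≡ p Bₙ (mod p²) for n < p - 1.
-- Everything takes place in a commutative ring in which p is nilpotent and 1, …, p-1 are invertible; it is
-- finally the ring of p-integral rationals modulo p² or p³.

-- The telescoping controls only the change of the sums under α ↦ α + 1, so each descent needs an
-- end point of known value. Multiples ρ of p serve because (ρ)ₖ contains the factor ρ: modulo p²,
-- Φᵣ(ρ) = ρ·Qᵣ with Qᵣ independent of ρ. The descent from ρ = p ends at Φᵣ(1) = Sₚ₋₁({1}^{r+1}) and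
-- so yields p·Qᵣ, which the descent from ρ = p/2 then uses. For Ψᵣ the same works modulo p³ with a
-- quadratic polynomial in ρ and with Ψᵣ(1) = 0. The boundary terms of the telescoping are products
-- of (1+α)ₚ₋₁/(p-1)! (or its analogue for Ψ) with a homogeneous sum. At the α met in the descent
-- the first factor is a multiple of p (for Ψ, of p²) and the second one of p, so the product
-- vanishes. What remains is a linear system in a few harmonic sums. The factors 2^{r+2} - 1 and
-- 2^{2r+3} - 1 come from splitting H⁽ᵗ⁾ₚ₋₁ once by size and once by parity, with t = r+1 or t =
-- 2r+2; the factor r of (ii) comes from 2 - t(t-1) = (2-t)(t+1).

open import Algebra.Bundles using (CommutativeRing; RawRing)
open import Algebra.Solver.Ring.AlmostCommutativeRing
  using (AlmostCommutativeRing; fromCommutativeRing; _-Raw-AlmostCommutative⟶_)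
import Algebra.Properties.Ring as RingProperties
import Algebra.Properties.Semiring.Mult.TCOptimised as Mult
import Algebra.Solver.Ring as Solver
open import Data.Bool.Base using (Bool; T)
open import Data.Fin.Base as Fin using ()
open import Data.Integer.Base as ℤ using (ℤ; +_; -[1+_]; _⊖_)
import Data.Integer.Properties as ℤ
open import Data.Maybe.Base as Maybe using (Maybe; just; nothing)
open import Data.Nat.Base as ℕ using (ℕ; zero; suc; _<_; _≤_; _∸_; s≤s; z≤n)
open import Data.Nat.Combinatorics using (_C_; nCn≡1; nC1≡n; k>n⇒nCk≡0; nCk+nC[k+1]≡[n+1]C[k+1]; nCk≡nC[n∸k])
open import Data.Nat.Divisibility using (_∤_)
open import Data.Nat.Primality using (Prime; prime⇒irreducible)
import Data.Nat.Properties as ℕ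
open import Data.Product.Base using (_×_; ∃-syntax; proj₁; proj₂; _,_)
open import Data.Sum.Base using (_⊎_; inj₁; inj₂; [_,_]′)
open import Data.Vec.Base as Vec using (Vec; []; _∷_)
open import Data.Vec.N-ary using (N-ary; _$ⁿ_)
open import Function.Base using (_∘_)
open import Level using (0ℓ)
open import Relation.Binary.PropositionalEquality.Core as ≡ using (_≡_)
import Relation.Binary.Reasoning.Setoid as SetoidReasoning
open import Relation.Nullary.Decidable using (yes; no)

-- Integers in a commutative ring, as coefficients for a ring solver

module Cast (R : CommutativeRing 0ℓ 0ℓ) where
  open CommutativeRing R
  open RingProperties ring
  open SetoidReasoning (CommutativeRing.setoid R)
  private module M = Mult semiring

  -- ν 0 and ν 1 are definitionally 0# and 1#.
  ν : ℕ → Carrier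
  ν n = n M.× 1#

  ν-suc : ∀ n → ν (suc n) ≈ 1# + ν n
  ν-suc n = M.1+× n 1#

  ν-+ : ∀ m n → ν (m ℕ.+ n) ≈ ν m + ν n
  ν-+ = M.×-homo-+ 1#

  ν-* : ∀ m n → ν (m ℕ.* n) ≈ ν m * ν n
  ν-* = M.×1-homo-*

  ζ : ℤ → Carrier
  ζ (+ n)    = ν n
  ζ -[1+ n ] = - ν (suc n)

  ζ-⊖ : ∀ m n → ζ (m ⊖ n) ≈ ν m - ν n
  ζ-⊖ m zero = sym (trans (+-congˡ -0#≈0#) (+-identityʳ _))
  ζ-⊖ zero (suc n) = sym (+-identityˡ _)
  ζ-⊖ (suc m) (suc n) = begin
    ζ (suc m ⊖ suc n)             ≡⟨ ≡.cong ζ (ℤ.[1+m]⊖[1+n]≡m⊖n m n) ⟩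
    ζ (m ⊖ n)                     ≈⟨ ζ-⊖ m n ⟩
    ν m - ν n                     ≈⟨ +-congʳ (+-identityʳ _) ⟨
    (ν m + 0#) - ν n              ≈⟨ +-congʳ (+-congˡ (-‿inverseʳ 1#)) ⟨
    (ν m + (1# - 1#)) - ν n       ≈⟨ +-congʳ (+-assoc _ _ _) ⟨
    ((ν m + 1#) - 1#) - ν n       ≈⟨ +-assoc _ _ _ ⟩
    (ν m + 1#) + (- 1# + - ν n)   ≈⟨ +-cong (+-comm _ _) (-‿+-comm 1# (ν n)) ⟩
    (1# + ν m) + - (1# + ν n)     ≈⟨ +-cong (ν-suc m) (-‿cong (ν-suc n)) ⟨
    ν (suc m) - ν (suc n)         ∎

  ζ-+ : ∀ i j → ζ (i ℤ.+ j) ≈ ζ i + ζ j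
  ζ-+ (+ m)    (+ n)    = ν-+ m n
  ζ-+ (+ m)    -[1+ n ] = ζ-⊖ m (suc n)
  ζ-+ -[1+ m ] (+ n)    = trans (ζ-⊖ n (suc m)) (+-comm _ _)
  ζ-+ -[1+ m ] -[1+ n ] = begin
    - ν (suc (suc (m ℕ.+ n)))    ≡⟨ ≡.cong (λ k → - ν (suc k)) (ℕ.+-suc m n) ⟨
    - ν (suc m ℕ.+ suc n)        ≈⟨ -‿cong (ν-+ (suc m) (suc n)) ⟩
    - (ν (suc m) + ν (suc n))    ≈⟨ -‿+-comm _ _ ⟨
    - ν (suc m) + - ν (suc n)    ∎

  ζ-neg : ∀ i → ζ (ℤ.- i) ≈ - ζ i
  ζ-neg (+ zero)  = sym -0#≈0#
  ζ-neg (+ suc n) = refl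
  ζ-neg -[1+ n ]  = sym (-‿involutive _)

  ζ-* : ∀ i j → ζ (i ℤ.* j) ≈ ζ i * ζ j
  ζ-*⁺ : ∀ m j → ζ (+ m ℤ.* j) ≈ ν m * ζ j
  ζ-*⁺ m (+ n) = trans (reflexive (≡.cong ζ (≡.sym (ℤ.pos-* m n)))) (ν-* m n)
  ζ-*⁺ m -[1+ n ] = begin
    ζ (+ m ℤ.* -[1+ n ])        ≡⟨ ≡.cong ζ (ℤ.neg-distribʳ-* (+ m) (+ suc n)) ⟨
    ζ (ℤ.- (+ m ℤ.* + suc n))   ≈⟨ ζ-neg (+ m ℤ.* + suc n) ⟩
    - ζ (+ m ℤ.* + suc n)       ≈⟨ -‿cong (ζ-*⁺ m (+ suc n)) ⟩
    - (ν m * ν (suc n))         ≈⟨ -‿distribʳ-* _ _ ⟩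
    ν m * - ν (suc n)           ∎
  ζ-* (+ m) j = ζ-*⁺ m j
  ζ-* -[1+ m ] j = begin
    ζ (-[1+ m ] ℤ.* j)          ≡⟨ ≡.cong ζ (ℤ.neg-distribˡ-* (+ suc m) j) ⟨
    ζ (ℤ.- (+ suc m ℤ.* j))     ≈⟨ ζ-neg (+ suc m ℤ.* j) ⟩
    - ζ (+ suc m ℤ.* j)         ≈⟨ -‿cong (ζ-*⁺ (suc m) j) ⟩
    - (ν (suc m) * ζ j)         ≈⟨ -‿distribˡ-* _ _ ⟩
    - ν (suc m) * ζ j           ∎

  ℤ-rawRing : RawRing 0ℓ 0ℓ
  ℤ-rawRing = CommutativeRing.rawRing ℤ.+-*-commutativeRing

  almost : AlmostCommutativeRing 0ℓ 0ℓ
  almost = fromCommutativeRing R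

  morphism : ℤ-rawRing -Raw-AlmostCommutative⟶ almost
  morphism = record
    { ⟦_⟧ = ζ ; +-homo = ζ-+ ; *-homo = ζ-* ; -‿homo = ζ-neg ; 0-homo = refl ; 1-homo = refl }

  coeff≟ : ∀ i j → Maybe (ζ i ≈ ζ j)
  coeff≟ i j with i ℤ.≟ j
  ... | yes ≡.refl = just refl
  ... | no  _      = nothing

  module S = Solver ℤ-rawRing almost morphism coeff≟

-- Reading ring terms as polynomials

module RingSolver (R : CommutativeRing 0ℓ 0ℓ) where
  open CommutativeRing R
  open Cast R using (module S)

  -- Instance search finds the polynomial; ρ lists the terms to be treated as variables.
  record Reify {n} (ρ : Vec Carrier n) (x : Carrier) : Set where
    constructor reify
    field
      polynomial : S.Polynomial n
      denotes    : S.⟦ polynomial ⟧ ρ ≈ x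
  open Reify

  private
    variable
      n : ℕ
      x y x₀ x₁ x₂ x₃ x₄ x₅ x₆ : Carrier

  -- A Boolean, so that the hidden argument `T (agree …)` of `solve` and `identity` reduces to the
  -- unit type and is filled in by itself once the normal forms coincide.
  agree : ∀ {n} → S.Polynomial n → S.Polynomial n → Bool
  agree p q = Maybe.is-just (S.normalise p S.≟N S.normalise q)

  sound : (ρ : Vec Carrier n) (p q : S.Polynomial n) → T (agree p q) → S.⟦ p ⟧ ρ ≈ S.⟦ q ⟧ ρ
  sound ρ p q t with S.normalise p S.≟N S.normalise q
  ... | just same = trans (sym (S.correct p ρ)) (trans (S.⟦ same ⟧N-cong ρ) (S.correct q ρ))

  solve : (ρ : Vec Carrier n) {{X : Reify ρ x}} {{Y : Reify ρ y}} {_ : T (agree (polynomial X) (polynomial Y))} → x ≈ y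
  solve ρ {{X}} {{Y}} {t} = trans (sym (denotes X)) (trans (sound ρ (polynomial X) (polynomial Y) t) (denotes Y))

  open S public using (_:+_; _:*_; _:-_; :-_)

  num : ℕ → S.Polynomial n
  num k = S.con (+ k)

  infix 4 _:=_
  _:=_ : S.Polynomial n → S.Polynomial n → S.Polynomial n × S.Polynomial n
  _:=_ = _,_

  variables : ∀ n → Vec (S.Polynomial n) n
  variables n = Vec.map S.var (Vec.allFin n)

  -- The polynomials are written out by hand here, which also admits more variables than the seven
  -- for which there are `Reify` instances.
  identity : (ρ : Vec Carrier n) (f : N-ary n (S.Polynomial n) (S.Polynomial n × S.Polynomial n)) →
             let e = f $ⁿ variables n in {_ : T (agree (proj₁ e) (proj₂ e))} → S.⟦ proj₁ e ⟧ ρ ≈ S.⟦ proj₂ e ⟧ ρ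
  identity {n} ρ f {t} = sound ρ (proj₁ (f $ⁿ variables n)) (proj₂ (f $ⁿ variables n)) t

  module _ {ρ : Vec Carrier n} where
    instance
      reify-+ : {{Reify ρ x}} → {{Reify ρ y}} → Reify ρ (x + y)
      reify-+ {{reify p h}} {{reify q k}} = reify (p S.:+ q) (+-cong h k)
      reify-* : {{Reify ρ x}} → {{Reify ρ y}} → Reify ρ (x * y)
      reify-* {{reify p h}} {{reify q k}} = reify (p S.:* q) (*-cong h k)
      reify-neg : {{Reify ρ x}} → Reify ρ (- x)
      reify-neg {{reify p h}} = reify (S.:- p) (-‿cong h)
      reify-0 : Reify ρ 0#
      reify-0 = reify (S.con (+ 0)) refl
      reify-1 : Reify ρ 1#
      reify-1 = reify (S.con (+ 1)) refl

  instance
    reify-x0 : {ρ : Vec Carrier n} → Reify (x₀ ∷ ρ) x₀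
    reify-x0 = reify (S.var Fin.zero) refl
    reify-x1 : {ρ : Vec Carrier n} → Reify (x₀ ∷ x₁ ∷ ρ) x₁
    reify-x1 = reify (S.var (Fin.suc Fin.zero)) refl
    reify-x2 : {ρ : Vec Carrier n} → Reify (x₀ ∷ x₁ ∷ x₂ ∷ ρ) x₂
    reify-x2 = reify (S.var (Fin.suc (Fin.suc Fin.zero))) refl
    reify-x3 : {ρ : Vec Carrier n} → Reify (x₀ ∷ x₁ ∷ x₂ ∷ x₃ ∷ ρ) x₃
    reify-x3 = reify (S.var (Fin.suc (Fin.suc (Fin.suc Fin.zero)))) refl
    reify-x4 : {ρ : Vec Carrier n} → Reify (x₀ ∷ x₁ ∷ x₂ ∷ x₃ ∷ x₄ ∷ ρ) x₄
    reify-x4 = reify (S.var (Fin.suc (Fin.suc (Fin.suc (Fin.suc Fin.zero))))) refl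
    reify-x5 : {ρ : Vec Carrier n} → Reify (x₀ ∷ x₁ ∷ x₂ ∷ x₃ ∷ x₄ ∷ x₅ ∷ ρ) x₅
    reify-x5 = reify (S.var (Fin.suc (Fin.suc (Fin.suc (Fin.suc (Fin.suc Fin.zero)))))) refl
    reify-x6 : {ρ : Vec Carrier n} → Reify (x₀ ∷ x₁ ∷ x₂ ∷ x₃ ∷ x₄ ∷ x₅ ∷ x₆ ∷ ρ) x₆
    reify-x6 = reify (S.var (Fin.suc (Fin.suc (Fin.suc (Fin.suc (Fin.suc (Fin.suc Fin.zero))))))) refl

-- Rational numbers with denominator prime to p

module RationalNumbers where
  open import Data.Empty using (⊥-elim)
  open import Data.Integer.Base as ℤ using (+_; ∣_∣)
  import Data.Integer.Properties as ℤ
  import Data.Integer.GCD as ℤ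
  open import Data.Nat.Base as ℕ using (ℕ; zero; suc; NonZero; _<_)
  import Data.Nat.Properties as ℕ
  open import Data.Nat.Coprimality using (Coprime)
  open import Data.Nat.Divisibility as ℕ using (_∣_; _∤_; divides)
  open import Data.Nat.Primality using (Prime; euclidsLemma; prime⇒irreducible; prime⇒nonTrivial)
  open import Data.Product.Base using (_,_)
  open import Data.Rational.Base as ℚ using (_/_; ↧_; ↧ₙ_; fromℚᵘ)
  import Data.Rational.Properties as ℚ
  open import Data.Rational.Unnormalised.Base as ℚᵘ using (mkℚᵘ; *≡*)
  import Data.Rational.Unnormalised.Properties as ℚᵘ
  open import Data.Sum.Base using (inj₁; inj₂; [_,_]′)
  open import Relation.Binary.PropositionalEquality.Core using (_≡_; sym; trans; cong; cong₂; subst)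
  open import Defs using (_IntegralAt_)

  fromℚᵘ-homo-+ : ∀ x y → fromℚᵘ x ℚ.+ fromℚᵘ y ≡ fromℚᵘ (x ℚᵘ.+ y)
  fromℚᵘ-homo-+ x y = ℚ.toℚᵘ-injective (ℚᵘ.≃-trans (ℚ.toℚᵘ-homo-+ (fromℚᵘ x) (fromℚᵘ y))
    (ℚᵘ.≃-trans (ℚᵘ.+-cong (ℚ.toℚᵘ-fromℚᵘ x) (ℚ.toℚᵘ-fromℚᵘ y)) (ℚᵘ.≃-sym (ℚ.toℚᵘ-fromℚᵘ (x ℚᵘ.+ y)))))

  fromℚᵘ-homo-* : ∀ x y → fromℚᵘ x ℚ.* fromℚᵘ y ≡ fromℚᵘ (x ℚᵘ.* y)
  fromℚᵘ-homo-* x y = ℚ.toℚᵘ-injective (ℚᵘ.≃-trans (ℚ.toℚᵘ-homo-* (fromℚᵘ x) (fromℚᵘ y))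
    (ℚᵘ.≃-trans (ℚᵘ.*-cong (ℚ.toℚᵘ-fromℚᵘ x) (ℚ.toℚᵘ-fromℚᵘ y)) (ℚᵘ.≃-sym (ℚ.toℚᵘ-fromℚᵘ (x ℚᵘ.* y)))))

  /1-homo-+ : ∀ i j → i / 1 ℚ.+ j / 1 ≡ (i ℤ.+ j) / 1
  /1-homo-+ i j = trans (fromℚᵘ-homo-+ (mkℚᵘ i 0) (mkℚᵘ j 0))
    (cong (_/ 1) (cong₂ ℤ._+_ (ℤ.*-identityʳ i) (ℤ.*-identityʳ j)))

  denominator-*-/ : ∀ c d .{{_ : NonZero d}} → (+ d / 1) ℚ.* (c / d) ≡ c / 1
  denominator-*-/ c (suc d) = trans (fromℚᵘ-homo-* (mkℚᵘ (+ suc d) 0) (mkℚᵘ c d))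
    (ℚ.fromℚᵘ-cong {mkℚᵘ (+ suc d) 0 ℚᵘ.* mkℚᵘ c d} {mkℚᵘ c 0} (*≡* (trans (ℤ.*-identityʳ (+ suc d ℤ.* c)) (trans (ℤ.*-comm (+ suc d) c)
      (cong (λ n → c ℤ.* + n) (sym (ℕ.*-identityˡ (suc d))))))))

  ↧ₙ-/-∣ : ∀ i n .{{_ : NonZero n}} → ↧ₙ (i / n) ∣ n
  ↧ₙ-/-∣ i n = divides ∣ ℤ.gcd i (+ n) ∣ (trans (cong ∣_∣ (sym (ℚ.↧-/ i n)))
    (trans (ℤ.abs-* (↧ (i / n)) (ℤ.gcd i (+ n))) (ℕ.*-comm (↧ₙ (i / n)) ∣ ℤ.gcd i (+ n) ∣)))

  ↧ₙ-+-∣ : ∀ x y → ↧ₙ (x ℚ.+ y) ∣ ↧ₙ x ℕ.* ↧ₙ y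
  ↧ₙ-+-∣ x@record{} y@record{} = ↧ₙ-/-∣ (ℚ.↥ x ℤ.* ↧ y ℤ.+ ℚ.↥ y ℤ.* ↧ x) (↧ₙ x ℕ.* ↧ₙ y)

  ↧ₙ-*-∣ : ∀ x y → ↧ₙ (x ℚ.* y) ∣ ↧ₙ x ℕ.* ↧ₙ y
  ↧ₙ-*-∣ x@record{} y@record{} = ↧ₙ-/-∣ (ℚ.↥ x ℤ.* ℚ.↥ y) (↧ₙ x ℕ.* ↧ₙ y)

  module Integral (p : ℕ) (p-prime : Prime p) where

    1<p : 1 < p
    1<p = ℕ.nonTrivial⇒n>1 p {{prime⇒nonTrivial p-prime}}

    ∤⇒coprime : ∀ {n} → p ∤ n → Coprime n p
    ∤⇒coprime p∤n (d∣n , d∣p) with prime⇒irreducible p-prime d∣p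
    ... | inj₁ d≡1 = d≡1
    ... | inj₂ d≡p = ⊥-elim (p∤n (subst (_∣ _) d≡p d∣n))

    coprime⇒∤ : ∀ {n} → Coprime n p → p ∤ n
    coprime⇒∤ c p∣n = ℕ.<⇒≢ 1<p (sym (c (p∣n , ℕ.∣-refl)))

    ∤-* : ∀ {m n} → p ∤ m → p ∤ n → p ∤ m ℕ.* n
    ∤-* p∤m p∤n p∣mn = [ p∤m , p∤n ]′ (euclidsLemma _ _ p-prime p∣mn)

    ∤-^ : ∀ {m} n → p ∤ m → p ∤ m ℕ.^ n
    ∤-^ zero    p∤m p∣1 = ℕ.<⇒≢ 1<p (sym (ℕ.∣1⇒≡1 p∣1))
    ∤-^ (suc n) p∤m = ∤-* p∤m (∤-^ n p∤m)

    <⇒∤ : ∀ {n} .{{_ : NonZero n}} → n < p → p ∤ n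
    <⇒∤ n<p = ℕ.>⇒∤ n<p

    integral-∣ : ∀ x {n} → ↧ₙ x ∣ n → p ∤ n → x IntegralAt p
    integral-∣ x ↧∣n p∤n = ∤⇒coprime λ p∣↧ → p∤n (ℕ.∣-trans p∣↧ ↧∣n)

    integral-/ : ∀ i n .{{_ : NonZero n}} → p ∤ n → (i / n) IntegralAt p
    integral-/ i n = integral-∣ (i / n) (↧ₙ-/-∣ i n)

    integral-+ : ∀ {x y} → x IntegralAt p → y IntegralAt p → (x ℚ.+ y) IntegralAt p
    integral-+ {x} {y} hx hy = integral-∣ (x ℚ.+ y) (↧ₙ-+-∣ x y) (∤-* (coprime⇒∤ hx) (coprime⇒∤ hy))

    integral-* : ∀ {x y} → x IntegralAt p → y IntegralAt p → (x ℚ.* y) IntegralAt p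
    integral-* {x} {y} hx hy = integral-∣ (x ℚ.* y) (↧ₙ-*-∣ x y) (∤-* (coprime⇒∤ hx) (coprime⇒∤ hy))

    integral-neg : ∀ {x} → x IntegralAt p → (ℚ.- x) IntegralAt p
    integral-neg {x} hx = subst (λ n → Coprime n p) (cong ∣_∣ (sym (ℚ.↧-neg x))) hx

    integral-ℤ : ∀ i → (i / 1) IntegralAt p
    integral-ℤ i = integral-/ i 1 (<⇒∤ 1<p)

-- Finite sums and divisibility in a commutative ring

module Over (R : CommutativeRing 0ℓ 0ℓ) where
  open CommutativeRing R hiding (zero)
  open Cast R using (ν; ν-suc; ν-+; ν-*; ζ; ζ-+; ζ-*)
  open RingSolver R
  open import Algebra.Properties.Ring ring using (-0#≈0#)
  open import Algebra.Properties.Group +-group using () renaming (x∙y⁻¹≈ε⇒x≈y to x-y≈0⇒x≈y; x≈y⇒x∙y⁻¹≈ε to x≈y⇒x-y≈0′)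
  open import Algebra.Properties.Semiring.Exp semiring using (_^_; ^-congˡ)
  open import Algebra.Properties.CommutativeSemiring.Exp commutativeSemiring using (^-distrib-*)
  open import Algebra.Properties.Semiring.Divisibility semiring using (_∣_; _,_; _∣0; ∣-respʳ-≈)
  open SetoidReasoning setoid

  x≈y⇒x-y≈0 : ∀ x y → x ≈ y → x - y ≈ 0#
  x≈y⇒x-y≈0 x y = x≈y⇒x-y≈0′

  -- The format of nearly all calculations below: an equation follows once the difference of its
  -- sides is a combination, with explicit coefficients, of the differences of the sides of known
  -- equations. The last argument is then a pure ring identity, left to the solver.
  combine₁ : ∀ {l r a b} c → a ≈ b → l - r ≈ c * (a - b) → l ≈ r
  combine₁ c h eq = x-y≈0⇒x≈y _ _ (trans eq (trans (*-congˡ (x≈y⇒x-y≈0 _ _ h)) (zeroʳ c)))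

  combine₂ : ∀ {l r a b a′ b′} c → a ≈ b → ∀ c′ → a′ ≈ b′ →
             l - r ≈ c * (a - b) + c′ * (a′ - b′) → l ≈ r
  combine₂ {a′ = a′} {b′} c h c′ h′ eq = combine₁ c h (trans eq (trans (+-congˡ (trans (*-congˡ (x≈y⇒x-y≈0 _ _ h′)) (zeroʳ c′))) (+-identityʳ _)))

  combine₃ : ∀ {l r a b a′ b′ a″ b″} c → a ≈ b → ∀ c′ → a′ ≈ b′ → ∀ c″ → a″ ≈ b″ →
             l - r ≈ c * (a - b) + c′ * (a′ - b′) + c″ * (a″ - b″) → l ≈ r
  combine₃ c h c′ h′ c″ h″ eq = combine₂ c h c′ h′ (trans eq (trans (+-congˡ (trans (*-congˡ (x≈y⇒x-y≈0 _ _ h″)) (zeroʳ c″))) (+-identityʳ _)))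

  combine₄ : ∀ {l r a b a′ b′ a″ b″ a‴ b‴} c → a ≈ b → ∀ c′ → a′ ≈ b′ → ∀ c″ → a″ ≈ b″ → ∀ c‴ → a‴ ≈ b‴ →
             l - r ≈ c * (a - b) + c′ * (a′ - b′) + c″ * (a″ - b″) + c‴ * (a‴ - b‴) → l ≈ r
  combine₄ c h c′ h′ c″ h″ c‴ h‴ eq = combine₃ c h c′ h′ c″ h″ (trans eq (trans (+-congˡ (trans (*-congˡ (x≈y⇒x-y≈0 _ _ h‴)) (zeroʳ c‴))) (+-identityʳ _)))

  Σ : ℕ → (ℕ → Carrier) → Carrier
  Σ zero    f = 0#
  Σ (suc n) f = Σ n f + f (suc n)

  Σ-cong : ∀ n {f g : ℕ → Carrier} → (∀ k → k < n → f (suc k) ≈ g (suc k)) → Σ n f ≈ Σ n g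
  Σ-cong zero    h = refl
  Σ-cong (suc n) h = +-cong (Σ-cong n (λ k k<n → h k (ℕ.m<n⇒m<1+n k<n))) (h n (ℕ.n<1+n n))

  Σ-+ : ∀ n (f g : ℕ → Carrier) → Σ n f + Σ n g ≈ Σ n (λ k → f k + g k)
  Σ-+ zero    f g = +-identityʳ 0#
  Σ-+ (suc n) f g = combine₁ 1# (Σ-+ n f g)
      (solve (Σ n f ∷ f (suc n) ∷ Σ n g ∷ g (suc n) ∷ Σ n (λ k → f k + g k) ∷ []))

  Σ-*ˡ : ∀ n c (f : ℕ → Carrier) → c * Σ n f ≈ Σ n (λ k → c * f k)
  Σ-*ˡ zero    c f = zeroʳ c
  Σ-*ˡ (suc n) c f = combine₁ 1# (Σ-*ˡ n c f) (solve (c ∷ Σ n f ∷ f (suc n) ∷ Σ n (λ k → c * f k) ∷ []))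

  Σ-neg : ∀ n (f : ℕ → Carrier) → - Σ n f ≈ Σ n (λ k → - f k)
  Σ-neg zero    f = -0#≈0#
  Σ-neg (suc n) f = combine₁ 1# (Σ-neg n f) (solve (Σ n f ∷ f (suc n) ∷ Σ n (λ k → - f k) ∷ []))

  Σ-- : ∀ n (f g : ℕ → Carrier) → Σ n f - Σ n g ≈ Σ n (λ k → f k - g k)
  Σ-- n f g = trans (+-congˡ (Σ-neg n g)) (Σ-+ n f (λ k → - g k))

  Σ-swap : ∀ n l (f : ℕ → ℕ → Carrier) → Σ n (λ i → Σ l (f i)) ≈ Σ l (λ j → Σ n (λ i → f i j))
  Σ-swap zero    l f = Σ-zero l
    where
    Σ-zero : ∀ l → 0# ≈ Σ l (λ _ → 0#)
    Σ-zero zero    = refl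
    Σ-zero (suc l) = trans (Σ-zero l) (sym (+-identityʳ (Σ l (λ _ → 0#))))
  Σ-swap (suc n) l f = trans (+-congʳ (Σ-swap n l f)) (Σ-+ l (λ j → Σ n (λ i → f i j)) (f (suc n)))

  Σ-telescope : ∀ n (f : ℕ → Carrier) → Σ n (λ k → f k - f (k ∸ 1)) ≈ f n - f 0
  Σ-telescope zero    f = solve (f zero ∷ [])
  Σ-telescope (suc n) f = combine₁ 1# (Σ-telescope n f)
      (solve (Σ n (λ k → f k - f (k ∸ 1)) ∷ f (suc n) ∷ f (suc n ∸ 1) ∷ f 0 ∷ []))

  Σ-head : ∀ n (f : ℕ → Carrier) → Σ (suc n) f ≈ f 1 + Σ n (f ∘ suc)
  Σ-head zero    f = +-comm 0# (f 1)
  Σ-head (suc n) f = combine₁ 1# (Σ-head n f)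
      (solve (Σ n f ∷ f (suc n) ∷ f (suc (suc n)) ∷ f 1 ∷ Σ n (λ x → f (suc x)) ∷ []))

  Σ-reverse : ∀ n (f : ℕ → Carrier) → Σ n f ≈ Σ n (λ k → f (suc n ∸ k))
  Σ-reverse zero    f = refl
  Σ-reverse (suc n) f = begin
    Σ n f + f (suc n)                           ≈⟨ +-congʳ (Σ-reverse n f) ⟩
    Σ n (λ k → f (suc n ∸ k)) + f (suc n)       ≈⟨ +-comm _ _ ⟩
    f (suc n) + Σ n (λ k → f (suc n ∸ k))       ≈⟨ Σ-head n (λ k → f (suc (suc n) ∸ k)) ⟨
    Σ (suc n) (λ k → f (suc (suc n) ∸ k))       ∎

  Σ-+ˡ : ∀ m n (f : ℕ → Carrier) → Σ (m ℕ.+ n) f ≈ Σ n f + Σ m (λ k → f (n ℕ.+ k))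
  Σ-+ˡ zero    n f = sym (+-identityʳ _)
  Σ-+ˡ (suc m) n f = begin
    Σ (m ℕ.+ n) f + f (suc (m ℕ.+ n))                       ≈⟨ +-cong (Σ-+ˡ m n f) (reflexive (≡.cong f (≡.trans (≡.cong suc (ℕ.+-comm m n)) (≡.sym (ℕ.+-suc n m))))) ⟩
    (Σ n f + Σ m (λ k → f (n ℕ.+ k))) + f (n ℕ.+ suc m)     ≈⟨ +-assoc _ _ _ ⟩
    Σ n f + (Σ m (λ k → f (n ℕ.+ k)) + f (n ℕ.+ suc m))     ∎

  Σ-parity : ∀ n (f : ℕ → Carrier) → Σ (n ℕ.+ n) f ≈ Σ n (λ k → f (k ℕ.+ k)) + Σ n (λ k → f (k ℕ.+ k ∸ 1))
  Σ-parity zero    f = sym (+-identityʳ 0#)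
  Σ-parity (suc n) f rewrite ℕ.+-suc n n = combine₁ 1# (Σ-parity n f)
      (solve (Σ (n ℕ.+ n) f ∷ f (suc (n ℕ.+ n)) ∷ f (suc (suc (n ℕ.+ n))) ∷ Σ n (λ k → f (k ℕ.+ k))
        ∷ Σ n (λ k → f (k ℕ.+ k ∸ 1)) ∷ []))

  Σ-const : ∀ n → Σ n (λ _ → 1#) ≈ ν n
  Σ-const zero    = refl
  Σ-const (suc n) = trans (+-congʳ (Σ-const n)) (trans (+-comm _ _) (sym (ν-suc n)))

  ∣-+ : ∀ {a x y} → a ∣ x → a ∣ y → a ∣ (x + y)
  ∣-+ {a} {x} {y} (q , h) (q′ , h′) = q + q′ , combine₂ 1# h 1# h′ (solve (q ∷ q′ ∷ a ∷ x ∷ y ∷ []))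

  ∣-neg : ∀ {a x} → a ∣ x → a ∣ - x
  ∣-neg {a} {x} (q , h) = - q , combine₁ (- 1#) h (solve (q ∷ a ∷ x ∷ []))

  ∣-*ˡ : ∀ {a x} c → a ∣ x → a ∣ c * x
  ∣-*ˡ {a} {x} c (q , h) = c * q , combine₁ c h (solve (c ∷ q ∷ a ∷ x ∷ []))

  ∣-*ʳ : ∀ {a x} c → a ∣ x → a ∣ x * c
  ∣-*ʳ {a} {x} c (q , h) = c * q , combine₁ c h (solve (c ∷ q ∷ a ∷ x ∷ []))

  ∣-* : ∀ {a b x y} → a ∣ x → b ∣ y → a * b ∣ x * y
  ∣-* {a} {b} {x} {y} (q , h) (q′ , h′) = q * q′ , combine₂ (q′ * b) h x h′
      (solve (q ∷ q′ ∷ a ∷ b ∷ x ∷ y ∷ []))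

  ∣-refl : ∀ {a} → a ∣ a
  ∣-refl = 1# , *-identityˡ _

  ∣-Σ : ∀ {a} n {f : ℕ → Carrier} → (∀ k → k < n → a ∣ f (suc k)) → a ∣ Σ n f
  ∣-Σ zero    h = _ ∣0
  ∣-Σ (suc n) h = ∣-+ (∣-Σ n (λ k k<n → h k (ℕ.m<n⇒m<1+n k<n))) (h n (ℕ.n<1+n n))

  -- Applied with a power of p that is zero in the ring: divisibility proved in general becomes an
  -- equation there.
  ∣∧≈0⇒≈0 : ∀ {a x} → a ≈ 0# → a ∣ x → x ≈ 0#
  ∣∧≈0⇒≈0 h (q , h′) = trans (sym h′) (trans (*-congˡ h) (zeroʳ q))

  -- Symmetric polynomials and Newton's identities

  -- h a r n is the complete homogeneous symmetric polynomial of degree r in a 1, …, a n.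
  h : (ℕ → Carrier) → ℕ → ℕ → Carrier
  h a zero    n = 1#
  h a (suc r) n = Σ n (λ j → h a r j * a j)

  -- e a r n is (-1)^r times the elementary symmetric polynomial of degree r in a 1, …, a n.
  e : (ℕ → Carrier) → ℕ → ℕ → Carrier
  e a zero    n       = 1#
  e a (suc r) zero    = 0#
  e a (suc r) (suc n) = e a (suc r) n - a (suc n) * e a r n

  psum : (ℕ → Carrier) → ℕ → ℕ → Carrier
  psum a i n = Σ n (λ j → a j ^ i)

  conv : (ℕ → Carrier) → (ℕ → Carrier) → ℕ → Carrier
  conv f g zero    = f 0 * g 0
  conv f g (suc r) = f 0 * g (suc r) + conv (f ∘ suc) g r

  conv-congˡ : ∀ {f f′ : ℕ → Carrier} g → (∀ i → f i ≈ f′ i) → ∀ r → conv f g r ≈ conv f′ g r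
  conv-congˡ g eq zero    = *-congʳ (eq 0)
  conv-congˡ g eq (suc r) = +-cong (*-congʳ (eq 0)) (conv-congˡ g (eq ∘ suc) r)

  conv-zeroˡ : ∀ g r → conv (λ _ → 0#) g r ≈ 0#
  conv-zeroˡ g zero    = zeroˡ (g 0)
  conv-zeroˡ g (suc r) = combine₁ 1# (conv-zeroˡ g r) (solve (g (suc r) ∷ conv (λ x → 0#) g r ∷ []))

  conv-+ˡ : ∀ f f′ g r → conv (λ i → f i + f′ i) g r ≈ conv f g r + conv f′ g r
  conv-+ˡ f f′ g zero    = solve (f 0 ∷ f′ 0 ∷ g 0 ∷ [])
  conv-+ˡ f f′ g (suc r) = combine₁ 1# (conv-+ˡ (f ∘ suc) (f′ ∘ suc) g r)
      (solve (f 0 ∷ f′ 0 ∷ g (suc r) ∷ conv (λ x → f (suc x) + f′ (suc x)) g r ∷ conv (λ x → f (suc x)) g r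
        ∷ conv (λ x → f′ (suc x)) g r ∷ []))

  conv-*ˡ : ∀ c f g r → conv (λ i → c * f i) g r ≈ c * conv f g r
  conv-*ˡ c f g zero    = solve (c ∷ f 0 ∷ g 0 ∷ [])
  conv-*ˡ c f g (suc r) = combine₁ 1# (conv-*ˡ c (f ∘ suc) g r)
      (solve (c ∷ f 0 ∷ g (suc r) ∷ conv (λ x → c * f (suc x)) g r ∷ conv (λ x → f (suc x)) g r ∷ []))

  conv-last : ∀ f g r → conv f g (suc r) ≈ conv f (g ∘ suc) r + f (suc r) * g 0
  conv-last f g zero    = refl
  conv-last f g (suc r) = combine₁ 1# (conv-last (f ∘ suc) g r)
      (identity (f 0 ∷ g (suc (suc r)) ∷ f 1 ∷ g (suc r) ∷ conv (λ x → f (suc (suc x))) g r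
        ∷ conv (λ x → f (suc x)) (λ x → g (suc x)) r ∷ f (suc (suc r)) ∷ g 0 ∷ [])
      (λ x y z u v w p q → x :* y :+ (z :* u :+ v) :- (x :* y :+ w :+ p :* q) := num 1 :* (z :* u :+ v :- (w :+ p
        :* q))))

  conv-∣ : ∀ {c} f g r → (∀ i l → i ℕ.+ l ≡ r → c ∣ f i * g l) → c ∣ conv f g r
  conv-∣ f g zero    H = H 0 0 ≡.refl
  conv-∣ f g (suc r) H = ∣-+ (H 0 (suc r) ≡.refl)
    (conv-∣ (f ∘ suc) g r (λ i l eq → H (suc i) l (≡.cong suc eq)))

  -- g′ is the product of g with the power series 1 / (1 - c x), and f′ the sum of f with c / (1 - c x).
  module _ (c : Carrier) (f f′ g g′ : ℕ → Carrier) (f′-f : ∀ i → f′ i ≈ f i + c ^ suc i)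
           (g′-zero : g′ 0 ≈ g 0) (g′-suc : ∀ l → g′ (suc l) ≈ g (suc l) + c * g′ l) where

    conv-geometric : ∀ r → conv (λ i → c ^ suc i) g r ≈ c * g′ r
    conv-geometric zero    = combine₁ (- c) g′-zero (solve (c ∷ g 0 ∷ g′ zero ∷ []))
    conv-geometric (suc r) = combine₃ 1# (conv-*ˡ c (λ i → c ^ suc i) g r)
      c (conv-geometric r) (- c) (g′-suc r)
          (identity (c ∷ g (suc r) ∷ conv (λ x → c ^ suc (suc x)) g r ∷ g′ (suc r) ∷ conv (λ i → c ^ suc i) g r
            ∷ g′ r ∷ [])
          (λ x y z u v w → x :* num 1 :* y :+ z :- x :* u := num 1 :* (z :- x :* v) :+ x :* (v :- x :* w) :+ :- x :* (u
            :- (y :+ x :* w))))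

    conv-quotient-zero : ∀ k → conv k g′ 0 ≈ conv k g 0
    conv-quotient-zero k = *-congˡ g′-zero

    conv-quotient-suc : ∀ k r → conv k g′ (suc r) ≈ conv k g (suc r) + c * conv k g′ r
    conv-quotient-suc k zero    = combine₂ (k 0) (g′-suc 0) (k 1) g′-zero
        (identity (k 0 ∷ g′ 1 ∷ k 1 ∷ g′ 0 ∷ g 1 ∷ g 0 ∷ c ∷ [])
        (λ x y z u v w p → x :* y :+ z :* u :- (x :* v :+ z :* w :+ p :* (x :* u)) := x :* (y :- (v :+ p :* u))
          :+ z :* (u :- w)))
    conv-quotient-suc k (suc r) = combine₂ (k 0) (g′-suc (suc r)) 1# (conv-quotient-suc (k ∘ suc) r)
        (identity (k 0 ∷ g′ (suc (suc r)) ∷ k 1 ∷ g′ (suc r) ∷ conv (λ x → k (suc (suc x))) g′ r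
          ∷ g (suc (suc r)) ∷ g (suc r) ∷ conv (λ x → k (suc (suc x))) g r ∷ c ∷ conv (λ x → k (suc x)) g′ r
          ∷ [])
        (λ x y z u v w p q s t → x :* y :+ (z :* u :+ v) :- (x :* w :+ (z :* p :+ q) :+ s :* (x :* u :+ t)) := x
          :* (y :- (w :+ s :* u)) :+ num 1 :* (z :* u :+ v :- (z :* p :+ q :+ s :* t))))

    conv-added : ∀ r → conv f′ g r ≈ conv f g r + c * g′ r
    conv-added r = trans (conv-congˡ g f′-f r)
      (trans (conv-+ˡ f (λ i → c ^ suc i) g r) (+-congˡ (conv-geometric r)))

    conv-both-zero : conv f′ g′ 0 ≈ conv f g 0 + c * g′ 0
    conv-both-zero = trans (conv-quotient-zero f′) (conv-added 0)

    -- As power series, f′g = fg + c·g′ and (1 - cx)·f′g′ = f′g. This is how both sides of a Newton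
    -- identity change when one variable c is adjoined or removed.
    conv-both-suc : ∀ r → conv f′ g′ (suc r) ≈ conv f g (suc r) + c * g′ (suc r) + c * conv f′ g′ r
    conv-both-suc r = trans (conv-quotient-suc f′ r) (+-congʳ (conv-added (suc r)))

  -- The coefficients of H′ = P·H, where H = ∏ 1/(1 - aⱼx) and P = Σ aⱼ/(1 - aⱼx). Induction on the
  -- number of variables: a new one multiplies H by a geometric series and adds a geometric series
  -- to P.
  newton-h : ∀ a n r → ν (suc r) * h a (suc r) n ≈ conv (λ i → psum a (suc i) n) (λ l → h a l n) r
  newton-h a zero    r = combine₁ (- 1#) (conv-zeroˡ (λ l → h a l 0) r)
      (solve (ν (suc r) ∷ conv (λ i → psum a (suc i) zero) (λ l → h a l zero) r ∷ []))
  newton-h a (suc n) r = go r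
    where
    f f′ g g′ : ℕ → Carrier
    f  i = psum a (suc i) n
    f′ i = psum a (suc i) (suc n)
    g  l = h a l n
    g′ l = h a l (suc n)
    step : ∀ l → g′ (suc l) ≈ g (suc l) + a (suc n) * g′ l
    step l = +-congˡ (*-comm _ _)
    go : ∀ r → ν (suc r) * g′ (suc r) ≈ conv f′ g′ r
    go zero    = combine₂ 1# (newton-h a n 0)
      (- 1#) (conv-both-zero (a (suc n)) f f′ g g′ (λ _ → refl) refl step)
          (solve (h a (suc 0) n ∷ a (suc n) ∷ psum a 1 n ∷ []))
    -- `ν (suc (suc r))` unfolds to `ν (suc r) + 1#`, so in the identity it appears as the variable
    -- for `ν (suc r)` plus one; later identities rely on the same unfolding.
    go (suc r) = combine₄ 1# (newton-h a n (suc r))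
      (- 1#) (conv-both-suc (a (suc n)) f f′ g g′ (λ _ → refl) refl step r)
      (a (suc n)) (go r) (g′ (suc r) * a (suc n)) (ν-suc (suc r))
          (identity (ν (suc r) ∷ h a (suc (suc r)) n ∷ h a (suc r) n ∷ h a r (suc n) ∷ a (suc n) ∷ psum a 1 n
            ∷ conv (λ x → f′ (suc x)) g′ r ∷ conv (λ x → psum a (suc (suc x)) n) (λ l → h a l n) r
            ∷ conv f′ g′ r ∷ [])
          (λ x y z u v w p q s → (x :+ num 1) :* (y :+ (z :+ u :* v) :* v) :- ((w :+ v :* num 1) :* (z :+ u :* v) :+ p)
            := num 1 :* ((x :+ num 1) :* y :- (w :* z :+ q)) :+ :- (num 1) :* ((w :+ v :* num 1) :* (z :+ u :* v) :+ p
            :- (w :* z :+ q :+ v :* (z :+ u :* v) :+ v :* s)) :+ v :* (x :* (z :+ u :* v) :- s) :+ (z :+ u :* v)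
            :* v :* (x :+ num 1 :- (num 1 :+ x))))

  -- The coefficients of E′ = -P·E for E = ∏ (1 - aⱼx). Here it is the removal of a variable that
  -- multiplies E by a geometric series, so the primed sequences are those with n variables and the
  -- unprimed ones those with n + 1.
  newton-e : ∀ a n r → ν (suc r) * e a (suc r) n ≈ conv (λ i → - psum a (suc i) n) (λ l → e a l n) r
  newton-e a zero    r = combine₂ (- 1#) (conv-congˡ (λ l → e a l 0) (λ _ → -0#≈0#) r)
    (- 1#) (conv-zeroˡ (λ l → e a l 0) r)
        (solve (ν (suc r) ∷ conv (λ i → - psum a (suc i) zero) (λ l → e a l zero) r
          ∷ conv (λ z → 0#) (λ l → e a l 0) r ∷ []))
  newton-e a (suc n) = go
    where
    f f′ g g′ : ℕ → Carrier
    f  i = - psum a (suc i) (suc n)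
    f′ i = - psum a (suc i) n
    g  l = e a l (suc n)
    g′ l = e a l n
    f′-f : ∀ i → f′ i ≈ f i + a (suc n) ^ suc i
    f′-f i = solve (psum a (suc i) n ∷ a (suc n) ∷ a (suc n) ^ i ∷ [])
    step : ∀ l → g′ (suc l) ≈ g (suc l) + a (suc n) * g′ l
    step l = solve (g′ (suc l) ∷ a (suc n) ∷ e a l n ∷ [])
    go : ∀ r → ν (suc r) * g (suc r) ≈ conv f g r
    go zero    = combine₂ 1# (newton-e a n 0)
      1# (conv-both-zero (a (suc n)) f f′ g g′ f′-f refl step) (solve (e a 1 n ∷ a (suc n) ∷ psum a 1 n ∷ []))
    go (suc r) = combine₄ 1# (newton-e a n (suc r)) (- a (suc n)) (newton-e a n r)
      1# (conv-both-suc (a (suc n)) f f′ g g′ f′-f refl step r)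
      (- (a (suc n) * g′ (suc r))) (ν-suc (suc r))
          (identity (ν (suc r) ∷ e a (suc (suc r)) n ∷ a (suc n) ∷ e a (suc r) n ∷ psum a 1 n ∷ e a r n
            ∷ conv (λ x → f (suc x)) g r ∷ conv (λ x → - psum a (suc (suc x)) n) (λ l → e a l n) r
            ∷ conv (λ i → - psum a (suc i) n) (λ l → e a l n) r ∷ [])
          (λ x y z u v w p q s → (x :+ num 1) :* (y :- z :* u) :- (:- (v :+ z :* num 1) :* (u :- z :* w) :+ p) := num 1
            :* ((x :+ num 1) :* y :- (:- v :* u :+ q)) :+ :- z :* (x :* u :- s) :+ num 1 :* (:- v :* u :+ q :- (:- (v
            :+ z :* num 1) :* (u :- z :* w) :+ p :+ z :* u :+ z :* s)) :+ :- (z :* u) :* (x :+ num 1 :- (num 1 :+ x))))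

  e-beyond : ∀ a r n → n < r → e a r n ≈ 0#
  e-beyond a (suc r) zero    _         = refl
  e-beyond a (suc r) (suc n) (s≤s n<r) = combine₂ 1# (e-beyond a (suc r) n (ℕ.m<n⇒m<1+n n<r))
    (- a (suc n)) (e-beyond a r n n<r) (solve (e a (suc r) n ∷ a (suc n) ∷ e a r n ∷ []))

  negProduct : (ℕ → Carrier) → ℕ → Carrier
  negProduct a zero    = 1#
  negProduct a (suc n) = negProduct a n * - a (suc n)

  -- Substituting 1/x in ∏ (1 - x / aⱼ).
  e-reciprocal : ∀ a a′ n → (∀ k → k < n → a (suc k) * a′ (suc k) ≈ 1#) →
                 ∀ r l → r ℕ.+ l ≡ n → negProduct a n * e a′ r n ≈ e a l n
  e-reciprocal a a′ zero    H zero zero eq = *-identityˡ 1#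
  e-reciprocal a a′ (suc n) H zero (suc .n) ≡.refl = combine₂
    (- a (suc n)) (e-reciprocal a a′ n (λ k k<n → H k (ℕ.m<n⇒m<1+n k<n)) 0 n ≡.refl)
    (- 1#) (e-beyond a (suc n) n (ℕ.n<1+n n))
        (solve (negProduct a n ∷ a (suc n) ∷ e a (suc n) n ∷ e a n n ∷ []))
  e-reciprocal a a′ (suc n) H (suc r) zero eq with ≡.trans (≡.sym (ℕ.+-identityʳ r)) (ℕ.suc-injective eq)
  ... | ≡.refl = combine₃
    1# (e-reciprocal a a′ n (λ k k<n → H k (ℕ.m<n⇒m<1+n k<n)) n 0 (ℕ.+-identityʳ n))
    (negProduct a n * - a (suc n)) (e-beyond a′ (suc n) n (ℕ.n<1+n n))
    (negProduct a n * e a′ n n) (H n (ℕ.n<1+n n))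
        (solve (negProduct a n ∷ a (suc n) ∷ e a′ (suc n) n ∷ a′ (suc n) ∷ e a′ n n ∷ []))
  e-reciprocal a a′ (suc n) H (suc r) (suc l) eq = combine₃
    (- a (suc n)) (e-reciprocal a a′ n H′ (suc r) l (≡.trans (≡.sym (ℕ.+-suc r l)) (ℕ.suc-injective eq)))
    1# (e-reciprocal a a′ n H′ r (suc l) (ℕ.suc-injective eq))
    (negProduct a n * e a′ r n) (H n (ℕ.n<1+n n))
        (identity (negProduct a n ∷ a (suc n) ∷ e a′ (suc r) n ∷ a′ (suc n) ∷ e a′ r n ∷ e a (suc l) n ∷ e a l n
          ∷ [])
        (λ x y z u v w p → x :* :- y :* (z :- u :* v) :- (w :- y :* p) := :- y :* (x :* z :- p) :+ num 1 :* (x :* v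
          :- w) :+ x :* v :* (y :* u :- num 1)))
    where
    H′ : ∀ k → k < n → a (suc k) * a′ (suc k) ≈ 1#
    H′ k k<n = H k (ℕ.m<n⇒m<1+n k<n)

  -- Isolates the one summand of a Newton identity that contains the constant coefficient g 0 = 1.
  -- With c = π² the others are negligible as products of two multiples of π, which turns the
  -- identity into a relation between one power sum and one symmetric polynomial.
  conv-leading : ∀ {c} f g r → (∀ i l → i ℕ.+ suc l ≡ r → c ∣ f i * g (suc l)) → c ∣ conv f g r - f r * g 0
  conv-leading f g zero    H = ∣-respʳ-≈ (sym (-‿inverseʳ _)) (_ ∣0)
  conv-leading f g (suc r) H = ∣-respʳ-≈ (combine₁ (- 1#) (conv-last f g r)
      (solve (conv f (λ x → g (suc x)) r ∷ f 0 ∷ g (suc r) ∷ conv (λ x → f (suc x)) g r ∷ f (suc r) ∷ g 0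
        ∷ [])))
    (conv-∣ f (g ∘ suc) r (λ i l eq → H i l (≡.trans (ℕ.+-suc i l) (≡.cong suc eq))))

  -- Binomial coefficients and Faulhaber's recursion

  binom : ℕ → ℕ → Carrier
  binom n k = ν (n C k)

  binom-n-0 : ∀ n → binom n 0 ≈ 1#
  binom-n-0 n = reflexive (≡.cong ν (≡.trans (nCk≡nC[n∸k] {0} {n} z≤n) (nCn≡1 n)))

  binom-n-n : ∀ n → binom n n ≈ 1#
  binom-n-n n = reflexive (≡.cong ν (nCn≡1 n))

  pascal : ∀ n k → binom (suc n) (suc k) ≈ binom n k + binom n (suc k)
  pascal n k = trans (reflexive (≡.cong ν (≡.sym (nCk+nC[k+1]≡[n+1]C[k+1] n k)))) (ν-+ (n C k) (n C suc k))

  absorption : ∀ n k → ν (suc k) * binom (suc n) (suc k) ≈ ν (suc n) * binom n k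
  absorption zero zero = combine₁ 1# (pascal 0 0) (solve [])
  absorption zero (suc k) = begin
    ν (suc (suc k)) * binom 1 (suc (suc k)) ≈⟨ *-congˡ (reflexive (≡.cong ν (k>n⇒nCk≡0 {1} {suc (suc k)} (s≤s (s≤s z≤n))))) ⟩
    ν (suc (suc k)) * 0#                    ≈⟨ zeroʳ _ ⟩
    0#                                      ≈⟨ zeroʳ (ν 1) ⟨
    ν 1 * 0#                                ≈⟨ *-congˡ (reflexive (≡.cong ν (k>n⇒nCk≡0 {0} {suc k} (s≤s z≤n)))) ⟨
    ν 1 * binom 0 (suc k)                   ∎
  absorption (suc n) zero = begin
    ν 1 * binom (suc (suc n)) 1             ≈⟨ *-identityˡ _ ⟩
    binom (suc (suc n)) 1                   ≡⟨ ≡.cong ν (nC1≡n (suc (suc n))) ⟩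
    ν (suc (suc n))                         ≈⟨ *-identityʳ _ ⟨
    ν (suc (suc n)) * 1#                    ≈⟨ *-congˡ (binom-n-0 (suc n)) ⟨
    ν (suc (suc n)) * binom (suc n) 0       ∎
  absorption (suc n) (suc k) = x-y≈0⇒x≈y _ _ (trans expand vanish)
    where
    b₀ b₁ b₂ : Carrier
    b₀ = binom (suc n) (suc k)
    b₁ = binom (suc n) (suc (suc k))
    b₂ = binom n k
    expand : ν (suc (suc k)) * binom (suc (suc n)) (suc (suc k)) - ν (suc (suc n)) * b₀
      ≈ ν (suc k) * b₀ + ν (suc (suc k)) * b₁ - ν (suc n) * b₀
    expand = combine₃ (ν (suc (suc k))) (pascal (suc n) (suc k)) b₀ (ν-suc (suc k)) (- b₀) (ν-suc (suc n))
        (identity (ν (suc k) ∷ binom (suc (suc n)) (suc (suc k)) ∷ ν (suc n) ∷ b₀ ∷ b₁ ∷ [])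
        (λ x y z u v → (x :+ num 1) :* y :- (z :+ num 1) :* u :- (x :* u :+ (x :+ num 1) :* v :- z :* u) := (x :+ num 1)
          :* (y :- (u :+ v)) :+ u :* (x :+ num 1 :- (num 1 :+ x)) :+ :- u :* (z :+ num 1 :- (num 1 :+ z))))
    vanish : ν (suc k) * b₀ + ν (suc (suc k)) * b₁ - ν (suc n) * b₀ ≈ 0#
    vanish = combine₃ 1# (absorption n k) 1# (absorption n (suc k)) (- ν (suc n)) (pascal n k)
        (identity (ν (suc k) ∷ b₀ ∷ b₁ ∷ ν (suc n) ∷ binom n k ∷ binom n (suc k) ∷ [])
        (λ x y z u v w → x :* y :+ (x :+ num 1) :* z :- u :* y :- num 0 := num 1 :* (x :* y :- u :* v) :+ num 1 :* ((x
          :+ num 1) :* z :- u :* w) :+ :- u :* (y :- (v :+ w))))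

  binomial : ∀ x n → (1# + x) ^ n ≈ 1# + Σ n (λ i → binom n i * x ^ i)
  binomial x zero    = sym (+-identityʳ 1#)
  binomial x (suc n) = begin
    (1# + x) * (1# + x) ^ n
      ≈⟨ *-congˡ (binomial x n) ⟩
    (1# + x) * (1# + s)
      ≈⟨ combine₃ (- x) head (- 1#) last 0# last
          (identity (x ∷ s ∷ Σ n (λ i → binom n (i ∸ 1) * x ^ (i ∸ 1)) ∷ binom n (suc n ∸ 1) ∷ x ^ (suc n ∸ 1)
            ∷ binom n (suc n) ∷ [])
          (λ x y z u v w → (num 1 :+ x) :* (num 1 :+ y) :- (num 1 :+ (x :* (z :+ u :* v) :+ (y :+ w :* (x :* v)))) :=
            :- x :* (z :+ u :* v :- (num 1 :+ y)) :+ :- (num 1) :* (y :+ w :* (x :* v) :- y) :+ num 0 :* (y :+ w :* (x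
            :* v) :- y))) ⟩
    1# + (x * Σ (suc n) (λ i → binom n (i ∸ 1) * x ^ (i ∸ 1)) + Σ (suc n) (λ i → binom n i * x ^ i))
      ≈⟨ +-congˡ (trans (+-congʳ (Σ-*ˡ (suc n) x _)) (Σ-+ (suc n) _ _)) ⟩
    1# + Σ (suc n) (λ i → x * (binom n (i ∸ 1) * x ^ (i ∸ 1)) + binom n i * x ^ i)
      ≈⟨ +-congˡ (Σ-cong (suc n) (λ k _ → combine₁ (- x ^ suc k) (pascal n k)
          (solve (x ∷ binom n (suc k ∸ 1) ∷ x ^ (suc k ∸ 1) ∷ binom n (suc k) ∷ binom (suc n) (suc k) ∷ [])))) ⟩
    1# + Σ (suc n) (λ i → binom (suc n) i * x ^ i)
      ∎
    where
    s : Carrier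
    s = Σ n (λ i → binom n i * x ^ i)
    head : Σ (suc n) (λ i → binom n (i ∸ 1) * x ^ (i ∸ 1)) ≈ 1# + s
    head = trans (Σ-head n _) (+-congʳ (trans (*-identityʳ _) (binom-n-0 n)))
    last : Σ (suc n) (λ i → binom n i * x ^ i) ≈ s
    last = trans (+-congˡ (trans (*-congʳ (reflexive (≡.cong ν (k>n⇒nCk≡0 {n} {suc n} (ℕ.n<1+n n))))) (zeroˡ _))) (+-identityʳ s)

  -- Telescoping (j+1)^{n+1} - j^{n+1} over 1 ≤ j ≤ N. The constant terms of the binomial expansions
  -- add up to N, and the 1 from the lower end of the telescope makes this `ν (suc N)`.
  faulhaber : ∀ N n → ν (suc N) ^ suc n ≈ ν (suc N) + Σ n (λ i → binom (suc n) i * psum ν i N)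
  faulhaber N n = combine₂ 1# (trans (sym (Σ-telescope N (λ j → ν (suc j) ^ suc n))) expand)
    (- 1#) (ν-suc N) (simplify (ν (suc N) ^ suc n) (ν (suc N)) (ν N) (Σ n (λ i → binom (suc n) i * psum ν i N)) one)
    where
    one : 1# ^ suc n ≈ 1#
    one = one^ (suc n)
      where
      one^ : ∀ n → 1# ^ n ≈ 1#
      one^ zero    = refl
      one^ (suc n) = trans (*-identityˡ _) (one^ n)
    simplify : ∀ a b c d {x} → x ≈ 1# → a - (b + d) ≈ 1# * ((a - x) - (c + d)) + - 1# * (b - (1# + c))
    simplify a b c d {x} h = combine₁ 1# h (solve (a ∷ b ∷ d ∷ x ∷ c ∷ []))
    expand : Σ N (λ j → ν (suc j) ^ suc n - ν (suc (j ∸ 1)) ^ suc n)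
               ≈ ν N + Σ n (λ i → binom (suc n) i * psum ν i N)
    expand = begin
      Σ N (λ j → ν (suc j) ^ suc n - ν (suc (j ∸ 1)) ^ suc n)
        ≈⟨ Σ-cong N (λ k _ → combine₃ 1# (^-congˡ (suc n) (ν-suc (suc k))) 1# (binomial (ν (suc k)) (suc n))
                               (ν (suc k) ^ suc n) (binom-n-n (suc n))
                                   (identity (ν (suc k) ∷ ν (suc (suc k)) ^ n ∷ ν (suc (suc k ∸ 1)) ^ n
                                     ∷ Σ n (λ i → binom (suc n) i * ν (suc k) ^ i) ∷ (1# + ν (suc k)) ^ n
                                     ∷ binom (suc n) (suc n) ∷ [])
                                   (λ x y z u v w → (x :+ num 1) :* y :- x :* z :- (num 1 :+ u) := num 1 :* ((x :+ num 1)
                                     :* y :- (num 1 :+ x) :* v) :+ num 1 :* ((num 1 :+ x) :* v :- (num 1 :+ (u :+ w :* (x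
                                     :* z)))) :+ x :* z :* (w :- num 1)))) ⟩
      Σ N (λ j → 1# + Σ n (λ i → binom (suc n) i * ν j ^ i))
        ≈⟨ Σ-+ N _ _ ⟨
      Σ N (λ _ → 1#) + Σ N (λ j → Σ n (λ i → binom (suc n) i * ν j ^ i))
        ≈⟨ +-cong (Σ-const N) (Σ-swap N n (λ j i → binom (suc n) i * ν j ^ i)) ⟩
      ν N + Σ n (λ i → Σ N (λ j → binom (suc n) i * ν j ^ i))
        ≈⟨ +-congˡ (Σ-cong n (λ i _ → sym (Σ-*ˡ N (binom (suc n) (suc i)) (λ j → ν j ^ suc i)))) ⟩
      ν N + Σ n (λ i → binom (suc n) i * psum ν i N)
        ∎

  binom-suc-n : ∀ n → binom (suc n) n ≈ ν (suc n)
  binom-suc-n zero    = binom-n-0 1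
  binom-suc-n (suc n) = begin
    binom (suc (suc n)) (suc n)             ≈⟨ pascal (suc n) n ⟩
    binom (suc n) n + binom (suc n) (suc n) ≈⟨ +-cong (binom-suc-n n) (binom-n-n (suc n)) ⟩
    ν (suc n) + 1#                          ≈⟨ +-comm _ _ ⟩
    1# + ν (suc n)                          ≈⟨ ν-suc (suc n) ⟨
    ν (suc (suc n))                         ∎


  tri : ℕ → ℕ
  tri zero    = 0
  tri (suc n) = suc n ℕ.+ tri n

  ν-tri-suc : ∀ s → ν (tri (suc s)) ≈ 1# + ν s + ν (tri s)
  ν-tri-suc s = trans (ν-+ (suc s) (tri s)) (+-congʳ (ν-suc s))

  2*tri : ∀ s → ν 2 * ν (tri s) ≈ ν s * (1# + ν s)
  2*tri zero    = (solve [])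
  2*tri (suc s) = combine₃ (ν 2) (ν-tri-suc s) 1# (2*tri s) (- (ν (suc s) + ν s + ν 2)) (ν-suc s)
      (solve (ν (tri (suc s)) ∷ ν (suc s) ∷ ν s ∷ ν (tri s) ∷ []))

  -- The sums Φ and their change under α ↦ α + 1

  module Inverses (N : ℕ) (inv : ℕ → Carrier)
    (inv-spec : ∀ k → k < N → ν (suc k) * inv (suc k) ≈ 1#) where

    -- (α)ₖ / k!
    rising : Carrier → ℕ → Carrier
    rising α zero    = 1#
    rising α (suc k) = rising α k * (α + ν k) * inv (suc k)

    rising-suc : ∀ α k → rising (α + 1#) k * α ≈ rising α k * (α + ν k)
    rising-suc α zero    = solve (α ∷ [])
    rising-suc α (suc k) = combine₂
      ((α + 1# + ν k) * inv (suc k)) (rising-suc α k)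
      (- (rising α k * (α + ν k) * inv (suc k))) (ν-suc k)
          (identity (rising (α + 1#) k ∷ α ∷ ν k ∷ inv (suc k) ∷ rising α k ∷ ν (suc k) ∷ [])
          (λ x y z u v w → x :* (y :+ num 1 :+ z) :* u :* y :- v :* (y :+ z) :* u :* (y :+ w) := (y :+ num 1 :+ z)
            :* u :* (x :* y :- v :* (y :+ z)) :+ :- (v :* (y :+ z) :* u) :* (w :- (num 1 :+ z))))

    rising-cong : ∀ {x y} k → x ≈ y → rising x k ≈ rising y k
    rising-cong zero    eq = refl
    rising-cong (suc k) eq = *-congʳ (*-cong (rising-cong k eq) (+-congʳ eq))

    -- Φ is the sum of the header; α φᵣ(α) + φᵣ₋₁(α) telescopes (φ-suc).
    Φ φ : ℕ → Carrier → Carrier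
    Φ r α = Σ N (λ k → rising α k * inv k * h inv r k)
    φ r α = Σ N (λ k → rising α k * h inv r k)

    Φ-cong : ∀ r {x y} → x ≈ y → Φ r x ≈ Φ r y
    Φ-cong r eq = Σ-cong N (λ k _ → *-congʳ (*-congʳ (rising-cong (suc k) eq)))

    -- α·((α+1)ₖ - (α)ₖ) = k·(α)ₖ, and the factor k cancels the 1/k in Φ.
    Φ-diff : ∀ r α → α * (Φ r (α + 1#) - Φ r α) ≈ φ r α
    Φ-diff r α = begin
      α * (Φ r (α + 1#) - Φ r α)    ≈⟨ *-congˡ (Σ-- N _ _) ⟩
      α * Σ N (λ k → rising (α + 1#) k * inv k * h inv r k - rising α k * inv k * h inv r k)
                                    ≈⟨ Σ-*ˡ N α _ ⟩
      Σ N (λ k → α * (rising (α + 1#) k * inv k * h inv r k - rising α k * inv k * h inv r k))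
                                    ≈⟨ Σ-cong N (λ k k<N → combine₂
                                         (inv (suc k) * h inv r (suc k)) (rising-suc α (suc k))
                                         (rising α (suc k) * h inv r (suc k)) (inv-spec k k<N)
                                             (identity (α ∷ rising (α + 1#) k ∷ ν k ∷ inv (suc k)
                                               ∷ h inv r (suc k) ∷ rising α k ∷ ν (suc k) ∷ [])
                                             (λ x y z u v w p → x :* (y :* (x :+ num 1 :+ z) :* u :* u :* v :- w
                                               :* (x :+ z) :* u :* u :* v) :- w :* (x :+ z) :* u :* v := u :* v
                                               :* (y :* (x :+ num 1 :+ z) :* u :* x :- w :* (x :+ z) :* u :* (x :+ p))
                                               :+ w :* (x :+ z) :* u :* v :* (p :* u :- num 1)))) ⟩
      φ r α                         ∎

    φ-zero : ∀ α n → n ≤ N → α * Σ n (λ k → rising α k * 1#) ≈ (α + ν n) * rising α n - α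
    φ-zero α zero    _   = solve (α ∷ [])
    φ-zero α (suc n) n<N = combine₂ 1# (φ-zero α n (ℕ.<⇒≤ n<N))
      (- (rising α n * (α + ν n))) (inv-spec n n<N)
          (identity (α ∷ Σ n (λ k → rising α k * 1#) ∷ rising α n ∷ ν n ∷ inv (suc n) ∷ ν (suc n) ∷ [])
          (λ x y z u v w → x :* (y :+ z :* (x :+ u) :* v :* num 1) :- ((x :+ w) :* (z :* (x :+ u) :* v) :- x) := num 1
            :* (x :* y :- ((x :+ u) :* z :- x)) :+ :- (z :* (x :+ u)) :* (w :* v :- num 1)))

    -- Summation by parts with u k = (α + k)·`rising α k`: one has u k - u (k-1) = α·`rising α k`
    -- and u (k-1) = k·`rising α k`, whose factor k cancels the 1/k in the increment of h.
    φ-suc : ∀ r α n → n ≤ N →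
            α * Σ n (λ k → rising α k * h inv (suc r) k) + Σ n (λ k → rising α k * h inv r k)
              ≈ (α + ν n) * rising α n * h inv (suc r) n
    φ-suc r α zero    _   = solve (α ∷ [])
    φ-suc r α (suc n) n<N = combine₂ 1# (φ-suc r α n (ℕ.<⇒≤ n<N))
      (- (rising α n * (α + ν n) * h inv (suc r) (suc n))) (inv-spec n n<N)
          (identity (α ∷ Σ n (λ k → rising α k * h inv (suc r) k) ∷ rising α n ∷ ν n ∷ inv (suc n)
            ∷ h inv (suc r) n ∷ h inv r (suc n) ∷ Σ n (λ k → rising α k * h inv r k) ∷ ν (suc n) ∷ [])
          (λ x y z u v w p q s → x :* (y :+ z :* (x :+ u) :* v :* (w :+ p :* v)) :+ (q :+ z :* (x :+ u) :* v :* p)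
            :- (x :+ s) :* (z :* (x :+ u) :* v) :* (w :+ p :* v) := num 1 :* (x :* y :+ q :- (x :+ u) :* z :* w)
            :+ :- (z :* (x :+ u) :* (w :+ p :* v)) :* (s :* v :- num 1)))

    -- Here β = -1/α. By `rising-suc` the boundary term of `φ-suc` is α times a product assumed to
    -- vanish, so α φᵢ₊₁ = -φᵢ and the φᵢ form a geometric progression with ratio β.
    Φ-shift : ∀ r α β → α * β ≈ - 1# →
              (∀ i → i < r → rising (α + 1#) N * h inv (suc i) N ≈ 0#) →
              Φ r (α + 1#) - Φ r α ≈ β ^ suc r * (1# - rising (α + 1#) N)
    Φ-shift r α β αβ vanish = combine₃
      (- β) (Φ-diff r α) (- β) (φ-closed r ℕ.≤-refl) (Φ r (α + 1#) - Φ r α) αβ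
          (identity (Φ r (α + 1#) ∷ Φ r α ∷ β ∷ β ^ r ∷ rising (α + 1#) N ∷ α ∷ φ r α ∷ [])
          (λ x y z u v w p → x :- y :- z :* u :* (num 1 :- v) := :- z :* (w :* (x :- y) :- p) :+ :- z :* (p :- u
            :* (v :- num 1)) :+ (x :- y) :* (w :* z :- :- (num 1))))
      where
      c = rising (α + 1#) N
      φ-closed : ∀ i → i ≤ r → φ i α ≈ β ^ i * (c - 1#)
      φ-closed zero    _   = combine₃ (- β) (φ-zero α N ℕ.≤-refl)
        (φ 0 α - c + 1#) αβ β (rising-suc α N) (identity (φ zero α ∷ c ∷ β ∷ α ∷ ν N ∷ rising α N ∷ [])
            (λ x y z u v w → x :- num 1 :* (y :- num 1) := :- z :* (u :* x :- ((u :+ v) :* w :- u)) :+ (x :- y :+ num 1)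
              :* (u :* z :- :- (num 1)) :+ z :* (y :* u :- w :* (u :+ v))))
      φ-closed (suc i) i<r = combine₃
        (- β) recursion
        (φ (suc i) α) αβ β (φ-closed i (ℕ.<⇒≤ i<r)) (identity (φ (suc i) α ∷ β ∷ β ^ i ∷ c ∷ α ∷ φ i α ∷ [])
            (λ x y z u v w → x :- y :* z :* (u :- num 1) := :- y :* (v :* x :+ w :- num 0) :+ x :* (v :* y :- :- (num 1))
              :+ y :* (w :- z :* (u :- num 1))))
        where
        recursion : α * φ (suc i) α + φ i α ≈ 0#
        recursion = combine₃ 1# (φ-suc i α N ℕ.≤-refl)
          (- h inv (suc i) N) (rising-suc α N) α (vanish i i<r)
              (identity (α ∷ φ (suc i) α ∷ φ i α ∷ ν N ∷ rising α N ∷ h inv (suc i) N ∷ rising (α + 1#) N ∷ [])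
              (λ x y z u v w p → x :* y :+ z :- num 0 := num 1 :* (x :* y :+ z :- (x :+ u) :* v :* w) :+ :- w :* (p
                :* x :- v :* (x :+ u)) :+ x :* (p :* w :- num 0)))

    -- The sums Ψ and their change under α ↦ α + 1

    sq : ℕ → Carrier
    sq k = inv k * inv k

    sq-spec : ∀ k → k < N → ν (suc k) * ν (suc k) * sq (suc k) ≈ 1#
    sq-spec k k<N = combine₁ (1# + ν (suc k) * inv (suc k)) (inv-spec k k<N)
        (solve (ν (suc k) ∷ inv (suc k) ∷ []))

    -- (α)ₖ(1-α)ₖ / k!², (α)ₖ(-α)ₖ / k!² and (1+α)ₖ(1-α)ₖ / k!²
    b d Γ : Carrier → ℕ → Carrier
    b α zero    = 1#
    b α (suc k) = b α k * ((α + ν k) * (ν (suc k) - α)) * sq (suc k)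
    d α zero    = 1#
    d α (suc k) = d α k * (ν k * ν k - α * α) * sq (suc k)
    Γ α zero    = 1#
    Γ α (suc k) = Γ α k * (ν (suc k) * ν (suc k) - α * α) * sq (suc k)

    b-cong : ∀ {x y} k → x ≈ y → b x k ≈ b y k
    b-cong zero    eq = refl
    b-cong (suc k) eq = *-congʳ (*-cong (b-cong k eq) (*-cong (+-congʳ eq) (+-congˡ (-‿cong eq))))

    Γ-cong : ∀ {x y} k → x ≈ y → Γ x k ≈ Γ y k
    Γ-cong zero    eq = refl
    Γ-cong (suc k) eq = *-congʳ (*-cong (Γ-cong k eq) (+-congˡ (-‿cong (*-cong eq eq))))

    -- Together with `b-suc-d` this writes b(α) and b(α+1) as multiples of the same d; their
    -- difference is 2k·d/α, and k cancels the 1/k in Ψ.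
    b-d : ∀ α k → α * b α k ≈ d α k * (α - ν k)
    b-d α zero    = solve (α ∷ [])
    b-d α (suc k) = combine₁ ((α + ν k) * (ν (suc k) - α) * sq (suc k)) (b-d α k)
        (identity (α ∷ b α k ∷ ν k ∷ ν (suc k) ∷ inv (suc k) ∷ d α k ∷ [])
        (λ x y z u v w → x :* (y :* ((x :+ z) :* (u :- x)) :* (v :* v)) :- w :* (z :* z :- x :* x) :* (v :* v)
          :* (x :- u) := (x :+ z) :* (u :- x) :* (v :* v) :* (x :* y :- w :* (x :- z))))

    b-suc-d : ∀ α k → α * b (α + 1#) k ≈ d α k * (α + ν k)
    b-suc-d α zero    = solve (α ∷ [])
    b-suc-d α (suc k) = combine₂ ((α + 1# + ν k) * (ν (suc k) - (α + 1#)) * sq (suc k)) (b-suc-d α k)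
      (d α k * (α + ν k) * (1# + α + α) * sq (suc k)) (ν-suc k)
          (identity (α ∷ b (α + 1#) k ∷ ν k ∷ ν (suc k) ∷ inv (suc k) ∷ d α k ∷ [])
          (λ x y z u v w → x :* (y :* ((x :+ num 1 :+ z) :* (u :- (x :+ num 1))) :* (v :* v)) :- w :* (z :* z :- x
            :* x) :* (v :* v) :* (x :+ u) := (x :+ num 1 :+ z) :* (u :- (x :+ num 1)) :* (v :* v) :* (x :* y :- w :* (x
            :+ z)) :+ w :* (x :+ z) :* (num 1 :+ x :+ x) :* (v :* v) :* (u :- (num 1 :+ z))))

    Γ-d : ∀ α k → (ν k * ν k - α * α) * d α k ≈ - (α * α) * Γ α k
    Γ-d α zero    = solve (α ∷ [])
    Γ-d α (suc k) = combine₁ ((ν (suc k) * ν (suc k) - α * α) * sq (suc k)) (Γ-d α k)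
        (identity (ν (suc k) ∷ α ∷ d α k ∷ ν k ∷ inv (suc k) ∷ Γ α k ∷ [])
        (λ x y z u v w → (x :* x :- y :* y) :* (z :* (u :* u :- y :* y) :* (v :* v)) :- :- (y :* y) :* (w :* (x
          :* x :- y :* y) :* (v :* v)) := (x :* x :- y :* y) :* (v :* v) :* ((u :* u :- y :* y) :* z :- :- (y :* y)
          :* w)))

    -- Ψ is the sum of the header; ψᵣ₋₁(α) - α² ψᵣ(α) telescopes (ψ-suc).
    Ψ ψ : ℕ → Carrier → Carrier
    Ψ r α = Σ N (λ k → b α k * inv k * h sq r k)
    ψ r α = Σ N (λ k → d α k * h sq r k)

    Ψ-cong : ∀ r {x y} → x ≈ y → Ψ r x ≈ Ψ r y
    Ψ-cong r eq = Σ-cong N (λ k _ → *-congʳ (*-congʳ (b-cong (suc k) eq)))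

    Ψ-diff : ∀ r α → α * (Ψ r (α + 1#) - Ψ r α) ≈ ν 2 * ψ r α
    Ψ-diff r α = begin
      α * (Ψ r (α + 1#) - Ψ r α)    ≈⟨ *-congˡ (Σ-- N _ _) ⟩
      α * Σ N (λ k → b (α + 1#) k * inv k * h sq r k - b α k * inv k * h sq r k)
                                    ≈⟨ Σ-*ˡ N α _ ⟩
      Σ N (λ k → α * (b (α + 1#) k * inv k * h sq r k - b α k * inv k * h sq r k))
                                    ≈⟨ Σ-cong N (λ k k<N → combine₃
                                         (inv (suc k) * h sq r (suc k)) (b-suc-d α (suc k))
                                         (- (inv (suc k) * h sq r (suc k))) (b-d α (suc k))
                                         (ν 2 * d α (suc k) * h sq r (suc k)) (inv-spec k k<N)
                                             (identity (α ∷ b (α + 1#) k ∷ ν k ∷ ν (suc k) ∷ inv (suc k)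
                                               ∷ h sq r (suc k) ∷ b α k ∷ d α k ∷ [])
                                             (λ x y z u v w p q → x :* (y :* ((x :+ num 1 :+ z) :* (u :- (x :+ num 1)))
                                               :* (v :* v) :* v :* w :- p :* ((x :+ z) :* (u :- x)) :* (v :* v)
                                               :* v :* w) :- num 2 :* (q :* (z :* z :- x :* x) :* (v :* v) :* w)
                                               := v :* w :* (x :* (y :* ((x :+ num 1 :+ z) :* (u :- (x :+ num 1)))
                                               :* (v :* v)) :- q :* (z :* z :- x :* x) :* (v :* v) :* (x :+ u))
                                               :+ :- (v :* w) :* (x :* (p :* ((x :+ z) :* (u :- x)) :* (v :* v))
                                               :- q :* (z :* z :- x :* x) :* (v :* v) :* (x :- u)) :+ num 2 :* (q
                                               :* (z :* z :- x :* x) :* (v :* v)) :* w :* (u :* v :- num 1)))) ⟩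
      Σ N (λ k → ν 2 * (d α k * h sq r k)) ≈⟨ Σ-*ˡ N (ν 2) _ ⟨
      ν 2 * ψ r α                   ∎

    ψ-zero : ∀ α n → n ≤ N → - (α * α) * Σ n (λ k → d α k * 1#) ≈ (ν n * ν n - α * α) * d α n + α * α
    ψ-zero α zero    _   = solve (α ∷ [])
    ψ-zero α (suc n) n<N = combine₂ 1# (ψ-zero α n (ℕ.<⇒≤ n<N))
      (- (d α n * (ν n * ν n - α * α))) (sq-spec n n<N)
          (identity (α ∷ Σ n (λ k → d α k * 1#) ∷ d α n ∷ ν n ∷ inv (suc n) ∷ ν (suc n) ∷ [])
          (λ x y z u v w → :- (x :* x) :* (y :+ z :* (u :* u :- x :* x) :* (v :* v) :* num 1) :- ((w :* w :- x :* x)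
            :* (z :* (u :* u :- x :* x) :* (v :* v)) :+ x :* x) := num 1 :* (:- (x :* x) :* y :- ((u :* u :- x :* x)
            :* z :+ x :* x)) :+ :- (z :* (u :* u :- x :* x)) :* (w :* w :* (v :* v) :- num 1)))

    -- Summation by parts with u k = (k² - α²)·`d α k`: now u k - u (k-1) = -α²·`d α k` and u (k-1)
    -- = k²·`d α k`, which cancels the 1/k² in the increment of h.
    ψ-suc : ∀ r α n → n ≤ N →
            Σ n (λ k → d α k * h sq r k) - α * α * Σ n (λ k → d α k * h sq (suc r) k)
              ≈ (ν n * ν n - α * α) * d α n * h sq (suc r) n
    ψ-suc r α zero    _   = solve (α ∷ [])
    ψ-suc r α (suc n) n<N = combine₂ 1# (ψ-suc r α n (ℕ.<⇒≤ n<N))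
      (- (d α n * (ν n * ν n - α * α) * h sq (suc r) (suc n))) (sq-spec n n<N)
          (identity (Σ n (λ k → d α k * h sq r k) ∷ d α n ∷ ν n ∷ α ∷ inv (suc n) ∷ h sq r (suc n)
            ∷ Σ n (λ k → d α k * h sq (suc r) k) ∷ h sq (suc r) n ∷ ν (suc n) ∷ [])
          (λ x y z u v w p q s → x :+ y :* (z :* z :- u :* u) :* (v :* v) :* w :- u :* u :* (p :+ y :* (z :* z
            :- u :* u) :* (v :* v) :* (q :+ w :* (v :* v))) :- (s :* s :- u :* u) :* (y :* (z :* z :- u :* u) :* (v
            :* v)) :* (q :+ w :* (v :* v)) := num 1 :* (x :- u :* u :* p :- (z :* z :- u :* u) :* y :* q) :+ :- (y
            :* (z :* z :- u :* u) :* (q :+ w :* (v :* v))) :* (s :* s :* (v :* v) :- num 1)))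

    Ψ-shift : ∀ r α β → α * β ≈ - 1# → (∀ i → i < r → Γ α N * h sq (suc i) N ≈ 0#) →
              Ψ r (α + 1#) - Ψ r α ≈ ν 2 * β ^ suc (r ℕ.+ r) * (1# - Γ α N)
    Ψ-shift r α β αβ vanish = combine₃
      (- β) (Ψ-diff r α) (- (ν 2 * β)) (ψ-closed r ℕ.≤-refl) (Ψ r (α + 1#) - Ψ r α) αβ
          (identity (Ψ r (α + 1#) ∷ Ψ r α ∷ β ∷ β ^ (r ℕ.+ r) ∷ Γ α N ∷ α ∷ ψ r α ∷ [])
          (λ x y z u v w p → x :- y :- num 2 :* (z :* u) :* (num 1 :- v) := :- z :* (w :* (x :- y) :- num 2 :* p) :+
            :- (num 2 :* z) :* (p :- u :* (v :- num 1)) :+ (x :- y) :* (w :* z :- :- (num 1))))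
      where
      ψ-closed : ∀ i → i ≤ r → ψ i α ≈ β ^ (i ℕ.+ i) * (Γ α N - 1#)
      ψ-closed zero    _   = combine₃ (- (β * β)) (ψ-zero α N ℕ.≤-refl) (- (β * β)) (Γ-d α N)
        -- The factor αβ - 1 turns αβ = -1 into (αβ)² = 1.
        ((α * β - 1#) * (Γ α N - 1# - ψ 0 α)) αβ (identity (ψ zero α ∷ Γ α N ∷ β ∷ α ∷ ν N ∷ d α N ∷ [])
            (λ x y z u v w → x :- num 1 :* (y :- num 1) := :- (z :* z) :* (:- (u :* u) :* x :- ((v :* v :- u :* u)
              :* w :+ u :* u)) :+ :- (z :* z) :* ((v :* v :- u :* u) :* w :- :- (u :* u) :* y) :+ (u :* z :- num 1)
              :* (y :- num 1 :- x) :* (u :* z :- :- (num 1))))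
      ψ-closed (suc i) i<r rewrite ℕ.+-suc i i = combine₃
        (- (β * β)) recursion
        (β * β) (ψ-closed i (ℕ.<⇒≤ i<r))
        ((1# - α * β) * ψ (suc i) α) αβ
            (identity (Σ N (λ k → d α k * Σ k (λ j → h (λ k₁ → inv k₁ * inv k₁) i j * (inv j * inv j))) ∷ β
              ∷ β ^ (i ℕ.+ i) ∷ Γ α N ∷ ψ i α ∷ α ∷ [])
            (λ x y z u v w → x :- y :* (y :* z) :* (u :- num 1) := :- (y :* y) :* (v :- w :* w :* x :- num 0) :+ y
              :* y :* (v :- z :* (u :- num 1)) :+ (num 1 :- w :* y) :* x :* (w :* y :- :- (num 1))))
        where
        recursion : ψ i α - α * α * ψ (suc i) α ≈ 0#
        recursion = combine₃ 1# (ψ-suc i α N ℕ.≤-refl)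
          (h sq (suc i) N) (Γ-d α N) (- (α * α)) (vanish i i<r)
              (identity (ψ i α ∷ α ∷ ψ (suc i) α ∷ ν N ∷ d α N ∷ h sq (suc i) N ∷ Γ α N ∷ [])
              (λ x y z u v w p → x :- y :* y :* z :- num 0 := num 1 :* (x :- y :* y :* z :- (u :* u :- y :* y) :* v
                :* w) :+ w :* ((u :* u :- y :* y) :* v :- :- (y :* y) :* p) :+ :- (y :* y) :* (p :* w :- num 0)))

    -- Power sums of 1, ..., p-1 and of their inverses modulo π², where π is p

    π π² : Carrier
    π  = ν (suc N)
    π² = π * π

    ∣-cancel : ∀ {c x} k → k < N → c ∣ ν (suc k) * x → c ∣ x
    ∣-cancel {c} {x} k k<N H = ∣-respʳ-≈ (combine₁ x (inv-spec k k<N)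
        (solve (inv (suc k) ∷ ν (suc k) ∷ x ∷ []))) (∣-*ˡ (inv (suc k)) H)

    π²∣⇒π∣ : ∀ {x} → π² ∣ x → π ∣ x
    π²∣⇒π∣ {x} (q , eq) = q * π , combine₁ 1# eq (solve (q ∷ π ∷ x ∷ []))

    h-divisible : ∀ a {c} r → r < N → (∀ i → i ≤ r → c ∣ psum a (suc i) N) → c ∣ h a (suc r) N
    h-divisible a r r<N H = ∣-cancel r r<N (∣-respʳ-≈ (sym (newton-h a N r))
      (conv-∣ _ _ r (λ i l i+l≡r → ∣-*ʳ (h a l N) (H i (ℕ.m+n≤o⇒m≤o i (ℕ.≤-reflexive i+l≡r))))))

    -- Every summand of Newton's identity except the power sum of degree r + 1 is a power sum times
    -- a homogeneous polynomial of positive degree, both multiples of π.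
    h-leading : ∀ a r → r < N → (∀ i → i < r → π ∣ psum a (suc i) N) →
                π² ∣ ν (suc r) * h a (suc r) N - psum a (suc r) N
    h-leading a r r<N H = ∣-respʳ-≈ (combine₁ (- 1#) (newton-h a N r)
        (solve (conv (λ i → psum a (suc i) N) (λ l → h a l N) r ∷ psum a (suc r) N ∷ ν (suc r) ∷ h a (suc r) N
          ∷ [])))
      (conv-leading (λ i → psum a (suc i) N) (λ l → h a l N) r λ i l eq →
        ∣-* (H i (i<r i l eq)) (h-divisible a l (ℕ.≤-<-trans (ℕ.<⇒≤ (l<r i l eq)) r<N)
          (λ j j≤l → H j (ℕ.≤-<-trans j≤l (l<r i l eq)))))
      where
      i<r : ∀ i l → i ℕ.+ suc l ≡ r → i < r
      i<r i l ≡.refl = ℕ.m<m+n i (s≤s z≤n)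
      l<r : ∀ i l → i ℕ.+ suc l ≡ r → l < r
      l<r i l ≡.refl = ℕ.m≤n+m (suc l) i

    P H : ℕ → Carrier
    P i = psum ν i N
    H i = psum inv i N

    module _ (B : ℕ → Carrier)
      (B-rec : ∀ n → suc n < N → 1# + Σ (suc n) (λ i → binom (suc (suc n)) i * B i) ≈ 0#) where

      -- Subtracting π times Bernoulli's recursion from Faulhaber's leaves Σ C(n+2,i)·(Pᵢ - πBᵢ) =
      -- π^{n+2}, with i from 1 to n+1. All summands but the last are multiples of π² by induction,
      -- and the coefficient n + 2 ≤ N of the last is a unit.
      P-bernoulli-below : ∀ n → n < N → ∀ k → k < n → π² ∣ P (suc k) - π * B (suc k)
      P-bernoulli-below (suc n) n<N k k<n with ℕ.m≤n⇒m<n∨m≡n (ℕ.≤-pred k<n)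
      ... | inj₁ k<n′ = P-bernoulli-below n (ℕ.<-trans (ℕ.n<1+n n) n<N) k k<n′
      ... | inj₂ ≡.refl = ∣-cancel (suc n) n<N (∣-respʳ-≈ isolate
              (∣-+ (π ^ n , *-comm (π ^ n) π² ) (∣-neg below)))
        where
        δ : ℕ → Carrier
        δ i = P i - π * B i
        below : π² ∣ Σ n (λ i → binom (suc (suc n)) i * δ i)
        below = ∣-Σ n (λ j j<n → ∣-*ˡ _ (P-bernoulli-below n (ℕ.<-trans (ℕ.n<1+n n) n<N) j j<n))
        difference : Σ (suc n) (λ i → binom (suc (suc n)) i * P i) - π * Σ (suc n) (λ i → binom (suc (suc n)) i * B i)
                       ≈ Σ (suc n) (λ i → binom (suc (suc n)) i * δ i)
        difference = trans (+-congˡ (-‿cong (Σ-*ˡ (suc n) π _))) (trans (Σ-- (suc n) _ _)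
          (Σ-cong (suc n) (λ j _ → distribute (binom (suc (suc n)) (suc j)) (P (suc j)) (B (suc j)))))
          where
          distribute : ∀ b x y → b * x - π * (b * y) ≈ b * (x - π * y)
          distribute b x y = solve (b ∷ x ∷ π ∷ y ∷ [])
        isolate : π² * π ^ n - Σ n (λ i → binom (suc (suc n)) i * δ i) ≈ ν (suc (suc n)) * δ (suc n)
        isolate = assemble (π ^ n) (Σ (suc n) (λ i → binom (suc (suc n)) i * P i))
          (Σ (suc n) (λ i → binom (suc (suc n)) i * B i)) (Σ n (λ i → binom (suc (suc n)) i * δ i))
          (binom (suc (suc n)) (suc n)) (ν (suc (suc n))) (δ (suc n))
          (faulhaber N (suc n)) difference (B-rec n n<N) (binom-suc-n (suc n))
          where
          assemble : ∀ q sP sB sD b c d → π * (π * q) ≈ π + sP → sP - π * sB ≈ sD + b * d → 1# + sB ≈ 0# → b ≈ c →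
                     π² * q - sD ≈ c * d
          assemble q sP sB sD b c d h₁ h₂ h₃ h₄ = combine₄ 1# h₁ 1# h₂ π h₃ d h₄
              (identity (π ∷ q ∷ sD ∷ c ∷ d ∷ sP ∷ sB ∷ b ∷ [])
              (λ x y z u v w p q → x :* x :* y :- z :- u :* v := num 1 :* (x :* (x :* y) :- (x :+ w)) :+ num 1 :* (w
                :- x :* p :- (z :+ q :* v)) :+ x :* (num 1 :+ p :- num 0) :+ v :* (q :- u)))

      P-bernoulli : ∀ k → suc k < N → π² ∣ P (suc k) - π * B (suc k)
      P-bernoulli k k<N = P-bernoulli-below (suc k) k<N k (ℕ.n<1+n k)

      π∣P : ∀ k → suc k < N → π ∣ P (suc k)
      π∣P k k<N = ∣-respʳ-≈ (recover (P (suc k)) (π * B (suc k)))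
        (∣-+ (π²∣⇒π∣ (P-bernoulli k k<N)) (B (suc k) , *-comm (B (suc k)) π))
        where
        recover : ∀ x y → (x - y) + y ≈ x
        recover x y = solve (x ∷ y ∷ [])

      E E⁻ : ℕ → Carrier
      E  r = e ν r N
      E⁻ r = e inv r N

      π∣E : ∀ r → suc r < N → π ∣ E (suc r)
      π∣E r r<N = ∣-cancel r (ℕ.<⇒≤ r<N) (∣-respʳ-≈ (sym (newton-e ν N r)) (conv-∣ _ _ r λ i l eq →
        ∣-*ʳ (E l) (∣-neg (π∣P i (ℕ.≤-<-trans (s≤s (ℕ.m+n≤o⇒m≤o i (ℕ.≤-reflexive eq))) r<N)))))

      E-leading : ∀ r → suc r < N → π² ∣ ν (suc r) * E (suc r) + P (suc r)
      E-leading r r<N = ∣-respʳ-≈ (combine₁ (- 1#) (newton-e ν N r)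
          (solve (conv (λ i → - psum ν (suc i) N) (λ l → e ν l N) r ∷ psum ν (suc r) N ∷ ν (suc r) ∷ E (suc r)
            ∷ [])))
        (conv-leading (λ i → - psum ν (suc i) N) (λ l → e ν l N) r λ i l eq →
          ∣-* (∣-neg (π∣P i (ℕ.≤-<-trans (s≤s (ℕ.m+n≤o⇒m≤o i (ℕ.≤-reflexive eq))) r<N)))
              (π∣E l (ℕ.≤-<-trans (s≤s (ℕ.<⇒≤ (ℕ.m+n≤o⇒n≤o i (ℕ.≤-reflexive eq)))) r<N)))

      π∣binom : ∀ k → k < N → π ∣ binom (suc N) (suc k)
      π∣binom k k<N = ∣-cancel k k<N (binom N k , trans (*-comm _ _) (sym (absorption N k)))

      -- Induction on j by the binomial theorem; the middle coefficients are multiples of π by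
      -- absorption, the numbers 1, ..., N being units.
      fermat : ∀ j → π ∣ ν j ^ suc N - ν j
      fermat zero    = 0# , (solve (π ∷ ν zero ^ N ∷ []))
      fermat (suc j) = ∣-respʳ-≈
        (combine₄ (- 1#) (^-congˡ (suc N) (ν-suc j)) (- 1#) (binomial (ν j) (suc N)) 1# (ν-suc j)
          (- ν j ^ suc N) (binom-n-n (suc N))
              (identity (Σ N (λ i → binom (suc N) i * ν j ^ i) ∷ ν j ∷ ν j ^ N ∷ ν (suc j) ∷ ν (suc j) ^ N
                ∷ (1# + ν j) ^ N ∷ binom (suc N) (suc N) ∷ [])
              (λ x y z u v w p → x :+ (y :* z :- y) :- (u :* v :- u) := :- (num 1) :* (u :* v :- (num 1 :+ y) :* w)
                :+ :- (num 1) :* ((num 1 :+ y) :* w :- (num 1 :+ (x :+ p :* (y :* z)))) :+ num 1 :* (u :- (num 1 :+ y)) :+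
                :- (y :* z) :* (p :- num 1))))
        (∣-+ (∣-Σ N {λ i → binom (suc N) i * ν j ^ i} (λ k k<N → ∣-*ʳ (ν j ^ suc k) (π∣binom k k<N))) (fermat j))

      fermat-unit : ∀ k → k < N → π ∣ ν (suc k) ^ N - 1#
      fermat-unit k k<N = ∣-cancel k k<N (∣-respʳ-≈ (solve (ν (suc k) ∷ ν (suc k) ^ N ∷ [])) (fermat (suc k)))

      π∣P[N]+1 : π ∣ P N + 1#
      π∣P[N]+1 = ∣-respʳ-≈ (assemble (P N) (Σ N (λ _ → 1#)) (ν N) (Σ-- N _ _) (Σ-const N) (ν-suc N))
        (∣-+ (∣-Σ N fermat-unit) ∣-refl)
        where
        assemble : ∀ x s n {d} → x - s ≈ d → s ≈ n → π ≈ 1# + n → d + π ≈ x + 1#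
        assemble x s n {d} h₁ h₂ h₃ = combine₃ (- 1#) h₁ (- 1#) h₂ 1# h₃ (solve (d ∷ π ∷ x ∷ s ∷ n ∷ []))

      complement : ∀ {k} → k < N → k ℕ.+ suc (N ∸ suc k) ≡ N
      complement {k} k<N = ≡.trans (ℕ.+-suc k (N ∸ suc k)) (ℕ.m+[n∸m]≡n k<N)

      module _ (M : ℕ) (N≡ : suc M ≡ N) where

        -- Here `E N` is (-1)^N·N!. Modulo π, Newton's identity in degree N keeps only P_N, so N·E_N
        -- ≡ -P_N ≡ 1, while N ≡ -1.
        wilson : π ∣ E N + 1#
        wilson = ≡.subst (λ n → π ∣ E n + 1#) N≡ (∣-respʳ-≈
          (assemble π (ν (suc M)) (E (suc M)) (P (suc M)) (newton-e ν N M) (trans (ν-suc N) (+-congˡ (reflexive (≡.cong ν (≡.sym N≡))))))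
          (∣-+ (∣-+ (E (suc M) , *-comm (E (suc M)) π)
            (∣-neg (conv-leading (λ i → - psum ν (suc i) N) (λ l → e ν l N) M λ i l eq →
              ∣-*ʳ (E (suc l)) (∣-neg (π∣P i (≡.subst (suc i <_) N≡ (s≤s (≡.subst (i <_) eq (ℕ.m<m+n i (s≤s z≤n))))))))))
            (≡.subst (λ n → π ∣ P n + 1#) (≡.sym N≡) π∣P[N]+1)))
          where
          assemble : ∀ p n x y {c} → n * x ≈ c → p ≈ 1# + n → p * x + - (c - - y * 1#) + (y + 1#) ≈ x + 1#
          assemble p n x y {c} h₁ h₂ = combine₂ 1# h₁ x h₂ (solve (p ∷ x ∷ c ∷ y ∷ n ∷ []))

        reversal : ∀ r l → r ℕ.+ l ≡ N → E N * E⁻ r ≈ E l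
        reversal r l eq = trans (*-congʳ (sym (trans (sym (*-identityʳ _)) (e-reciprocal ν inv N inv-spec 0 N ≡.refl))))
          (e-reciprocal ν inv N inv-spec r l eq)

        π∣E⁻ : ∀ r l → suc r ℕ.+ suc l ≡ N → π ∣ E⁻ (suc r)
        π∣E⁻ r l eq = ∣-respʳ-≈ (combine₁ 1# (reversal (suc r) (suc l) eq)
            (solve (E N ∷ E⁻ (suc r) ∷ E (suc l) ∷ [])))
          (∣-+ (∣-*ʳ (E⁻ (suc r)) wilson)
               (∣-neg (π∣E l (≡.subst (suc l <_) eq (ℕ.m<n+m (suc l) (s≤s z≤n))))))

        -- By `reversal` the sum is (E_N + 1)·E⁻ᵣ₊₁, and both factors are multiples of π.
        E⁻-leading : ∀ r l → suc r ℕ.+ suc l ≡ N → π² ∣ E⁻ (suc r) + E (suc l)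
        E⁻-leading r l eq = ∣-respʳ-≈ (combine₁ 1# (reversal (suc r) (suc l) eq)
            (solve (E N ∷ E⁻ (suc r) ∷ E (suc l) ∷ [])))
          (∣-* wilson (π∣E⁻ r l eq))

        π∣E⁻[1+l] : ∀ i l {r} → i ℕ.+ suc l ≡ r → suc r < N → π ∣ E⁻ (suc l)
        π∣E⁻[1+l] i l eq r<N = π∣E⁻ l _ (complement (ℕ.≤-<-trans (s≤s (ℕ.<⇒≤ (≡.subst (suc l ≤_) eq (ℕ.m≤n+m (suc l) i)))) r<N))

        π∣H : ∀ r → suc r < N → π ∣ H (suc r)
        π∣H r r<N = ∣-respʳ-≈ (combine₁ (- 1#) (newton-e inv N r)
            (solve (conv (λ i → - psum inv (suc i) N) (λ l → e inv l N) r ∷ psum inv (suc r) N ∷ ν (suc r)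
              ∷ E⁻ (suc r) ∷ [])))
          (∣-+ (conv-leading (λ i → - psum inv (suc i) N) (λ l → e inv l N) r λ i l eq →
                  ∣-*ˡ _ (π∣E⁻[1+l] i l eq r<N))
               (∣-*ˡ (- ν (suc r)) (π∣E⁻ r _ (complement r<N))))

        H-leading : ∀ r → suc r < N → π² ∣ ν (suc r) * E⁻ (suc r) + H (suc r)
        H-leading r r<N = ∣-respʳ-≈ (combine₁ (- 1#) (newton-e inv N r)
            (solve (conv (λ i → - psum inv (suc i) N) (λ l → e inv l N) r ∷ psum inv (suc r) N ∷ ν (suc r)
              ∷ E⁻ (suc r) ∷ [])))
          (conv-leading (λ i → - psum inv (suc i) N) (λ l → e inv l N) r λ i l eq →
            ∣-* (∣-neg (π∣H i (ℕ.<-trans (s≤s (≡.subst (i <_) eq (ℕ.m<m+n i (s≤s z≤n)))) r<N))) (π∣E⁻[1+l] i l eq r<N))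

        -- Put t = r + 1 and n = l + 1, so t + n = N. Modulo π², Hₜ ≡ -t·E⁻ₜ ≡ t·Eₙ and n·Eₙ ≡ -Pₙ ≡
        -- -πBₙ, whence n·Hₜ ≡ -tπBₙ. As π ∣ Hₜ, the factor n = π - 1 - t may be replaced by -(t +
        -- 1).
        H-bernoulli : ∀ r l → suc r ℕ.+ suc l ≡ N →
                      π² ∣ ν (suc (suc r)) * H (suc r) - ν (suc r) * (π * B (suc l))
        H-bernoulli r l eq = ∣-respʳ-≈
          (assemble (ν (suc r)) (ν (suc l)) (H (suc r)) (P (suc l)) (E⁻ (suc r)) (E (suc l)) (B (suc l))
            (ν-suc (suc r)) (trans (ν-suc N) (+-congˡ (trans (reflexive (≡.cong ν (≡.sym eq))) (ν-+ (suc r) (suc l))))))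
          (∣-+ (∣-+ (∣-+ (∣-* ∣-refl (π∣H r r<N)) (∣-*ˡ (- ν (suc l)) (H-leading r r<N)))
            (∣-*ˡ (ν (suc l) * ν (suc r)) (E⁻-leading r l eq)))
            (∣-+ (∣-*ˡ (- ν (suc r)) (E-leading l l<N)) (∣-*ˡ (ν (suc r)) (P-bernoulli l l<N))))
          where
          r<N : suc r < N
          r<N = ≡.subst (suc r <_) eq (ℕ.m<m+n (suc r) (s≤s z≤n))
          l<N : suc l < N
          l<N = ≡.subst (suc l <_) eq (ℕ.m<n+m (suc l) (s≤s z≤n))
          assemble : ∀ t n x y u v w {t₁} → t₁ ≈ 1# + t → π ≈ 1# + (t + n) →
            π * x + - n * (t * u + x) + n * t * (u + v) + (- t * (n * v + y) + t * (y - π * w)) ≈ t₁ * x - t * (π * w)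
          assemble t n x y u v w {t₁} h₁ h₂ = combine₂ (- x) h₁ x h₂
              (identity (π ∷ x ∷ n ∷ t ∷ u ∷ v ∷ y ∷ w ∷ t₁ ∷ [])
              (λ x y z u v w p q s → x :* y :+ :- z :* (u :* v :+ y) :+ z :* u :* (v :+ w) :+ (:- u :* (z :* w
                :+ p) :+ u :* (p :- x :* q)) :- (s :* y :- u :* (x :* q)) := :- y :* (s :- (num 1 :+ u)) :+ y :* (x
                :- (num 1 :+ (u :+ z)))))

    -- Harmonic sums under j ↦ p - j and under separation by parity

    module Reflection (π³≈0 : π * π * π ≈ 0#) where

      -- With u inverse to x, this is -1 / (ρ - x) modulo ρ³.
      shifted : Carrier → Carrier → Carrier
      shifted ρ u = u * (1# + ρ * u + ρ * u * (ρ * u))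

      module _ (ρ : Carrier) (ρ³≈0 : ρ * ρ * ρ ≈ 0#) where

        shifted-spec : ∀ x u → x * u ≈ 1# → (ρ - x) * shifted ρ u ≈ - 1#
        shifted-spec x u h = combine₂ (- (1# + ρ * u + ρ * u * (ρ * u))) h (u * u * u) ρ³≈0
            (solve (ρ ∷ x ∷ u ∷ []))

        shifted-^ : ∀ u s → shifted ρ u ^ s ≈ u ^ s + ν s * ρ * u ^ suc s + ν (tri s) * (ρ * ρ) * u ^ suc (suc s)
        shifted-^ u zero    = solve (ρ ∷ u ∷ [])
        shifted-^ u (suc s) = combine₄ (shifted ρ u) (shifted-^ u s)
          ((ν (tri s) + ν s + ν (tri s) * ρ * u) * u ^ suc (suc (suc (suc s)))) ρ³≈0
          (- ρ * u ^ suc (suc s)) (ν-suc s) (- (ρ * ρ * u ^ suc (suc (suc s)))) (ν-tri-suc s)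
              (identity (u ∷ ρ ∷ shifted ρ u ^ s ∷ u ^ s ∷ ν (suc s) ∷ ν (tri (suc s)) ∷ ν s ∷ ν (tri s) ∷ [])
              (λ x y z u v w p q → x :* (num 1 :+ y :* x :+ y :* x :* (y :* x)) :* z :- (x :* u :+ v :* y :* (x :* (x
                :* u)) :+ w :* (y :* y) :* (x :* (x :* (x :* u)))) := x :* (num 1 :+ y :* x :+ y :* x :* (y :* x))
                :* (z :- (u :+ p :* y :* (x :* u) :+ q :* (y :* y) :* (x :* (x :* u)))) :+ (q :+ p :+ q :* y :* x)
                :* (x :* (x :* (x :* (x :* u)))) :* (y :* y :* y :- num 0) :+ :- y :* (x :* (x :* u)) :* (v :- (num 1
                :+ p)) :+ :- (y :* y :* (x :* (x :* (x :* u)))) :* (w :- (num 1 :+ p :+ q))))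

      inverse-unique : ∀ {x y z} → x * y ≈ 1# → x * z ≈ 1# → y ≈ z
      inverse-unique {x} {y} {z} h h′ = combine₂ (- y) h′ z h (solve (y ∷ z ∷ x ∷ []))

      ν-∸ : ∀ {m n} → n ≤ m → ν (m ∸ n) ≈ ν m - ν n
      ν-∸ {m} {n} n≤m = combine₂ 1# (sym (ν-+ (m ∸ n) n)) 1# (reflexive (≡.cong ν (ℕ.m∸n+n≡m n≤m)))
          (solve (ν (m ∸ n) ∷ ν m ∷ ν n ∷ ν (m ∸ n ℕ.+ n) ∷ []))

      inv-spec′ : ∀ k → 0 < k → k ≤ N → ν k * inv k ≈ 1#
      inv-spec′ (suc k) _ k<N = inv-spec k k<N

      inv-reflect : ∀ k → 0 < k → k ≤ N → inv (suc N ∸ k) ≈ - shifted π (inv k)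
      inv-reflect k 0<k k≤N = inverse-unique (inv-spec′ (suc N ∸ k) (ℕ.m<n⇒0<n∸m (s≤s k≤N)) (below k 0<k))
        (combine₂ (- shifted π (inv k)) (ν-∸ (ℕ.m≤n⇒m≤1+n k≤N))
          (- 1#) (shifted-spec π π³≈0 (ν k) (inv k) (inv-spec′ k 0<k k≤N))
              (identity (ν (suc N ∸ k) ∷ inv k ∷ π ∷ ν k ∷ [])
              (λ x y z u → x :* :- (y :* (num 1 :+ z :* y :+ z :* y :* (z :* y))) :- num 1 := :- (y :* (num 1 :+ z :* y
                :+ z :* y :* (z :* y))) :* (x :- (z :- u)) :+ :- (num 1) :* ((z :- u) :* (y :* (num 1 :+ z :* y :+ z
                :* y :* (z :* y))) :- :- (num 1)))))
        where
        below : ∀ k → 0 < k → suc N ∸ k ≤ N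
        below (suc k) _ = ℕ.m∸n≤m N k

      neg-^-even : ∀ x u → (- x) ^ (u ℕ.+ u) ≈ x ^ (u ℕ.+ u)
      neg-^-even x zero    = refl
      neg-^-even x (suc u) rewrite ℕ.+-suc u u = combine₁ (x * x) (neg-^-even x u)
          (solve (x ∷ (- x) ^ (u ℕ.+ u) ∷ x ^ (u ℕ.+ u) ∷ []))

      inv-reflect-even : ∀ u k → 0 < k → k ≤ N → let t = u ℕ.+ u in
        inv (suc N ∸ k) ^ t ≈ inv k ^ t + ν t * π * inv k ^ suc t + ν (tri t) * (π * π) * inv k ^ suc (suc t)
      inv-reflect-even u k 0<k k≤N = trans (^-congˡ (u ℕ.+ u) (inv-reflect k 0<k k≤N))
        (trans (neg-^-even _ u) (shifted-^ π π³≈0 (inv k) (u ℕ.+ u)))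

      Σ-expansion : ∀ n a b (f g h : ℕ → Carrier) →
                    Σ n (λ k → f k + a * g k + b * h k) ≈ Σ n f + a * Σ n g + b * Σ n h
      Σ-expansion zero    a b f g h = solve (a ∷ b ∷ [])
      Σ-expansion (suc n) a b f g h = combine₁ 1# (Σ-expansion n a b f g h)
          (identity (Σ n (λ k → f k + a * g k + b * h k) ∷ f (suc n) ∷ a ∷ g (suc n) ∷ b ∷ h (suc n) ∷ Σ n f
            ∷ Σ n g ∷ Σ n h ∷ [])
          (λ x y z u v w p q s → x :+ (y :+ z :* u :+ v :* w) :- (p :+ y :+ z :* (q :+ u) :+ v :* (s :+ w)) := num 1
            :* (x :- (p :+ z :* q :+ v :* s))))

      -- For odd s the substitution j ↦ p - j changes the sign, so the sum equals minus its own
      -- expansion in π; the hypothesis removes the second-order term.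
      odd-reflection : ∀ u → let s = suc (u ℕ.+ u) in π * π * psum inv (suc (suc s)) N ≈ 0# →
                       ν 2 * psum inv s N + ν s * π * psum inv (suc s) N ≈ 0#
      odd-reflection u vanish = combine₂ 1# reflected (- ν (tri s)) vanish
          (identity (psum inv (suc (u ℕ.+ u)) N ∷ ν (suc (u ℕ.+ u)) ∷ π ∷ psum inv (suc (suc (u ℕ.+ u))) N
            ∷ ν (tri s) ∷ psum inv (suc (suc s)) N ∷ [])
          (λ x y z u v w → num 2 :* x :+ y :* z :* u :- num 0 := num 1 :* (x :- :- (x :+ y :* z :* u :+ v :* (z :* z)
            :* w)) :+ :- v :* (z :* z :* w :- num 0)))
        where
        s : ℕ
        s = suc (u ℕ.+ u)
        reflected : psum inv s N ≈ - (psum inv s N + ν s * π * psum inv (suc s) N + ν (tri s) * (π * π) * psum inv (suc (suc s)) N)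
        reflected = begin
          psum inv s N
            ≈⟨ Σ-reverse N _ ⟩
          Σ N (λ k → inv (suc N ∸ k) ^ s)
            ≈⟨ Σ-cong N (λ k k<N → odd k k<N) ⟩
          Σ N (λ k → - (inv k ^ s + ν s * π * inv k ^ suc s + ν (tri s) * (π * π) * inv k ^ suc (suc s)))
            ≈⟨ Σ-neg N _ ⟨
          - Σ N (λ k → inv k ^ s + ν s * π * inv k ^ suc s + ν (tri s) * (π * π) * inv k ^ suc (suc s))
            ≈⟨ -‿cong (Σ-expansion N _ _ _ _ _) ⟩
          - (psum inv s N + ν s * π * psum inv (suc s) N + ν (tri s) * (π * π) * psum inv (suc (suc s)) N)
            ∎
          where
          odd : ∀ k → k < N → inv (suc N ∸ suc k) ^ s ≈
            - (inv (suc k) ^ s + ν s * π * inv (suc k) ^ suc s + ν (tri s) * (π * π) * inv (suc k) ^ suc (suc s))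
          odd k k<N = begin
            inv (suc N ∸ suc k) ^ s               ≈⟨ ^-congˡ s (inv-reflect (suc k) (s≤s z≤n) k<N) ⟩
            - β * (- β) ^ (u ℕ.+ u)               ≈⟨ combine₁ (- β) (neg-^-even β u)
                (identity (inv (suc k) ∷ π ∷ (- β) ^ (u ℕ.+ u) ∷ β ^ (u ℕ.+ u) ∷ [])
                (λ x y z u → :- (x :* (num 1 :+ y :* x :+ y :* x :* (y :* x))) :* z :- :- (x :* (num 1 :+ y :* x :+ y
                  :* x :* (y :* x)) :* u) := :- (x :* (num 1 :+ y :* x :+ y :* x :* (y :* x))) :* (z :- u))) ⟩
            - (β ^ s)                             ≈⟨ -‿cong (shifted-^ π π³≈0 (inv (suc k)) s) ⟩
            - (inv (suc k) ^ s + ν s * π * inv (suc k) ^ suc s + ν (tri s) * (π * π) * inv (suc k) ^ suc (suc s)) ∎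
            where
            β : Carrier
            β = shifted π (inv (suc k))

      module _ (m : ℕ) (N≡ : N ≡ m ℕ.+ m) where

        m≤N : m ≤ N
        m≤N = ≡.subst (m ≤_) (≡.sym N≡) (ℕ.m≤m+n m m)

        Y : ℕ → Carrier
        Y t = psum inv t m

        -- The indices above m are carried to 1, ..., m by j ↦ p - j, with no sign because t is
        -- even.
        halves : ∀ u → let t = u ℕ.+ u in
          psum inv t N ≈ ν 2 * Y t + ν t * π * Y (suc t) + ν (tri t) * (π * π) * Y (suc (suc t))
        halves u = begin
          psum inv t N
            ≡⟨ ≡.cong (psum inv t) N≡ ⟩
          psum inv t (m ℕ.+ m)
            ≈⟨ Σ-+ˡ m m _ ⟩
          Y t + Σ m (λ k → inv (m ℕ.+ k) ^ t)
            ≈⟨ +-congˡ (Σ-reverse m _) ⟩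
          Y t + Σ m (λ k → inv (m ℕ.+ (suc m ∸ k)) ^ t)
            ≈⟨ +-congˡ (Σ-cong m (λ k k<m → trans (^-congˡ t (reflexive (≡.cong inv (index k k<m))))
                 (inv-reflect-even u (suc k) (s≤s z≤n) (ℕ.≤-trans k<m m≤N)))) ⟩
          Y t + Σ m (λ k → inv k ^ t + ν t * π * inv k ^ suc t + ν (tri t) * (π * π) * inv k ^ suc (suc t))
            ≈⟨ +-congˡ (Σ-expansion m _ _ _ _ _) ⟩
          Y t + (Y t + ν t * π * Y (suc t) + ν (tri t) * (π * π) * Y (suc (suc t)))
            ≈⟨ collect (Y t) _ _ ⟩
          ν 2 * Y t + ν t * π * Y (suc t) + ν (tri t) * (π * π) * Y (suc (suc t))
            ∎
          where
          t : ℕ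
          t = u ℕ.+ u
          index : ∀ k → k < m → m ℕ.+ (suc m ∸ suc k) ≡ suc N ∸ suc k
          index k k<m = ≡.trans (≡.sym (ℕ.+-∸-assoc m (ℕ.<⇒≤ k<m))) (≡.cong (_∸ k) (≡.sym N≡))
          collect : ∀ x y z → x + (x + y + z) ≈ ν 2 * x + y + z
          collect x y z = solve (x ∷ y ∷ z ∷ [])

        double≤N : ∀ k → k < m → suc k ℕ.+ suc k ≤ N
        double≤N k k<m = ≡.subst (suc k ℕ.+ suc k ≤_) (≡.sym N≡) (ℕ.+-mono-≤ k<m k<m)

        inv-double : ∀ k → k < m → ν 2 * inv (suc k ℕ.+ suc k) ≈ inv (suc k)
        inv-double k k<m = inverse-unique
          (combine₂ 1# (inv-spec′ (suc k ℕ.+ suc k) (s≤s z≤n) (double≤N k k<m))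
            (- inv (suc k ℕ.+ suc k)) (ν-+ (suc k) (suc k))
                (solve (ν (suc k) ∷ inv (suc k ℕ.+ suc k) ∷ ν (suc k ℕ.+ suc k) ∷ [])))
          (inv-spec k (ℕ.≤-trans k<m m≤N))

        inv-double-^ : ∀ s k → k < m → ν 2 ^ s * inv (suc k ℕ.+ suc k) ^ s ≈ inv (suc k) ^ s
        inv-double-^ s k k<m = trans (sym (^-distrib-* (ν 2) (inv (suc k ℕ.+ suc k)) s)) (^-congˡ s (inv-double k k<m))

        -- The odd indices are the p - 2k with 1 ≤ k ≤ m. The factor 2^{t+1} clears the powers of
        -- 1/2 up to first order. The second-order sum is left as it stands, since the equation is
        -- applied only where π² = 0 or after multiplication by π.
        parity : ∀ u → let t = u ℕ.+ u in
          ν 2 ^ suc t * psum inv t N ≈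
            ν 4 * Y t + ν t * π * Y (suc t) + ν (tri t) * (π * π) * Σ m (λ k → inv k ^ suc t * inv (k ℕ.+ k))
        parity u = begin
          ν 2 ^ suc t * psum inv t N
            ≡⟨ ≡.cong (λ n → ν 2 ^ suc t * psum inv t n) N≡ ⟩
          ν 2 ^ suc t * psum inv t (m ℕ.+ m)
            ≈⟨ *-congˡ (trans (Σ-parity m _) (trans (+-congˡ (Σ-reverse m _)) (Σ-+ m _ _))) ⟩
          ν 2 ^ suc t * Σ m (λ k → inv (k ℕ.+ k) ^ t + inv ((suc m ∸ k) ℕ.+ (suc m ∸ k) ∸ 1) ^ t)
            ≈⟨ Σ-*ˡ m _ _ ⟩
          Σ m (λ k → ν 2 ^ suc t * (inv (k ℕ.+ k) ^ t + inv ((suc m ∸ k) ℕ.+ (suc m ∸ k) ∸ 1) ^ t))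
            ≈⟨ Σ-cong m summand ⟩
          Σ m (λ k → ν 4 * inv k ^ t + ν t * π * inv k ^ suc t + ν (tri t) * (π * π) * (inv k ^ suc t * inv (k ℕ.+ k)))
            ≈⟨ Σ-expansion m _ _ _ _ _ ⟩
          Σ m (λ k → ν 4 * inv k ^ t) + ν t * π * Y (suc t)
            + ν (tri t) * (π * π) * Σ m (λ k → inv k ^ suc t * inv (k ℕ.+ k))
            ≈⟨ +-congʳ (+-congʳ (Σ-*ˡ m (ν 4) (λ k → inv k ^ t))) ⟨
          ν 4 * Y t + ν t * π * Y (suc t) + ν (tri t) * (π * π) * Σ m (λ k → inv k ^ suc t * inv (k ℕ.+ k))
            ∎
          where
          t : ℕ
          t = u ℕ.+ u
          -- After the reversal each even index 2j is paired with the odd index p - 2j.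
          index : ∀ k → k < m → (m ∸ k) ℕ.+ (m ∸ k) ∸ 1 ≡ suc N ∸ (suc k ℕ.+ suc k)
          index k k<m = ≡.trans (≡.sym (ℕ.[m+n]∸[m+o]≡n∸o (k ℕ.+ k) ((m ∸ k) ℕ.+ (m ∸ k)) 1))
            (≡.cong₂ _∸_ (≡.trans (interchange k k (m ∸ k) (m ∸ k)) (≡.trans (≡.cong₂ ℕ._+_ split split) (≡.sym N≡)))
              (≡.trans (ℕ.+-comm (k ℕ.+ k) 1) (≡.sym (ℕ.+-suc k k))))
            where
            split : k ℕ.+ (m ∸ k) ≡ m
            split = ℕ.m+[n∸m]≡n (ℕ.<⇒≤ k<m)
            open import Algebra.Properties.CommutativeSemigroup ℕ.+-commutativeSemigroup using (interchange)
          summand : ∀ k → k < m →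
            ν 2 ^ suc t * (inv (suc k ℕ.+ suc k) ^ t + inv ((suc m ∸ suc k) ℕ.+ (suc m ∸ suc k) ∸ 1) ^ t)
              ≈ ν 4 * inv (suc k) ^ t + ν t * π * inv (suc k) ^ suc t
                + ν (tri t) * (π * π) * (inv (suc k) ^ suc t * inv (suc k ℕ.+ suc k))
          summand k k<m = assemble (ν 2 ^ t) (v ^ t) v (inv (suc k) ^ t) (inv (suc k)) (ν t) (ν (tri t))
            (trans (^-congˡ t (reflexive (≡.cong inv (index k k<m))))
                   (inv-reflect-even u (suc k ℕ.+ suc k) (s≤s z≤n) (double≤N k k<m)))
            (inv-double-^ t k k<m) (inv-double k k<m)
            where
            v : Carrier
            v = inv (suc k ℕ.+ suc k)
            assemble : ∀ w vt v xt x a b {z} →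
              z ≈ vt + a * π * (v * vt) + b * (π * π) * (v * (v * vt)) → w * vt ≈ xt → ν 2 * v ≈ x →
              ν 2 * w * (vt + z) ≈ ν 4 * xt + a * π * (x * xt) + b * (π * π) * (x * xt * v)
            assemble w vt v xt x a b {z} h₁ h₂ h₃ = combine₃ (ν 2 * w) h₁
              (ν 4 + a * π * ν 2 * v + b * (π * π) * v * ν 2 * v) h₂
              (a * π * xt + b * (π * π) * v * xt) h₃ (identity (w ∷ vt ∷ z ∷ xt ∷ a ∷ π ∷ x ∷ b ∷ v ∷ [])
                  (λ x y z u v w p q s → num 2 :* x :* (y :+ z) :- (num 4 :* u :+ v :* w :* (p :* u) :+ q :* (w :* w)
                    :* (p :* u :* s)) := num 2 :* x :* (z :- (y :+ v :* w :* (s :* y) :+ q :* (w :* w) :* (s :* (s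
                    :* y)))) :+ (num 4 :+ v :* w :* num 2 :* s :+ q :* (w :* w) :* s :* num 2 :* s) :* (x :* y :- u)
                    :+ (v :* w :* u :+ q :* (w :* w) :* s :* u) :* (num 2 :* s :- p)))

    -- Evaluation at α = 1/2: preparations for both moduli

    module WithBernoulli (B : ℕ → Carrier)
      (B-rec : ∀ n → suc n < N → 1# + Σ (suc n) (λ i → binom (suc (suc n)) i * B i) ≈ 0#)
      (m : ℕ) (N≡2m : N ≡ m ℕ.+ m) (M : ℕ) (1+M≡N : suc M ≡ N) where

      H-div : ∀ r → suc r < N → π ∣ H (suc r)
      H-div = π∣H B B-rec M 1+M≡N

      half : Carrier
      half = inv 2

      π∣π*half : π ∣ π * half
      π∣π*half = half , *-comm half π

      2≤N : 2 ≤ N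
      2≤N = two m N≡2m
        where
        two : ∀ m → N ≡ m ℕ.+ m → 2 ≤ N
        two zero    eq with () ← ≡.trans 1+M≡N eq
        two (suc m) eq = ≡.subst (2 ≤_) (≡.sym (≡.trans eq (≡.cong suc (ℕ.+-suc m m)))) (s≤s (s≤s z≤n))

      2*half : ν 2 * half ≈ 1#
      2*half = inv-spec 1 2≤N

      -- Hence p/2 - m = 1/2: from `π * half`, a multiple of π, exactly m unit steps lead to `half`.
      π≈1+2m : π ≈ 1# + (ν m + ν m)
      π≈1+2m = trans (ν-suc N) (+-congˡ (trans (reflexive (≡.cong ν N≡2m)) (ν-+ m m)))

      half-cancel : ∀ {x} → ν 2 * x ≈ 0# → x ≈ 0#
      half-cancel {x} eq = combine₂ half eq (- x) 2*half (solve (x ∷ half ∷ []))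

      -- Part (i), in a ring where π² = 0

      module Linear (π²≈0 : π * π ≈ 0#) where
        private
          π³≈0 : π * π * π ≈ 0#
          π³≈0 = trans (*-congʳ π²≈0) (zeroˡ π)
        open Reflection π³≈0

        π*∣ : ∀ {x} → π ∣ x → π * x ≈ 0#
        π*∣ {x} (q , eq) = combine₂ (- π) eq q π²≈0 (solve (π ∷ x ∷ q ∷ []))

        ∣*∣ : ∀ {x y} → π ∣ x → π ∣ y → x * y ≈ 0#
        ∣*∣ h h′ = ∣∧≈0⇒≈0 π²≈0 (∣-* h h′)

        h-div : ∀ r → suc r < N → π ∣ h inv (suc r) N
        h-div r r<N = h-divisible inv r (ℕ.<⇒≤ r<N) (λ i i≤r → H-div i (ℕ.≤-<-trans (s≤s i≤r) r<N))

        module _ (ρ : Carrier) (π∣ρ : π ∣ ρ) where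

          ρ²≈0 : ρ * ρ ≈ 0#
          ρ²≈0 = ∣*∣ π∣ρ π∣ρ

          ρ³≈0 : ρ * ρ * ρ ≈ 0#
          ρ³≈0 = trans (*-congʳ ρ²≈0) (zeroˡ ρ)

          -- In ρ(ρ+1)⋯(ρ+k) all terms beyond ρ·k! contain ρ² = 0.
          rising-ρ : ∀ k → k < N → rising ρ (suc k) ≈ ρ * inv (suc k)
          rising-ρ zero    _   = solve (ρ ∷ inv 1 ∷ [])
          rising-ρ (suc k) k<N = combine₃ ((ρ + ν (suc k)) * inv (suc (suc k))) (rising-ρ k (ℕ.<-trans (ℕ.n<1+n k) k<N))
            (ρ * inv (suc (suc k))) (inv-spec k (ℕ.<-trans (ℕ.n<1+n k) k<N))
            (inv (suc k) * inv (suc (suc k))) ρ²≈0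
                (identity (rising ρ k ∷ ρ ∷ ν k ∷ inv (suc k) ∷ ν (suc k) ∷ inv (suc (suc k)) ∷ [])
                (λ x y z u v w → x :* (y :+ z) :* u :* (y :+ v) :* w :- y :* w := (y :+ v) :* w :* (x :* (y :+ z)
                  :* u :- y :* u) :+ y :* w :* (v :* u :- num 1) :+ u :* w :* (y :* y :- num 0)))

          -- The factor (1+α)ₚ₋₁/(p-1)! of the shift formula at α = ρ - j.
          c : ℕ → Carrier
          c j = rising (ρ - ν j + 1#) N

          rising[ρ]N : rising ρ N ≈ ρ * inv N
          rising[ρ]N = ≡.subst (λ n → rising ρ n ≈ ρ * inv n) 1+M≡N (rising-ρ M (ℕ.≤-reflexive 1+M≡N))

          inv-N : ν N * inv N ≈ 1#
          inv-N = inv-spec′ N (ℕ.≤-trans (s≤s z≤n) (ℕ.≤-reflexive 1+M≡N)) ℕ.≤-refl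

          -- Essentially c j = -ρ/j for j ≥ 1, without the division. By `rising-suc`, (ρ - j)·c j =
          -- (ρ + π - (j+1))·c (j+1). If the value is ρ, then π ∣ c (j+1), hence π·c (j+1) = 0 and
          -- the extra π drops out.
          c-spec : ∀ j → j ≤ N → (ρ - ν j) * c j ≈ ρ
          c-div  : ∀ j → suc j ≤ N → π ∣ c (suc j)

          c-step : ∀ j → suc j ≤ N → (ρ + π - ν (suc j)) * c (suc j) ≈ ρ
          c-step j j<N = combine₄ 1# (c-spec j (ℕ.<⇒≤ j<N)) (- 1#) (rising-suc (ρ - ν j) N)
            (ρ - ν j + ν N) shift (c (suc j)) π-ν
                (identity (ρ ∷ π ∷ ν (suc j) ∷ c (suc j) ∷ ν j ∷ c j ∷ rising (ρ - ν j) N ∷ ν N ∷ [])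
                (λ x y z u v w p q → (x :+ y :- z) :* u :- x := num 1 :* ((x :- v) :* w :- x) :+ :- (num 1) :* (w :* (x
                  :- v) :- p :* (x :- v :+ q)) :+ (x :- v :+ q) :* (u :- p) :+ u :* (x :+ y :- z :- (x :- v :+ q))))
            where
            shift : c (suc j) ≈ rising (ρ - ν j) N
            shift = rising-cong N (combine₁ (- 1#) (ν-suc j) (solve (ρ ∷ ν (suc j) ∷ ν j ∷ [])))
            π-ν : ρ + π - ν (suc j) ≈ ρ - ν j + ν N
            π-ν = combine₂ 1# (ν-suc N) (- 1#) (ν-suc j) (solve (ρ ∷ π ∷ ν (suc j) ∷ ν j ∷ ν N ∷ []))

          c-div j j<N = ∣-cancel j j<N (∣-respʳ-≈ (combine₁ 1# (c-step j j<N)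
              (solve (ρ ∷ π ∷ c (suc j) ∷ ν (suc j) ∷ [])))
            (∣-+ (∣-*ʳ (c (suc j)) (∣-+ π∣ρ ∣-refl)) (∣-neg π∣ρ)))

          c-spec zero    _   = begin
            (ρ - ν 0) * c 0             ≈⟨ *-cong (solve (ρ ∷ [])) (rising-cong N (solve (ρ ∷ []))) ⟩
            ρ * rising (ρ + 1#) N       ≈⟨ *-comm _ _ ⟩
            rising (ρ + 1#) N * ρ       ≈⟨ rising-suc ρ N ⟩
            rising ρ N * (ρ + ν N)      ≈⟨ *-congʳ rising[ρ]N ⟩
            ρ * inv N * (ρ + ν N)       ≈⟨ combine₂ ρ inv-N (inv N) ρ²≈0 (solve (ρ ∷ inv N ∷ ν N ∷ [])) ⟩
            ρ                           ∎
          c-spec (suc j) j<N = combine₂ 1# (c-step j j<N) (- 1#) (π*∣ (c-div j j<N))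
              (solve (ρ ∷ ν (suc j) ∷ c (suc j) ∷ π ∷ []))

          Φ-at-ρ : ∀ r → Φ r ρ ≈ ρ * Σ N (λ k → inv k * inv k * h inv r k)
          Φ-at-ρ r = trans (Σ-cong N λ k k<N → combine₁ (inv (suc k) * h inv r (suc k)) (rising-ρ k k<N)
              (solve (rising ρ k ∷ ρ ∷ ν k ∷ inv (suc k) ∷ h inv r (suc k) ∷ [])))
            (sym (Σ-*ˡ N ρ _))

          -- With u = 1/(n+1), one step contributes β^{r+1}(1 - x), where β^{r+1} = u^{r+1}(1 +
          -- (r+1)ρu) and x = -ρu; the product is u^{r+1} + (r+2)ρu^{r+2}.
          Φ-descent : ∀ r → suc r < N → ∀ n → n ≤ N →
            Φ r ρ ≈ Φ r (ρ - ν n) + psum inv (suc r) n + (1# + ν (suc r)) * ρ * psum inv (suc (suc r)) n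
          Φ-descent r r<N zero    _   = combine₁ 1# (Φ-cong r {ρ} {ρ - ν 0}
              (solve (ρ ∷ []))) (solve (Φ r ρ ∷ Φ r (ρ - ν zero) ∷ ν (suc r) ∷ ρ ∷ []))
          Φ-descent r r<N (suc n) n<N = combine₃ 1# (Φ-descent r r<N n (ℕ.<⇒≤ n<N)) 1# shifted-eq 1# step
              (identity (Φ r ρ ∷ Φ r (ρ - ν (suc n)) ∷ psum inv (suc r) n ∷ inv (suc n) ∷ inv (suc n) ^ r
                ∷ ν (suc r) ∷ ρ ∷ psum inv (suc (suc r)) n ∷ Φ r (ρ - ν n) ∷ Φ r (α + 1#) ∷ [])
              (λ x y z u v w p q s t → x :- (y :+ (z :+ u :* v) :+ (num 1 :+ w) :* p :* (q :+ u :* (u :* v))) := num 1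
                :* (x :- (s :+ z :+ (num 1 :+ w) :* p :* q)) :+ num 1 :* (s :- t) :+ num 1 :* (t :- y :- (u :* v :+ (num 1
                :+ w) :* p :* (u :* (u :* v))))))
            where
            u β α : Carrier
            u = inv (suc n)
            β = shifted ρ u
            α = ρ - ν (suc n)
            α+1 : ρ - ν n ≈ α + 1#
            α+1 = combine₁ 1# (ν-suc n) (solve (ρ ∷ ν n ∷ ν (suc n) ∷ []))
            αβ : α * β ≈ - 1#
            αβ = shifted-spec ρ ρ³≈0 (ν (suc n)) u (inv-spec n n<N)
            shifted-eq : Φ r (ρ - ν n) ≈ Φ r (α + 1#)
            shifted-eq = Φ-cong r α+1
            x : Carrier
            x = rising (α + 1#) N
            x≈ : x ≈ - (ρ * u)
            x≈ = combine₃ x αβ (- β) (c-spec (suc n) n<N) (- (u * u + u * u * u * ρ)) ρ²≈0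
                (identity (x ∷ ρ ∷ u ∷ ν (suc n) ∷ [])
                (λ x y z u → x :- :- (y :* z) := x :* ((y :- u) :* (z :* (num 1 :+ y :* z :+ y :* z :* (y :* z)))
                  :- :- (num 1)) :+ :- (z :* (num 1 :+ y :* z :+ y :* z :* (y :* z))) :* ((y :- u) :* x :- y) :+ :- (z
                  :* z :+ z :* z :* z :* y) :* (y :* y :- num 0)))
            -- Both factors are multiples of π; this disposes of the boundary terms of the
            -- telescoping.
            vanish : ∀ i → i < r → x * h inv (suc i) N ≈ 0#
            vanish i i<r = ∣*∣ (c-div n n<N) (h-div i (ℕ.<-trans (s≤s i<r) r<N))
            step : Φ r (α + 1#) - Φ r α ≈ u ^ suc r + (1# + ν (suc r)) * ρ * u ^ suc (suc r)
            step = combine₄ 1# (Φ-shift r α β αβ vanish) (1# - x) (shifted-^ ρ ρ³≈0 u (suc r))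
              (- (u ^ suc r + ν (suc r) * ρ * u ^ suc (suc r) + ν (tri (suc r)) * (ρ * ρ) * u ^ suc (suc (suc r)))) x≈
              (ν (tri (suc r)) * u ^ suc (suc (suc r)) * (1# + ρ * u) + ν (suc r) * u ^ suc (suc (suc r))) ρ²≈0
                  (identity (Φ r (α + 1#) ∷ Φ r α ∷ u ∷ u ^ r ∷ ν (suc r) ∷ ρ ∷ β ^ r ∷ rising (α + 1#) N
                    ∷ ν (tri (suc r)) ∷ [])
                  (λ x y z u v w p q s → x :- y :- (z :* u :+ (num 1 :+ v) :* w :* (z :* (z :* u))) := num 1 :* (x
                    :- y :- z :* (num 1 :+ w :* z :+ w :* z :* (w :* z)) :* p :* (num 1 :- q)) :+ (num 1 :- q) :* (z
                    :* (num 1 :+ w :* z :+ w :* z :* (w :* z)) :* p :- (z :* u :+ v :* w :* (z :* (z :* u)) :+ s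
                    :* (w :* w) :* (z :* (z :* (z :* u))))) :+ :- (z :* u :+ v :* w :* (z :* (z :* u)) :+ s :* (w
                    :* w) :* (z :* (z :* (z :* u)))) :* (q :- :- (w :* z)) :+ (s :* (z :* (z :* (z :* u))) :* (num 1
                    :+ w :* z) :+ v :* (z :* (z :* (z :* u)))) :* (w :* w :- num 0)))

        rising-one : ∀ k → k ≤ N → rising 1# k ≈ 1#
        rising-one zero    _   = refl
        rising-one (suc k) k<N = combine₃ ((1# + ν k) * inv (suc k)) (rising-one k (ℕ.<⇒≤ k<N))
          1# (inv-spec k k<N) (- inv (suc k)) (ν-suc k)
              (solve (rising 1# k ∷ ν k ∷ inv (suc k) ∷ ν (suc k) ∷ []))

        Φ-one : ∀ r → Φ r 1# ≈ h inv (suc r) N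
        Φ-one r = Σ-cong N λ k k<N → combine₁ (inv (suc k) * h inv r (suc k)) (rising-one (suc k) k<N)
            (solve (rising 1# k ∷ ν k ∷ inv (suc k) ∷ h inv r (suc k) ∷ []))

        Q : ℕ → Carrier
        Q r = Σ N (λ k → inv k * inv k * h inv r k)

        -- The full descent from π to π - N = 1, where Φᵣ(1) is a homogeneous sum; its first-order
        -- term is a multiple of π·H⁽ʳ⁺²⁾ = 0.
        Q-formula : ∀ r → suc (suc r) < N → π * Q r ≈ h inv (suc r) N + H (suc r)
        Q-formula r r<N = combine₄ (- 1#) (Φ-at-ρ π ∣-refl r) 1# (Φ-descent π ∣-refl r (ℕ.<⇒≤ r<N) N ℕ.≤-refl)
          1# (trans (Φ-cong r {π - ν N} (combine₁ 1# (ν-suc N) (solve (π ∷ ν N ∷ [])))) (Φ-one r))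
          (1# + ν (suc r)) (π*∣ (H-div (suc r) r<N))
              (identity (π ∷ Q r ∷ h inv (suc r) N ∷ H (suc r) ∷ Φ r π ∷ Φ r (π - ν N) ∷ ν (suc r)
                ∷ psum inv (suc (suc r)) N ∷ [])
              (λ x y z u v w p q → x :* y :- (z :+ u) := :- (num 1) :* (v :- x :* y) :+ num 1 :* (v :- (w :+ u :+ (num 1
                :+ p) :* x :* q)) :+ num 1 :* (w :- z) :+ (num 1 :+ p) :* (x :* q :- num 0)))

        Φ-half : ∀ r → suc r < N →
          Φ r half ≈ half * (π * Q r) - Y m N≡2m (suc r) - (1# + ν (suc r)) * half * (π * Y m N≡2m (suc (suc r)))
        Φ-half r r<N = combine₃ 1# (Φ-at-ρ (π * half) π∣π*half r)
          (- 1#) (Φ-descent (π * half) π∣π*half r r<N m (m≤N m N≡2m))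
          (- 1#) (Φ-cong r {π * half - ν m} {half} (combine₂ half π≈1+2m (ν m) 2*half
              (solve (π ∷ half ∷ ν m ∷ [])))) (identity (Φ r half ∷ half ∷ π ∷ Q r ∷ Y m N≡2m (suc r)
                ∷ ν (suc r) ∷ Y m N≡2m (suc (suc r)) ∷ Φ r (π * half) ∷ Φ r (π * half - ν m) ∷ [])
              (λ x y z u v w p q s → x :- (y :* (z :* u) :- v :- (num 1 :+ w) :* y :* (z :* p)) := num 1 :* (q :- z
                :* y :* u) :+ :- (num 1) :* (q :- (s :+ v :+ (num 1 :+ w) :* (z :* y) :* p)) :+ :- (num 1) :* (s :- x)))

        -- Everything in `Φ-half` except -Y⁽ʳ⁺¹⁾ is zero: H⁽ʳ⁺¹⁾ has odd exponent and vanishes by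
        -- reflection, with it the homogeneous sum of degree r + 1 and so π·Q; and 2πY⁽ʳ⁺²⁾ =
        -- πH⁽ʳ⁺²⁾ = 0 since r + 2 is even.
        partI-even : ∀ u → let r = u ℕ.+ u in suc (suc r) < N → Φ r half ≈ - Y m N≡2m (suc r)
        partI-even u r<N = assemble (Φ-half r (ℕ.<⇒≤ r<N)) (Q-formula r r<N)
          where
          r : ℕ
          r = u ℕ.+ u
          π*H≈0 : π * H (suc (suc r)) ≈ 0#
          π*H≈0 = π*∣ (H-div (suc r) r<N)
          H≈0 : H (suc r) ≈ 0#
          H≈0 = half-cancel (combine₂ 1# (odd-reflection u (trans (*-congʳ π²≈0) (zeroˡ _))) (- ν (suc r)) π*H≈0
              (solve (H (suc r) ∷ ν (suc (u ℕ.+ u)) ∷ π ∷ psum inv (suc (suc (u ℕ.+ u))) N ∷ [])))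
          h≈0 : h inv (suc r) N ≈ 0#
          h≈0 = combine₃ (- h inv (suc r) N) (inv-spec r (ℕ.<-trans (ℕ.n<1+n r) (ℕ.<-trans (ℕ.n<1+n (suc r)) r<N)))
            (inv (suc r)) (∣∧≈0⇒≈0 π²≈0 (h-leading inv r (ℕ.<-trans (ℕ.n<1+n r) (ℕ.<-trans (ℕ.n<1+n (suc r)) r<N))
              (λ i i<r → H-div i (ℕ.<-trans (s≤s i<r) (ℕ.<-trans (ℕ.n<1+n (suc r)) r<N)))))
            (inv (suc r)) H≈0 (solve (h inv (suc r) N ∷ ν (suc r) ∷ inv (suc r) ∷ psum inv (suc r) N ∷ []))
          π*Y≈0 : π * Y m N≡2m (suc (suc r)) ≈ 0#
          π*Y≈0 = half-cancel (≡.subst (λ t → ν 2 * (π * Y m N≡2m t) ≈ 0#) (≡.cong suc (ℕ.+-suc u u))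
            (combine₃ (- π) (halves m N≡2m (suc u)) 1# (≡.subst (λ t → π * H t ≈ 0#) (≡.cong suc (≡.sym (ℕ.+-suc u u))) π*H≈0)
              (- (ν t * Y m N≡2m (suc t) + ν (tri t) * π * Y m N≡2m (suc (suc t)))) π²≈0
                  (identity (π ∷ Y m N≡2m (suc (u ℕ.+ suc u)) ∷ psum inv (suc u ℕ.+ suc u) N
                    ∷ ν (suc u ℕ.+ suc u) ∷ Y m N≡2m (suc (suc u ℕ.+ suc u)) ∷ ν (tri (suc u ℕ.+ suc u))
                    ∷ Y m N≡2m (suc (suc (suc u ℕ.+ suc u))) ∷ [])
                  (λ x y z u v w p → num 2 :* (x :* y) :- num 0 := :- x :* (z :- (num 2 :* y :+ u :* x :* v :+ w :* (x
                    :* x) :* p)) :+ num 1 :* (x :* z :- num 0) :+ :- (u :* v :+ w :* x :* p) :* (x :* x :- num 0)))))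
            where
            t : ℕ
            t = suc u ℕ.+ suc u
          assemble : ∀ {F q Y₁} → F ≈ half * (π * q) - Y₁ - (1# + ν (suc r)) * half * (π * Y m N≡2m (suc (suc r))) →
                     π * q ≈ h inv (suc r) N + H (suc r) → F ≈ - Y₁
          assemble {F} {q} {Y₁} h₁ h₂ = combine₄ 1# h₁ half h₂ (- (1# + ν (suc r)) * half) π*Y≈0 half (trans (+-cong h≈0 H≈0) (+-identityʳ 0#))
              (identity (F ∷ Y₁ ∷ half ∷ π ∷ q ∷ ν (suc r) ∷ Y m N≡2m (suc (suc r)) ∷ h inv (suc r) N
                ∷ H (suc r) ∷ [])
              (λ x y z u v w p q s → x :- :- y := num 1 :* (x :- (z :* (u :* v) :- y :- (num 1 :+ w) :* z :* (u :* p)))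
                :+ z :* (u :* v :- (q :+ s)) :+ :- (num 1 :+ w) :* z :* (u :* p :- num 0) :+ z :* (q :+ s :- num 0)))

        -- Now t = r + 1 is even and H⁽ᵗ⁾ need not vanish. The relations are linear in π·Q, H⁽ᵗ⁾,
        -- Y⁽ᵗ⁾ and π·Y⁽ᵗ⁺¹⁾; they express the sum through H⁽ᵗ⁾, which `H-bernoulli` evaluates.
        partI-odd : ∀ u l → let r = u ℕ.+ suc u in suc (suc r) < N → suc r ℕ.+ suc l ≡ N →
          ν 2 * ν (suc (suc r)) * Φ r half ≈ (ν 2 ^ suc (suc r) - 1#) * (π * B (suc l))
        partI-odd u l r<N eq = assemble (ν (suc r)) (ν (suc (suc r))) (inv (suc r)) (Φ r half) (Q r) (h inv (suc r) N)
          (H (suc r)) (Y m N≡2m (suc r)) (Y m N≡2m (suc (suc r))) (ν 2 ^ suc (suc r)) (B (suc l))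
          (inv-spec r r<N′) (ν-suc (suc r)) (Φ-half r (ℕ.<⇒≤ r<N)) (Q-formula r r<N)
          (∣∧≈0⇒≈0 π²≈0 (h-leading inv r r<N′ (λ i i<r → H-div i (ℕ.<-trans (s≤s i<r) (ℕ.<⇒≤ r<N)))))
          (trans (halves m N≡2m (suc u)) (drop _ _ _))
          (trans (parity m N≡2m (suc u)) (drop _ _ _))
          (∣∧≈0⇒≈0 π²≈0 (H-bernoulli B B-rec M 1+M≡N r l eq))
          where
          r : ℕ
          r = u ℕ.+ suc u
          r<N′ : r < N
          r<N′ = ℕ.<⇒≤ (ℕ.<⇒≤ r<N)
          drop : ∀ x a y → x + a * (π * π) * y ≈ x
          drop x a y = combine₁ (a * y) π²≈0 (solve (x ∷ a ∷ π ∷ y ∷ []))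
          assemble : ∀ t t₁ t⁻¹ F q h₁ X Y₁ Y₂ w b → t * t⁻¹ ≈ 1# → t₁ ≈ 1# + t →
            F ≈ half * (π * q) - Y₁ - (1# + t) * half * (π * Y₂) → π * q ≈ h₁ + X → t * h₁ - X ≈ 0# →
            X ≈ ν 2 * Y₁ + t * π * Y₂ → w * X ≈ ν 4 * Y₁ + t * π * Y₂ → t₁ * X - t * (π * b) ≈ 0# →
            ν 2 * t₁ * F ≈ (w - 1#) * (π * b)
          assemble t t₁ t⁻¹ F q h₁ X Y₁ Y₂ w b unit t₁≈ F≈ q≈ h≈ X≈ wX≈ B≈ = cancel scaled
            where
            π*q : t * (π * q) ≈ t₁ * X
            π*q = combine₃ t q≈ 1# h≈ (- X) t₁≈ (identity (t ∷ π ∷ q ∷ t₁ ∷ X ∷ h₁ ∷ [])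
                (λ x y z u v w → x :* (y :* z) :- u :* v := x :* (y :* z :- (w :+ v)) :+ num 1 :* (x :* w :- v :- num 0)
                  :+ :- v :* (u :- (num 1 :+ x))))
            -- The two ways of splitting H⁽ᵗ⁾ have the same first-order term, so their difference
            -- eliminates Y₂.
            Y≈ : ν 2 * Y₁ ≈ (w - 1#) * X
            Y≈ = combine₂ (- 1#) wX≈ 1# X≈ (identity (Y₁ ∷ w ∷ X ∷ t ∷ π ∷ Y₂ ∷ [])
                (λ x y z u v w → num 2 :* x :- (y :- num 1) :* z := :- (num 1) :* (y :* z :- (num 4 :* x :+ u :* v :* w))
                  :+ num 1 :* (z :- (num 2 :* x :+ u :* v :* w))))
            tF : ν 2 * t * F ≈ t₁ * X - ν 2 * t * Y₁ - t₁ * (t * π * Y₂)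
            tF = combine₄ (ν 2 * t) F≈ (ν 2 * half) π*q (t₁ * X - t * t₁ * π * Y₂) 2*half (t * ν 2 * half * π * Y₂) t₁≈
                (identity (t ∷ F ∷ t₁ ∷ X ∷ Y₁ ∷ π ∷ Y₂ ∷ half ∷ q ∷ [])
                (λ x y z u v w p q s → num 2 :* x :* y :- (z :* u :- num 2 :* x :* v :- z :* (x :* w :* p)) := num 2
                  :* x :* (y :- (q :* (w :* s) :- v :- (num 1 :+ x) :* q :* (w :* p))) :+ num 2 :* q :* (x :* (w :* s)
                  :- z :* u) :+ (z :* u :- x :* z :* w :* p) :* (num 2 :* q :- num 1) :+ x :* num 2 :* q :* w :* p :* (z
                  :- (num 1 :+ x))))
            -- Since tπY₂ = X - 2Y₁, the terms t₁X cancel and (t₁ - t)·2Y₁ = 2Y₁ is left.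
            2tF : ν 2 * t * F ≈ (w - 1#) * X
            2tF = combine₄ 1# tF (t₁ - t) Y≈ t₁ X≈ ((w - 1#) * X) t₁≈
                (identity (t ∷ F ∷ w ∷ X ∷ t₁ ∷ Y₁ ∷ π ∷ Y₂ ∷ [])
                (λ x y z u v w p q → num 2 :* x :* y :- (z :- num 1) :* u := num 1 :* (num 2 :* x :* y :- (v :* u :- num 2
                  :* x :* w :- v :* (x :* p :* q))) :+ (v :- x) :* (num 2 :* w :- (z :- num 1) :* u) :+ v :* (u :- (num 2
                  :* w :+ x :* p :* q)) :+ (z :- num 1) :* u :* (v :- (num 1 :+ x))))
            scaled : t * (ν 2 * t₁ * F) ≈ t * ((w - 1#) * (π * b))
            scaled = combine₂ t₁ 2tF (w - 1#) B≈ (identity (t ∷ t₁ ∷ F ∷ w ∷ π ∷ b ∷ X ∷ [])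
                (λ x y z u v w p → x :* (num 2 :* y :* z) :- x :* ((u :- num 1) :* (v :* w)) := y :* (num 2 :* x :* z
                  :- (u :- num 1) :* p) :+ (u :- num 1) :* (y :* p :- x :* (v :* w) :- num 0)))
            cancel : ∀ {x y} → t * x ≈ t * y → x ≈ y
            cancel {x} {y} eq = combine₂ t⁻¹ eq (y - x) unit (solve (x ∷ y ∷ t⁻¹ ∷ t ∷ []))

      -- Part (ii), in a ring where π³ = 0

      module Quadratic (π³≈0 : π * π * π ≈ 0#) where
        open Reflection π³≈0

        private
          Z : ℕ → Carrier
          Z = Y m N≡2m

        ∣*∣² : ∀ {x y} → π ∣ x → π² ∣ y → x * y ≈ 0#
        ∣*∣² {x} {y} (q , eq) (q′ , eq′) = combine₃ (- (q′ * π²)) eq (- x) eq′ (q * q′) π³≈0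
            (identity (x ∷ y ∷ q′ ∷ π ∷ q ∷ [])
            (λ x y z u v → x :* y :- num 0 := :- (z :* (u :* u)) :* (v :* u :- x) :+ :- x :* (z :* (u :* u) :- y)
              :+ v :* z :* (u :* u :* u :- num 0)))

        square-^ : ∀ u n → (u * u) ^ n ≈ u ^ (n ℕ.+ n)
        square-^ u zero    = refl
        square-^ u (suc n) rewrite ℕ.+-suc n n = combine₁ (u * u) (square-^ u n)
            (solve (u ∷ (u * u) ^ n ∷ u ^ (n ℕ.+ n) ∷ []))

        psum-sq : ∀ i → psum sq i N ≈ psum inv (i ℕ.+ i) N
        psum-sq i = Σ-cong N λ k _ → square-^ (inv (suc k)) i

        π∣psum-sq : ∀ i → suc i ℕ.+ suc i < N → π ∣ psum sq (suc i) N
        π∣psum-sq i i<N = ∣-respʳ-≈ (sym (psum-sq (suc i))) (H-div (i ℕ.+ suc i) i<N)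

        module _ (ρ : Carrier) (π∣ρ : π ∣ ρ) where

          ρ³≈0 : ρ * ρ * ρ ≈ 0#
          ρ³≈0 = trans (*-comm _ _) (∣*∣² π∣ρ (∣-* π∣ρ π∣ρ))

          -- With K = k + 1, (ρ)_K(1-ρ)_K/K!² is ρ(K - ρ)/K² times the product of 1 - ρ²/j² over j <
          -- K, and that product is 1 next to the factor ρ because ρ³ = 0.
          b-ρ : ∀ k → k < N → b ρ (suc k) ≈ ρ * inv (suc k) * (1# - ρ * inv (suc k))
          b-ρ zero    k<N = combine₁ (ρ * inv 1) (inv-spec 0 k<N) (solve (ρ ∷ inv 1 ∷ []))
          b-ρ (suc k) k<N = combine₄ ((ρ + ν (suc k)) * (ν (suc (suc k)) - ρ) * sq (suc (suc k))) (b-ρ k k′<N)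
            (ρ * (1# - ρ * v) * (ν (suc (suc k)) - ρ) * sq (suc (suc k))) (inv-spec k k′<N)
            (- (v * v * (ν (suc (suc k)) - ρ) * sq (suc (suc k)))) ρ³≈0
            (ρ * inv (suc (suc k))) (inv-spec (suc k) k<N)
                (identity (b ρ k ∷ ρ ∷ ν k ∷ ν (suc k) ∷ inv (suc k) ∷ inv (suc (suc k)) ∷ [])
                (λ x y z u v w → x :* ((y :+ z) :* (u :- y)) :* (v :* v) :* ((y :+ u) :* (u :+ num 1 :- y)) :* (w
                  :* w) :- y :* w :* (num 1 :- y :* w) := (y :+ u) :* (u :+ num 1 :- y) :* (w :* w) :* (x :* ((y :+ z)
                  :* (u :- y)) :* (v :* v) :- y :* v :* (num 1 :- y :* v)) :+ y :* (num 1 :- y :* v) :* (u :+ num 1 :- y)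
                  :* (w :* w) :* (u :* v :- num 1) :+ :- (v :* v :* (u :+ num 1 :- y) :* (w :* w)) :* (y :* y :* y
                  :- num 0) :+ y :* w :* ((u :+ num 1) :* w :- num 1)))
            where
            k′<N : k < N
            k′<N = ℕ.<-trans (ℕ.n<1+n k) k<N
            v : Carrier
            v = inv (suc k)

          Γ-ρ : ∀ k → k ≤ N → ρ * Γ ρ k ≈ ρ
          Γ-ρ zero    _   = *-identityʳ ρ
          Γ-ρ (suc k) k<N = combine₃ 1# (Γ-ρ k (ℕ.<⇒≤ k<N)) (ρ * Γ ρ k) (sq-spec k k<N)
            (- (Γ ρ k * sq (suc k))) ρ³≈0 (identity (ρ ∷ Γ ρ k ∷ ν (suc k) ∷ inv (suc k) ∷ [])
                (λ x y z u → x :* (y :* (z :* z :- x :* x) :* (u :* u)) :- x := num 1 :* (x :* y :- x) :+ x :* y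
                  :* (z :* z :* (u :* u) :- num 1) :+ :- (y :* (u :* u)) :* (x :* x :* x :- num 0)))

          -- `Γ α n` is (1+α)ₙ(1-α)ₙ/n!², and α ↦ α + 1 exchanges one end factor in each of the two
          -- products.
          Γ-suc : ∀ α n → Γ α n * (α + 1# + ν n) * α ≈ Γ (α + 1#) n * (α + 1#) * (α - ν n)
          Γ-suc α zero    = solve (α ∷ [])
          Γ-suc α (suc n) = combine₂ ((ν (suc n) - α) * (α + 1# + ν (suc n)) * sq (suc n)) (Γ-suc α n)
            ((ν (suc n) - α) * (α + 1# + ν (suc n)) * sq (suc n) * (α * Γ α n + Γ (α + 1#) n * (α + 1#))) (ν-suc n)
                (identity (Γ α n ∷ ν (suc n) ∷ α ∷ inv (suc n) ∷ Γ (α + 1#) n ∷ ν n ∷ [])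
                (λ x y z u v w → x :* (y :* y :- z :* z) :* (u :* u) :* (z :+ num 1 :+ y) :* z :- v :* (y :* y :- (z
                  :+ num 1) :* (z :+ num 1)) :* (u :* u) :* (z :+ num 1) :* (z :- y) := (y :- z) :* (z :+ num 1 :+ y) :* (u
                  :* u) :* (x :* (z :+ num 1 :+ w) :* z :- v :* (z :+ num 1) :* (z :- w)) :+ (y :- z) :* (z :+ num 1
                  :+ y) :* (u :* u) :* (z :* x :+ v :* (z :+ num 1)) :* (y :- (num 1 :+ w))))

          private
            -- The invariant of the descent: the value of Γ(α)·α·(α - π) at α = ρ, where Γ acts as 1
            -- on ρ. It is a multiple of π².
            κ : Carrier
            κ = ρ * (ρ - π)

            π²∣κ : π² ∣ κ
            π²∣κ = ∣-* π∣ρ (∣-+ π∣ρ (∣-neg ∣-refl))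

            Γ-Spec : ℕ → Set
            Γ-Spec j = Γ (ρ - ν j) N * (ρ - ν j) * (ρ - ν j - π) ≈ κ

            Γ-Step : ℕ → Set
            Γ-Step j = let α = ρ - ν (suc j) in Γ α N * (α + π) * α ≈ κ

          Γ-step : ∀ j → Γ-Spec j → Γ-Step j
          Γ-step j spec = begin
            Γ α N * (α + π) * α                           ≈⟨ combine₁ (Γ α N * α) (ν-suc N)
                (solve (Γ α N ∷ ρ ∷ ν (suc j) ∷ π ∷ ν N ∷ [])) ⟩
            Γ α N * (α + 1# + ν N) * α                    ≈⟨ Γ-suc α N ⟩
            Γ (α + 1#) N * (α + 1#) * (α - ν N)           ≈⟨ *-cong (*-cong (Γ-cong N α+1) α+1) (combine₂ (- 1#) (ν-suc j) 1# (ν-suc N)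
                (solve (ρ ∷ ν (suc j) ∷ ν N ∷ ν j ∷ π ∷ []))) ⟩
            Γ (ρ - ν j) N * (ρ - ν j) * (ρ - ν j - π)     ≈⟨ spec ⟩
            κ                                             ∎
            where
            α : Carrier
            α = ρ - ν (suc j)
            α+1 : α + 1# ≈ ρ - ν j
            α+1 = combine₁ (- 1#) (ν-suc j) (solve (ρ ∷ ν (suc j) ∷ ν j ∷ []))

          -- The step says Γ = (κ - απΓ)/α², and π² ∣ κ. Divisibility is bootstrapped: π ∣ πΓ gives
          -- π ∣ Γ, hence π² ∣ πΓ, which gives π² ∣ Γ.
          Γ-step-div : ∀ j → j < N → Γ-Step j → π² ∣ Γ (ρ - ν (suc j)) N
          Γ-step-div j j<N step = isolate (∣-* ∣-refl (isolate′ (∣-*ʳ x ∣-refl)))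
            where
            α β x : Carrier
            α = ρ - ν (suc j)
            β = shifted ρ (inv (suc j))
            x = Γ α N
            αβ : α * β ≈ - 1#
            αβ = shifted-spec ρ ρ³≈0 (ν (suc j)) (inv (suc j)) (inv-spec j j<N)
            x≈ : β * β * (κ - α * (π * x)) ≈ x
            x≈ = combine₂ (- (β * β)) step (x * (α * β - 1#)) αβ
                (identity (inv (suc j) ∷ ρ ∷ π ∷ ν (suc j) ∷ x ∷ [])
                (λ x y z u v → x :* (num 1 :+ y :* x :+ y :* x :* (y :* x)) :* (x :* (num 1 :+ y :* x :+ y :* x :* (y
                  :* x))) :* (y :* (y :- z) :- (y :- u) :* (z :* v)) :- v := :- (x :* (num 1 :+ y :* x :+ y :* x
                  :* (y :* x)) :* (x :* (num 1 :+ y :* x :+ y :* x :* (y :* x)))) :* (v :* (y :- u :+ z) :* (y :- u)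
                  :- y :* (y :- z)) :+ v :* ((y :- u) :* (x :* (num 1 :+ y :* x :+ y :* x :* (y :* x))) :- num 1) :* ((y
                  :- u) :* (x :* (num 1 :+ y :* x :+ y :* x :* (y :* x))) :- :- (num 1))))
            isolate : π² ∣ π * x → π² ∣ x
            isolate h = ∣-respʳ-≈ x≈ (∣-*ˡ (β * β) (∣-+ π²∣κ (∣-neg (∣-*ˡ α h))))
            isolate′ : π ∣ π * x → π ∣ x
            isolate′ h = ∣-respʳ-≈ x≈ (∣-*ˡ (β * β) (∣-+ (π²∣⇒π∣ π²∣κ) (∣-neg (∣-*ˡ α h))))

          Γ-spec-zero : Γ-Spec 0
          Γ-spec-zero = combine₂ ((ρ - π) * ρ) (Γ-cong {ρ - ν 0} {ρ} N
              (solve (ρ ∷ []))) (ρ - π) (Γ-ρ N ℕ.≤-refl) (solve (Γ (ρ - ν 0) N ∷ ρ ∷ π ∷ Γ ρ N ∷ []))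

          -- α + π and α - π differ by 2π, and πΓ = 0 since Γ is a multiple of π².
          Γ-spec-suc : ∀ j → Γ-Step j → π² ∣ Γ (ρ - ν (suc j)) N → Γ-Spec (suc j)
          Γ-spec-suc j step π²∣C = combine₂ 1# step (- ν 2 * (ρ - ν (suc j))) (∣*∣² ∣-refl π²∣C)
              (identity (Γ (ρ - ν (suc j)) N ∷ ρ ∷ ν (suc j) ∷ π ∷ [])
              (λ x y z u → x :* (y :- z) :* (y :- z :- u) :- y :* (y :- u) := num 1 :* (x :* (y :- z :+ u) :* (y
                :- z) :- y :* (y :- u)) :+ :- (num 2) :* (y :- z) :* (u :* x :- num 0)))

          Γ-spec : ∀ j → j ≤ N → Γ-Spec j
          Γ-spec zero    _   = Γ-spec-zero
          Γ-spec (suc j) j<N = Γ-spec-suc j step (Γ-step-div j j<N step)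
            where
            step : Γ-Step j
            step = Γ-step j (Γ-spec j (ℕ.<⇒≤ j<N))

          Γ-div : ∀ j → j < N → π² ∣ Γ (ρ - ν (suc j)) N
          Γ-div j j<N = Γ-step-div j j<N step
            where
            step : Γ-Step j
            step = Γ-step j (Γ-spec j (ℕ.<⇒≤ j<N))

          Ψ-at-ρ : ∀ r → Ψ r ρ ≈ ρ * h sq (suc r) N - ρ * ρ * Σ N (λ k → inv k * sq k * h sq r k)
          Ψ-at-ρ r = begin
            Ψ r ρ
              ≈⟨ Σ-cong N (λ k k<N → combine₁ (inv (suc k) * h sq r (suc k)) (b-ρ k k<N)
                  (identity (b ρ k ∷ ρ ∷ ν k ∷ ν (suc k) ∷ inv (suc k) ∷ h sq r (suc k) ∷ [])
                  (λ x y z u v w → x :* ((y :+ z) :* (u :- y)) :* (v :* v) :* v :* w :- (y :* (w :* (v :* v)) :- y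
                    :* y :* (v :* (v :* v) :* w)) := v :* w :* (x :* ((y :+ z) :* (u :- y)) :* (v :* v) :- y :* v
                    :* (num 1 :- y :* v))))) ⟩
            Σ N (λ k → ρ * (h sq r k * sq k) - ρ * ρ * (inv k * sq k * h sq r k))
              ≈⟨ Σ-- N _ _ ⟨
            Σ N (λ k → ρ * (h sq r k * sq k)) - Σ N (λ k → ρ * ρ * (inv k * sq k * h sq r k))
              ≈⟨ +-cong (sym (Σ-*ˡ N ρ _)) (-‿cong (sym (Σ-*ˡ N (ρ * ρ) _))) ⟩
            ρ * h sq (suc r) N - ρ * ρ * Σ N (λ k → inv k * sq k * h sq r k)
              ∎

          -- With s = 2r + 1 and u = 1/(n+1), one step contributes 2β^s(1 - Γ). As Γ = u²ρ(ρ - π) is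
          -- already of second order, it meets only the leading term u^s of β^s; this gives the last
          -- summand.
          Ψ-descent : ∀ r → let s = suc (r ℕ.+ r) in s < N → ∀ n → n ≤ N →
            Ψ r ρ ≈ Ψ r (ρ - ν n)
              + ν 2 * (psum inv s n + ν s * ρ * psum inv (suc s) n + ν (tri s) * (ρ * ρ) * psum inv (suc (suc s)) n)
              - ν 2 * (ρ * (ρ - π)) * psum inv (suc (suc s)) n
          Ψ-descent r r<N zero    _   = combine₁ 1# (Ψ-cong r {ρ} {ρ - ν 0}
              (solve (ρ ∷ []))) (identity (Ψ r ρ ∷ Ψ r (ρ - ν zero) ∷ ν (suc (r ℕ.+ r)) ∷ ρ
                ∷ ν (tri (suc (r ℕ.+ r))) ∷ π ∷ [])
              (λ x y z u v w → x :- (y :+ num 2 :* (num 0 :+ z :* u :* num 0 :+ v :* (u :* u) :* num 0) :- num 2 :* (u :* (u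
                :- w)) :* num 0) := num 1 :* (x :- y)))
          Ψ-descent r r<N (suc n) n<N = combine₃ 1# (Ψ-descent r r<N n (ℕ.<⇒≤ n<N)) 1# shifted-eq 1# step
              (identity (Ψ r ρ ∷ Ψ r (ρ - ν (suc n)) ∷ psum inv (suc (r ℕ.+ r)) n ∷ inv (suc n)
                ∷ inv (suc n) ^ (r ℕ.+ r) ∷ ν (suc (r ℕ.+ r)) ∷ ρ ∷ psum inv (suc (suc (r ℕ.+ r))) n
                ∷ ν (tri (suc (r ℕ.+ r))) ∷ psum inv (suc (suc (suc (r ℕ.+ r)))) n ∷ π ∷ Ψ r (ρ - ν n)
                ∷ Ψ r (α + 1#) ∷ [])
              (λ x y z u v w p q s t k l o → x :- (y :+ num 2 :* (z :+ u :* v :+ w :* p :* (q :+ u :* (u :* v)) :+ s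
                :* (p :* p) :* (t :+ u :* (u :* (u :* v)))) :- num 2 :* (p :* (p :- k)) :* (t :+ u :* (u :* (u :* v))))
                := num 1 :* (x :- (l :+ num 2 :* (z :+ w :* p :* q :+ s :* (p :* p) :* t) :- num 2 :* (p :* (p :- k))
                :* t)) :+ num 1 :* (l :- o) :+ num 1 :* (o :- y :- (num 2 :* (u :* v :+ w :* p :* (u :* (u :* v)) :+ s
                :* (p :* p) :* (u :* (u :* (u :* v)))) :- num 2 :* (p :* (p :- k)) :* (u :* (u :* (u :* v)))))))
            where
            s : ℕ
            s = suc (r ℕ.+ r)
            u β α x : Carrier
            u = inv (suc n)
            β = shifted ρ u
            α = ρ - ν (suc n)
            x = Γ α N
            shifted-eq : Ψ r (ρ - ν n) ≈ Ψ r (α + 1#)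
            shifted-eq = Ψ-cong r (combine₁ 1# (ν-suc n) (solve (ρ ∷ ν n ∷ ν (suc n) ∷ [])))
            αβ : α * β ≈ - 1#
            αβ = shifted-spec ρ ρ³≈0 (ν (suc n)) u (inv-spec n n<N)
            ρx : ρ * x ≈ 0#
            ρx = ∣*∣² π∣ρ (Γ-div n n<N)
            πx : π * x ≈ 0#
            πx = ∣*∣² ∣-refl (Γ-div n n<N)
            ρκ : ρ * κ ≈ 0#
            ρκ = ∣*∣² π∣ρ π²∣κ
            -- β - u is a multiple of ρ, and ρκ = 0.
            β² : β * β * κ ≈ u * u * κ
            β² = combine₁ (u * u * (u + ρ * (u * u)) * (ν 2 + ρ * u + ρ * u * (ρ * u))) ρκ
                (identity (u ∷ ρ ∷ π ∷ [])
                (λ x y z → x :* (num 1 :+ y :* x :+ y :* x :* (y :* x)) :* (x :* (num 1 :+ y :* x :+ y :* x :* (y :* x)))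
                  :* (y :* (y :- z)) :- x :* x :* (y :* (y :- z)) := x :* x :* (x :+ y :* (x :* x)) :* (num 2 :+ y
                  :* x :+ y :* x :* (y :* x)) :* (y :* (y :* (y :- z)) :- num 0)))
            x≈ : x ≈ u * u * κ
            x≈ = combine₄ (β * β) (Γ-spec (suc n) n<N) (x * (1# - α * β)) αβ (α * β * β) πx 1# β²
                (identity (x ∷ u ∷ ρ ∷ π ∷ ν (suc n) ∷ [])
                (λ x y z u v → x :- y :* y :* (z :* (z :- u)) := y :* (num 1 :+ z :* y :+ z :* y :* (z :* y)) :* (y
                  :* (num 1 :+ z :* y :+ z :* y :* (z :* y))) :* (x :* (z :- v) :* (z :- v :- u) :- z :* (z :- u))
                  :+ x :* (num 1 :- (z :- v) :* (y :* (num 1 :+ z :* y :+ z :* y :* (z :* y)))) :* ((z :- v) :* (y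
                  :* (num 1 :+ z :* y :+ z :* y :* (z :* y))) :- :- (num 1)) :+ (z :- v) :* (y :* (num 1 :+ z :* y :+ z
                  :* y :* (z :* y))) :* (y :* (num 1 :+ z :* y :+ z :* y :* (z :* y))) :* (u :* x :- num 0) :+ num 1
                  :* (y :* (num 1 :+ z :* y :+ z :* y :* (z :* y)) :* (y :* (num 1 :+ z :* y :+ z :* y :* (z :* y)))
                  :* (z :* (z :- u)) :- y :* y :* (z :* (z :- u)))))
            -- A multiple of π² times a multiple of π.
            vanish : ∀ i → i < r → x * h sq (suc i) N ≈ 0#
            vanish i i<r = trans (*-comm _ _) (∣*∣² (h-divisible sq i (ℕ.<-trans i<s r<N)
              (λ j j≤i → π∣psum-sq j (ℕ.≤-<-trans (ℕ.≤-trans (ℕ.+-mono-≤ (j<r j≤i) (j<r j≤i)) (ℕ.n≤1+n _)) r<N))) (Γ-div n n<N))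
              where
              i<s : i < s
              i<s = ℕ.<-≤-trans i<r (ℕ.≤-trans (ℕ.m≤m+n r r) (ℕ.n≤1+n _))
              j<r : ∀ {j} → j ≤ i → j < r
              j<r j≤i = ℕ.≤-<-trans j≤i i<r
            step : Ψ r (α + 1#) - Ψ r α ≈ ν 2 * (u ^ s + ν s * ρ * u ^ suc s + ν (tri s) * (ρ * ρ) * u ^ suc (suc s))
                     - ν 2 * (ρ * (ρ - π)) * u ^ suc (suc s)
            step = combine₄ 1# (Ψ-shift r α β αβ vanish) (ν 2 * (1# - x)) (shifted-^ ρ ρ³≈0 u s)
              (- (ν 2 * u ^ s)) x≈ (- ν 2 * (ν s * u ^ suc s + ν (tri s) * ρ * u ^ suc (suc s))) ρx
                  (identity (Ψ r (α + 1#) ∷ Ψ r α ∷ u ∷ u ^ (r ℕ.+ r) ∷ ν s ∷ ρ ∷ ν (tri s) ∷ π ∷ β ^ (r ℕ.+ r)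
                    ∷ Γ α N ∷ [])
                  (λ x y z u v w p q s t → x :- y :- (num 2 :* (z :* u :+ v :* w :* (z :* (z :* u)) :+ p :* (w :* w)
                    :* (z :* (z :* (z :* u)))) :- num 2 :* (w :* (w :- q)) :* (z :* (z :* (z :* u)))) := num 1 :* (x
                    :- y :- num 2 :* (z :* (num 1 :+ w :* z :+ w :* z :* (w :* z)) :* s) :* (num 1 :- t)) :+ num 2 :* (num 1
                    :- t) :* (z :* (num 1 :+ w :* z :+ w :* z :* (w :* z)) :* s :- (z :* u :+ v :* w :* (z :* (z
                    :* u)) :+ p :* (w :* w) :* (z :* (z :* (z :* u))))) :+ :- (num 2 :* (z :* u)) :* (t :- z :* z
                    :* (w :* (w :- q))) :+ :- (num 2) :* (v :* (z :* (z :* u)) :+ p :* w :* (z :* (z :* (z :* u))))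
                    :* (w :* t :- num 0)))

        -- At α = 1 the factor (1-α)ₖ starts with 0; therefore the full descent from p ends at zero.
        b-one : ∀ k → b 1# (suc k) ≈ 0#
        b-one zero    = solve (inv 1 ∷ [])
        b-one (suc k) = combine₁ ((1# + ν (suc k)) * (ν (suc (suc k)) - 1#) * sq (suc (suc k))) (b-one k)
            (identity (b 1# k ∷ ν k ∷ ν (suc k) ∷ inv (suc k) ∷ inv (suc (suc k)) ∷ [])
            (λ x y z u v → x :* ((num 1 :+ y) :* (z :- num 1)) :* (u :* u) :* ((num 1 :+ z) :* (z :+ num 1 :- num 1)) :* (v
              :* v) :- num 0 := (num 1 :+ z) :* (z :+ num 1 :- num 1) :* (v :* v) :* (x :* ((num 1 :+ y) :* (z :- num 1)) :* (u
              :* u) :- num 0)))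

        Ψ-one : ∀ r → Ψ r 1# ≈ 0#
        Ψ-one r = trans (Σ-cong N λ k _ → combine₁ (inv (suc k) * h sq r (suc k)) (b-one k)
            (identity (b 1# k ∷ ν k ∷ ν (suc k) ∷ inv (suc k) ∷ h sq r (suc k) ∷ [])
            (λ x y z u v → x :* ((num 1 :+ y) :* (z :- num 1)) :* (u :* u) :* u :* v :- num 0 := u :* v :* (x :* ((num 1
              :+ y) :* (z :- num 1)) :* (u :* u) :- num 0)))) (zero-sum N)
          where
          zero-sum : ∀ n → Σ n (λ _ → 0#) ≈ 0#
          zero-sum zero    = refl
          zero-sum (suc n) = trans (+-identityʳ _) (zero-sum n)

        halve : ∀ {F g u Z₀ y z s′ τ} →
          F ≈ half * g - half * half * u - ν 2 * (Z₀ + s′ * half * y + τ * (half * half) * z) + ν 2 * (half * (half - 1#)) * z →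
          ν 2 * (ν 2 * (F + ν 2 * Z₀)) ≈ ν 2 * g - u - ν 4 * s′ * y - ν 2 * τ * z - ν 2 * z
        halve {F} {g} {u} {Z₀} {y} {z} {s′} {τ} F≈ = combine₂ (ν 4) F≈
          (ν 2 * g - u * (ν 2 * half + 1#) - ν 4 * s′ * y - ν 2 * τ * z * (ν 2 * half + 1#)
            + ν 2 * z * (ν 2 * half - 1#)) 2*half (identity (F ∷ Z₀ ∷ g ∷ u ∷ s′ ∷ y ∷ τ ∷ z ∷ half ∷ [])
                (λ x y z u v w p q s → num 2 :* (num 2 :* (x :+ num 2 :* y)) :- (num 2 :* z :- u :- num 4 :* v :* w :- num 2
                  :* p :* q :- num 2 :* q) := num 4 :* (x :- (s :* z :- s :* s :* u :- num 2 :* (y :+ v :* s :* w :+ p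
                  :* (s :* s) :* q) :+ num 2 :* (s :* (s :- num 1)) :* q)) :+ (num 2 :* z :- u :* (num 2 :* s :+ num 1) :- num 4
                  :* v :* w :- num 2 :* p :* q :* (num 2 :* s :+ num 1) :+ num 2 :* q :* (num 2 :* s :- num 1)) :* (num 2 :* s
                  :- num 1)))

        -- The linear relations between a = π H_N, y = π H_m, z = π² H_m′, g = π T and u = π² U, where t = s′ + 1 = 2 R + 2.
        assemble : ∀ {R s′ t t₁ t⁻¹ F g u X₀ a Z₀ y z τ w b} →
          t * t⁻¹ ≈ 1# → s′ ≈ 1# + (R + R) → t ≈ 1# + s′ → t₁ ≈ 1# + t → ν 2 * τ ≈ s′ * (1# + s′) →
          F ≈ half * g - half * half * u - ν 2 * (Z₀ + s′ * half * y + τ * (half * half) * z) + ν 2 * (half * (half - 1#)) * z →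
          u ≈ g - ν 2 * (X₀ + s′ * a) → ν 2 * X₀ + s′ * a ≈ 0# → (1# + R) * g ≈ a →
          a ≈ ν 2 * y + t * z → w * a ≈ ν 4 * y + t * z → t₁ * a ≈ t * b →
          ν 2 * (F + ν 2 * Z₀) ≈ - (R * (w - 1#) * b)
        assemble {R} {s′} {t} {t₁} {t⁻¹} {F} {g} {u} {X₀} {a} {Z₀} {y} {z} {τ} {w} {b}
          unit s≈ t≈ t₁≈ τ≈ F≈ u≈ X₀≈ g≈ a≈ wa≈ b≈ =
          cancel-2 (cancel (trans tG≈ (trans simplify tG≈′)))
          where
          W : Carrier
          W = w - 1#
          u≈′ : u ≈ g - s′ * a
          u≈′ = combine₂ 1# u≈ (- 1#) X₀≈ (solve (u ∷ g ∷ s′ ∷ a ∷ X₀ ∷ []))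
          tg≈ : t * g ≈ ν 2 * a
          tg≈ = combine₃ g t≈ g s≈ (ν 2) g≈ (solve (t ∷ g ∷ a ∷ s′ ∷ R ∷ []))
          y≈ : ν 2 * y ≈ W * a
          y≈ = combine₂ (- 1#) wa≈ 1# a≈ (solve (y ∷ w ∷ a ∷ t ∷ z ∷ []))
          tz≈ : t * z ≈ (1# - W) * a
          tz≈ = combine₂ (- 1#) a≈ (- 1#) y≈ (solve (t ∷ z ∷ w ∷ a ∷ y ∷ []))
          substitute : ∀ {G u g a y z W t s′ τ} → G ≈ ν 2 * g - u - ν 4 * s′ * y - ν 2 * τ * z - ν 2 * z → u ≈ g - s′ * a →
            t * g ≈ ν 2 * a → ν 2 * y ≈ W * a → t * z ≈ (1# - W) * a →
            t * G ≈ ν 2 * a + t * s′ * a - ν 2 * t * s′ * (W * a) - (ν 2 * τ + ν 2) * ((1# - W) * a)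
          substitute {G} {u} {g} {a} {y} {z} {W} {t} {s′} {τ} h₁ h₂ h₃ h₄ h₅ = begin
            t * G
              ≈⟨ *-congˡ (trans h₁ (+-congʳ (+-congʳ (+-congʳ (+-congˡ (-‿cong h₂)))))) ⟩
            t * (ν 2 * g - (g - s′ * a) - ν 4 * s′ * y - ν 2 * τ * z - ν 2 * z)
              ≈⟨ combine₃ 1# h₃ (- (ν 2 * t * s′)) h₄ (- (ν 2 * τ + ν 2)) h₅
                  (identity (t ∷ g ∷ s′ ∷ a ∷ y ∷ τ ∷ z ∷ W ∷ [])
                  (λ x y z u v w p q → x :* (num 2 :* y :- (y :- z :* u) :- num 4 :* z :* v :- num 2 :* w :* p :- num 2
                    :* p) :- (num 2 :* u :+ x :* z :* u :- num 2 :* x :* z :* (q :* u) :- (num 2 :* w :+ num 2) :* ((num 1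
                    :- q) :* u)) := num 1 :* (x :* y :- num 2 :* u) :+ :- (num 2 :* x :* z) :* (num 2 :* v :- q :* u) :+
                    :- (num 2 :* w :+ num 2) :* (x :* p :- (num 1 :- q) :* u))) ⟩
            ν 2 * a + t * s′ * a - ν 2 * t * s′ * (W * a) - (ν 2 * τ + ν 2) * ((1# - W) * a)
              ∎
          tG≈ : t * (ν 2 * (ν 2 * (F + ν 2 * Z₀))) ≈ ν 2 * a + t * s′ * a - ν 2 * t * s′ * (W * a) - (ν 2 * τ + ν 2) * ((1# - W) * a)
          tG≈ = substitute {ν 2 * (ν 2 * (F + ν 2 * Z₀))} {u} {g} {a} {y} {z} {W} {t} {s′} {τ} (halve F≈) u≈′ tg≈ y≈ tz≈
          simplify : ν 2 * a + t * s′ * a - ν 2 * t * s′ * (W * a) - (ν 2 * τ + ν 2) * ((1# - W) * a) ≈ W * (ν 2 - t * s′) * a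
          simplify = combine₂ (- ((1# - W) * a)) τ≈ ((1# - W) * a * s′) t≈ (identity (a ∷ t ∷ s′ ∷ w ∷ τ ∷ [])
              (λ x y z u v → num 2 :* x :+ y :* z :* x :- num 2 :* y :* z :* ((u :- num 1) :* x) :- (num 2 :* v :+ num 2)
                :* ((num 1 :- (u :- num 1)) :* x) :- (u :- num 1) :* (num 2 :- y :* z) :* x := :- ((num 1 :- (u :- num 1))
                :* x) :* (num 2 :* v :- z :* (num 1 :+ z)) :+ (num 1 :- (u :- num 1)) :* x :* z :* (y :- (num 1 :+ z))))
          -- 2 - ts′ = (2 - t)(t + 1) = -2R·t₁: this produces the factor r of the theorem, and also
          -- the t₁ required by t₁a = tb.
          tG≈′ : W * (ν 2 - t * s′) * a ≈ t * (ν 2 * - (R * W * b))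
          tG≈′ = combine₄ (- (ν 2 * R * W)) b≈ (ν 2 * R * W * a) t₁≈ (- (W * a * t + W * a)) s≈ (- (W * a)) t≈
              (identity (w ∷ t ∷ s′ ∷ a ∷ R ∷ b ∷ t₁ ∷ [])
              (λ x y z u v w p → (x :- num 1) :* (num 2 :- y :* z) :* u :- y :* (num 2 :* :- (v :* (x :- num 1) :* w))
                := :- (num 2 :* v :* (x :- num 1)) :* (p :* u :- y :* w) :+ num 2 :* v :* (x :- num 1) :* u :* (p :- (num 1
                :+ y)) :+ :- ((x :- num 1) :* u :* y :+ (x :- num 1) :* u) :* (z :- (num 1 :+ (v :+ v))) :+ :- ((x :- num 1)
                :* u) :* (y :- (num 1 :+ z))))
          cancel : ∀ {x x′} → t * x ≈ t * x′ → x ≈ x′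
          cancel {x} {x′} eq = combine₂ t⁻¹ eq (x′ - x) unit (solve (x ∷ x′ ∷ t⁻¹ ∷ t ∷ []))
          cancel-2 : ∀ {x x′} → ν 2 * x ≈ ν 2 * x′ → x ≈ x′
          cancel-2 {x} {x′} eq = combine₂ half eq (x′ - x) 2*half (solve (x ∷ x′ ∷ half ∷ []))

        U : ℕ → Carrier
        U r = Σ N (λ k → inv k * sq k * h sq r k)

        module _ (r : ℕ) (r<N : suc (suc (suc (r ℕ.+ r))) < N) where

          private
            s : ℕ
            s = suc (r ℕ.+ r)

            s<N : s < N
            s<N = ℕ.<⇒≤ (ℕ.<⇒≤ r<N)

            suc-r+suc-r : suc r ℕ.+ suc r ≡ suc s
            suc-r+suc-r = ≡.cong suc (ℕ.+-suc r r)

          vanishing : π * π * H (suc (suc s)) ≈ 0#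
          vanishing = trans (*-comm _ _) (∣*∣² (H-div (suc s) r<N) ∣-refl)

          -- At ρ = π the summand with ρ(ρ - π) is zero, the descent ends at Ψ(1) = 0, and the
          -- second-order sum is annihilated by π² because π divides H⁽²ʳ⁺³⁾.
          U-formula : π * π * U r ≈ π * h sq (suc r) N - ν 2 * (H s + ν s * (π * H (suc s)))
          U-formula = combine₄ 1# (Ψ-at-ρ π ∣-refl r) (- 1#) (Ψ-descent π ∣-refl r s<N N ℕ.≤-refl)
            (- 1#) (trans (Ψ-cong r {π - ν N} {1#} (combine₁ 1# (ν-suc N) (solve (π ∷ ν N ∷ [])))) (Ψ-one r))
            (- (ν 2 * ν (tri s))) vanishing
                (identity (π ∷ U r ∷ h sq (suc r) N ∷ H s ∷ ν s ∷ H (suc s) ∷ Ψ r π ∷ Ψ r (π - ν N)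
                  ∷ ν (tri (suc (r ℕ.+ r))) ∷ psum inv (suc (suc (suc (r ℕ.+ r)))) N ∷ [])
                (λ x y z u v w p q s t → x :* x :* y :- (x :* z :- num 2 :* (u :+ v :* (x :* w))) := num 1 :* (p :- (x
                  :* z :- x :* x :* y)) :+ :- (num 1) :* (p :- (q :+ num 2 :* (u :+ v :* x :* w :+ s :* (x :* x) :* t)
                  :- num 2 :* (x :* (x :- x)) :* t)) :+ :- (num 1) :* (q :- num 0) :+ :- (num 2 :* s) :* (x :* x :* t :- num 0)))

          Ψ-half : Ψ r half ≈ π * half * h sq (suc r) N - π * half * (π * half) * U r
            - ν 2 * (Z s + ν s * (π * half) * Z (suc s) + ν (tri s) * (π * half * (π * half)) * Z (suc (suc s)))
            + ν 2 * (π * half * (π * half - π)) * Z (suc (suc s))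
          Ψ-half = rearrange (Ψ-at-ρ (π * half) π∣π*half r) (Ψ-descent (π * half) π∣π*half r s<N m (m≤N m N≡2m))
            (Ψ-cong r {π * half - ν m} {half} (combine₂ half π≈1+2m (ν m) 2*half (solve (π ∷ half ∷ ν m ∷ []))))
            where
            rearrange : ∀ {x y z u v q w} → x ≈ y - z → x ≈ u + v - ν 2 * q * w → u ≈ Ψ r half →
                        Ψ r half ≈ y - z - v + ν 2 * q * w
            rearrange {x} {y} {z} {u} {v} {q} {w} h₁ h₂ h₃ = combine₃ 1# h₁ (- 1#) h₂ (- 1#) h₃
                (identity (Ψ r half ∷ y ∷ z ∷ v ∷ q ∷ w ∷ x ∷ u ∷ [])
                (λ x y z u v w p q → x :- (y :- z :- u :+ num 2 :* v :* w) := num 1 :* (p :- (y :- z)) :+ :- (num 1)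
                  :* (p :- (q :+ u :- num 2 :* v :* w)) :+ :- (num 1) :* (q :- x)))

          -- In `Ψ-half` everything apart from Y⁽²ʳ⁺¹⁾ carries π or π². Hence Newton's relation for
          -- the 1/j² and the evaluation of H⁽²ʳ⁺²⁾, both known modulo π², become equations after
          -- multiplication by π; only the reflection of H⁽²ʳ⁺¹⁾ has to hold without that factor.
          -- `assemble` solves the resulting linear system.
          partII : ∀ l → suc (suc (r ℕ.+ r)) ℕ.+ suc l ≡ N →
                   ν 2 * (Ψ r half + ν 2 * Z s) ≈ - (ν r * (ν 2 ^ suc (suc s) - 1#) * (π * π * B (suc l)))
          partII l eq = assemble (inv-spec s (ℕ.<⇒≤ (ℕ.<⇒≤ r<N))) s≈ (ν-suc s) (ν-suc (suc s)) (2*tri s) F≈ U-formula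
            (trans (+-congˡ (sym (*-assoc _ _ _))) (odd-reflection r vanishing)) (trans (*-congʳ (sym (ν-suc r))) h≈) halves≈ parity≈
            (combine₁ 1# (∣*∣² ∣-refl (H-bernoulli B B-rec M 1+M≡N s l eq))
                (solve (ν (suc (r ℕ.+ r)) ∷ π ∷ H (suc s) ∷ B (suc l) ∷ [])))
            where
            F≈ : Ψ r half ≈ half * (π * h sq (suc r) N) - half * half * (π * π * U r)
              - ν 2 * (Z s + ν s * half * (π * Z (suc s)) + ν (tri s) * (half * half) * (π * π * Z (suc (suc s))))
              + ν 2 * (half * (half - 1#)) * (π * π * Z (suc (suc s)))
            F≈ = trans Ψ-half (+-cong (+-cong (+-cong (e₁ _ _ _) (-‿cong (e₂ _ _ _)))
              (-‿cong (*-congˡ (+-cong (+-congˡ (e₃ _ _ _ _)) (e₄ _ _ _ _))))) (e₅ _ _ _))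
              where
              e₁ : ∀ p q x → p * q * x ≈ q * (p * x)
              e₁ p q x = solve (p ∷ q ∷ x ∷ [])
              e₂ : ∀ p q x → p * q * (p * q) * x ≈ q * q * (p * p * x)
              e₂ p q x = solve (p ∷ q ∷ x ∷ [])
              e₃ : ∀ n p q x → n * (p * q) * x ≈ n * q * (p * x)
              e₃ n p q x = solve (n ∷ p ∷ q ∷ x ∷ [])
              e₄ : ∀ n p q x → n * (p * q * (p * q)) * x ≈ n * (q * q) * (p * p * x)
              e₄ n p q x = solve (n ∷ p ∷ q ∷ x ∷ [])
              e₅ : ∀ p q x → ν 2 * (p * q * (p * q - p)) * x ≈ ν 2 * (q * (q - 1#)) * (p * p * x)
              e₅ p q x = solve (p ∷ q ∷ x ∷ [])
            s≈ : ν s ≈ 1# + (ν r + ν r)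
            s≈ = trans (ν-suc (r ℕ.+ r)) (+-congˡ (ν-+ r r))
            h≈ : ν (suc r) * (π * h sq (suc r) N) ≈ π * H (suc s)
            h≈ = combine₂ 1# (∣*∣² ∣-refl (h-leading sq r (ℕ.<-trans (s≤s (ℕ.m≤m+n r r)) s<N) λ i i<r →
                π∣psum-sq i (ℕ.≤-<-trans (ℕ.≤-trans (ℕ.+-mono-≤ i<r i<r) (ℕ.n≤1+n _)) s<N)))
              π psum≈ (solve (ν (suc r) ∷ π ∷ h sq (suc r) N ∷ H (suc s) ∷ psum sq (suc r) N ∷ []))
              where
              psum≈ : psum sq (suc r) N ≈ H (suc s)
              psum≈ = trans (psum-sq (suc r)) (reflexive (≡.cong H suc-r+suc-r))
            halves≈ : π * H (suc s) ≈ ν 2 * (π * Z (suc s)) + ν (suc s) * (π * π * Z (suc (suc s)))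
            halves≈ = ≡.subst (λ t → π * H t ≈ ν 2 * (π * Z t) + ν t * (π * π * Z (suc t))) suc-r+suc-r
              (combine₂ π (halves m N≡2m (suc r)) (ν (tri t) * Z (suc (suc t))) π³≈0
                  (identity (π ∷ H (suc r ℕ.+ suc r) ∷ Z (suc r ℕ.+ suc r) ∷ ν (suc r ℕ.+ suc r)
                    ∷ Z (suc (suc r ℕ.+ suc r)) ∷ ν (tri (suc r ℕ.+ suc r))
                    ∷ Y m N≡2m (suc (suc (suc r ℕ.+ suc r))) ∷ [])
                  (λ x y z u v w p → x :* y :- (num 2 :* (x :* z) :+ u :* (x :* x :* v)) := x :* (y :- (num 2 :* z
                    :+ u :* x :* v :+ w :* (x :* x) :* p)) :+ w :* p :* (x :* x :* x :- num 0))))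
              where
              t : ℕ
              t = suc r ℕ.+ suc r
            parity≈ : ν 2 ^ suc (suc s) * (π * H (suc s)) ≈ ν 4 * (π * Z (suc s)) + ν (suc s) * (π * π * Z (suc (suc s)))
            parity≈ = ≡.subst (λ t → ν 2 ^ suc t * (π * H t) ≈ ν 4 * (π * Z t) + ν t * (π * π * Z (suc t))) suc-r+suc-r
              (combine₂ π (parity m N≡2m (suc r)) (ν (tri t) * Σ m (λ k → inv k ^ suc t * inv (k ℕ.+ k))) π³≈0
                  (identity (ν 2 ^ (r ℕ.+ suc r) ∷ π ∷ H (suc r ℕ.+ suc r) ∷ Z (suc r ℕ.+ suc r)
                    ∷ ν (suc r ℕ.+ suc r) ∷ Z (suc (suc r ℕ.+ suc r)) ∷ ν (tri (suc r ℕ.+ suc r))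
                    ∷ Σ m (λ k → inv k ^ suc (suc r ℕ.+ suc r) * inv (k ℕ.+ k)) ∷ [])
                  (λ x y z u v w p q → num 2 :* (num 2 :* x) :* (y :* z) :- (num 4 :* (y :* u) :+ v :* (y :* y :* w))
                    := y :* (num 2 :* (num 2 :* x) :* z :- (num 4 :* u :+ v :* y :* w :+ p :* (y :* y) :* q)) :+ p :* q
                    :* (y :* y :* y :- num 0))))
              where
              t : ℕ
              t = suc r ℕ.+ suc r

  -- The sums of the theorem, with `fr c d` standing for c/d in the ring

  module Fractions (m : ℕ) (p-prime : Prime (suc (m ℕ.+ m))) (1<m : 1 < m)
    (fr : ℤ → ℕ → Carrier) (fr-spec : ∀ c d → suc (m ℕ.+ m) ∤ d → ν d * fr c d ≈ ζ c)
    (B : ℕ → Carrier) (B-zero : B 0 ≈ 1#)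
    (B-suc : ∀ n → suc n < m ℕ.+ m → B (suc n) ≈
      - (fr (+ 1) (suc (suc n)) * (fr (+ (suc (suc n) C 0)) 1 * B 0 + Σ n (λ k → fr (+ (suc (suc n) C k)) 1 * B k))))
    where

    N : ℕ
    N = m ℕ.+ m

    open RationalNumbers.Integral (suc N) p-prime

    fr-cancel : ∀ d → suc N ∤ d → ∀ {x y} → ν d * x ≈ ν d * y → x ≈ y
    fr-cancel d p∤d {x} {y} eq = combine₂ (fr (+ 1) d) eq (y - x) (fr-spec (+ 1) d p∤d)
        (solve (x ∷ y ∷ fr (+ 1) d ∷ ν d ∷ []))

    ∤suc : ∀ {k} → k < N → suc N ∤ suc k
    ∤suc k<N = <⇒∤ (s≤s k<N)

    fr-int : ∀ i → fr i 1 ≈ ζ i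
    fr-int i = trans (sym (*-identityˡ _)) (fr-spec i 1 (<⇒∤ 1<p))

    rec : ℕ → ℕ → Carrier
    rec t j = fr (+ 1) (j ℕ.^ t)

    inv : ℕ → Carrier
    inv = rec 1

    inv-spec : ∀ k → k < N → ν (suc k) * inv (suc k) ≈ 1#
    inv-spec k k<N = trans (*-congʳ (reflexive (≡.cong ν (≡.sym (ℕ.^-identityʳ (suc k))))))
      (fr-spec (+ 1) (suc k ℕ.^ 1) (∤-^ 1 (∤suc k<N)))

    ν-^-inv : ∀ k t → k < N → ν (suc k ℕ.^ t) * inv (suc k) ^ t ≈ 1#
    ν-^-inv k zero    _   = *-identityˡ 1#
    ν-^-inv k (suc t) k<N = combine₃ (inv (suc k) * inv (suc k) ^ t) (ν-* (suc k) (suc k ℕ.^ t))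
      (ν (suc k) * inv (suc k)) (ν-^-inv k t k<N) 1# (inv-spec k k<N)
          (solve (ν (suc k ℕ.^ suc t) ∷ inv (suc k) ∷ inv (suc k) ^ t ∷ ν (suc k) ∷ ν (suc k ℕ.^ t) ∷ []))

    rec-inv : ∀ t k → k < N → rec t (suc k) ≈ inv (suc k) ^ t
    rec-inv t k k<N = fr-cancel (suc k ℕ.^ t) (∤-^ t (∤suc k<N))
      (trans (fr-spec (+ 1) _ (∤-^ t (∤suc k<N))) (sym (ν-^-inv k t k<N)))

    Σ-rec : ∀ t → Σ m (rec t) ≈ psum inv t m
    Σ-rec t = Σ-cong m λ k k<m → rec-inv t k (ℕ.≤-trans k<m (ℕ.m≤m+n m m))

    B-rec : ∀ n → suc n < N → 1# + Σ (suc n) (λ i → binom (suc (suc n)) i * B i) ≈ 0#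
    B-rec n n<N = assemble (Σ-cong n λ k _ → *-congʳ (fr-int (+ (suc (suc n) C suc k))))
      (B-suc n n<N) (fr-spec (+ 1) (suc (suc n)) (∤suc n<N)) (fr-int (+ (suc (suc n) C 0))) (binom-n-0 (suc (suc n)))
      B-zero (binom-suc-n (suc n))
      where
      assemble : ∀ {S S′ b i n₂ c c′ b₀ w} → S′ ≈ S → b ≈ - (i * (c * b₀ + S′)) → n₂ * i ≈ 1# → c ≈ c′ → c′ ≈ 1# → b₀ ≈ 1# →
                 w ≈ n₂ → 1# + (S + w * b) ≈ 0#
      assemble {S} {S′} {b} {i} {n₂} {c} {c′} {b₀} {w} h₁ h₂ h₃ h₄ h₅ h₆ h₇ = begin
        1# + (S + w * b)
          ≈⟨ +-congˡ (+-congˡ (*-cong h₇ (trans h₂ (-‿cong (*-congˡ (+-cong (*-cong (trans h₄ h₅) h₆) h₁)))))) ⟩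
        1# + (S + n₂ * - (i * (1# * 1# + S)))
          ≈⟨ combine₁ (- (1# + S)) h₃ (solve (S ∷ n₂ ∷ i ∷ [])) ⟩
        0# ∎

    ν-^ : ∀ b n → ν (b ℕ.^ n) ≈ ν b ^ n
    ν-^ b zero    = refl
    ν-^ b (suc n) = trans (ν-* b (b ℕ.^ n)) (*-congˡ (ν-^ b n))

    ζ-2^-1 : ∀ n → ζ (+ (2 ℕ.^ n) ℤ.- + 1) ≈ ν 2 ^ n - 1#
    ζ-2^-1 n = trans (ζ-+ (+ (2 ℕ.^ n)) (ℤ.- + 1)) (+-congʳ (ν-^ 2 n))

    2<p : 2 < suc N
    2<p = s≤s (ℕ.≤-trans 1<m (ℕ.m≤m+n m m))

    ∤2 : suc N ∤ 2
    ∤2 = <⇒∤ 2<p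

    central : ℕ → Carrier
    central k = ν ((2 ℕ.* k) C k)

    -- Absorption is applied twice; between the two, the symmetry C(2k+1, k) = C(2k+1, k+1) moves
    -- the lower index up again.
    central-suc : ∀ k → ν (suc k) * central (suc k) ≈ ν 2 * (ν 2 * ν k + 1#) * central k
    central-suc k = begin
      ν (suc k) * central (suc k)              ≈⟨ *-congˡ (reflexive (≡.cong (λ n → ν (n C suc k)) (ℕ.*-suc 2 k))) ⟩
      ν (suc k) * binom (suc (suc n)) (suc k)  ≈⟨ absorption (suc n) k ⟩
      ν (suc (suc n)) * binom (suc n) k        ≈⟨ *-cong n+2 (reflexive (≡.cong ν symmetric)) ⟩
      ν 2 * ν (suc k) * binom (suc n) (suc k)  ≈⟨ combine₂ (ν 2) (absorption n k) (ν 2 * central k) n+1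
          (solve (ν (suc k) ∷ binom (suc n) (suc k) ∷ ν k ∷ central k ∷ ν (suc n) ∷ [])) ⟩
      ν 2 * (ν 2 * ν k + 1#) * central k       ∎
      where
      n : ℕ
      n = 2 ℕ.* k
      n+1 : ν (suc n) ≈ ν 2 * ν k + 1#
      n+1 = trans (ν-suc n) (trans (+-comm _ _) (+-congʳ (ν-* 2 k)))
      n+2 : ν (suc (suc n)) ≈ ν 2 * ν (suc k)
      n+2 = combine₃ 1# (ν-suc (suc n)) 1# n+1 (- ν 2) (ν-suc k)
          (solve (ν (suc (k ℕ.+ 1 ℕ.* k)) ∷ ν (suc k) ∷ ν k ∷ []))
      symmetric : suc n C k ≡ suc n C suc k
      symmetric = ≡.trans (nCk≡nC[n∸k] (ℕ.m≤n⇒m≤1+n (ℕ.m≤m+n k (k ℕ.+ 0)))) (≡.cong (suc n C_) (≡.trans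
        (≡.cong (_∸ k) (≡.trans (≡.cong (λ l → suc (k ℕ.+ l)) (ℕ.+-identityʳ k)) (≡.sym (ℕ.+-suc k k)))) (ℕ.m+n∸m≡n k (suc k))))

    1+M≡N : suc (ℕ.pred N) ≡ N
    1+M≡N = ℕ.suc-pred N {{ℕ.>-nonZero (ℕ.≤-trans (ℕ.<⇒≤ 1<m) (ℕ.m≤m+n m m))}}

    open Inverses N inv inv-spec
    open WithBernoulli B B-rec m ≡.refl (ℕ.pred N) 1+M≡N

    rising-central : ∀ k → k ≤ N → ν (4 ℕ.^ k) * rising half k ≈ central k
    rising-central zero    _   = trans (*-identityˡ 1#) (sym (binom-n-0 0))
    rising-central (suc k) k<N = begin
      ν (4 ℕ.* 4 ℕ.^ k) * (rising half k * (half + ν k) * inv (suc k))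
        ≈⟨ combine₃ (rising half k * (half + ν k) * inv (suc k)) (ν-* 4 (4 ℕ.^ k))
             (ν 4 * (half + ν k) * inv (suc k)) (rising-central k (ℕ.<⇒≤ k<N)) (ν 2 * central k * inv (suc k)) 2*half
                 (identity (ν (4 ℕ.* 4 ℕ.^ k) ∷ rising half k ∷ half ∷ ν k ∷ inv (suc k) ∷ central k
                   ∷ ν (4 ℕ.^ k) ∷ [])
                 (λ x y z u v w p → x :* (y :* (z :+ u) :* v) :- num 2 :* (num 2 :* u :+ num 1) :* w :* v := y :* (z
                   :+ u) :* v :* (x :- num 4 :* p) :+ num 4 :* (z :+ u) :* v :* (p :* y :- w) :+ num 2 :* w :* v :* (num 2
                   :* z :- num 1))) ⟩
      ν 2 * (ν 2 * ν k + 1#) * central k * inv (suc k)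
        ≈⟨ combine₂ (- inv (suc k)) (central-suc k) (central (suc k)) (inv-spec k k<N)
            (solve (ν k ∷ central k ∷ inv (suc k) ∷ central (suc k) ∷ ν (suc k) ∷ [])) ⟩
      central (suc k)
        ∎

    -- At α = 1/2 the factors α + k and k + 1 - α coincide.
    b-rising : ∀ k → b half k ≈ rising half k * rising half k
    b-rising zero    = (solve [])
    b-rising (suc k) = combine₃ ((half + ν k) * (ν (suc k) - half) * sq (suc k)) (b-rising k)
      (rising half k * rising half k * (half + ν k) * sq (suc k)) (ν-suc k)
      (- (rising half k * rising half k * (half + ν k) * sq (suc k))) 2*half
          (identity (b half k ∷ half ∷ ν k ∷ ν (suc k) ∷ inv (suc k) ∷ rising half k ∷ [])
          (λ x y z u v w → x :* ((y :+ z) :* (u :- y)) :* (v :* v) :- w :* (y :+ z) :* v :* (w :* (y :+ z) :* v)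
            := (y :+ z) :* (u :- y) :* (v :* v) :* (x :- w :* w) :+ w :* w :* (y :+ z) :* (v :* v) :* (u :- (num 1
            :+ z)) :+ :- (w :* w :* (y :+ z) :* (v :* v)) :* (num 2 :* y :- num 1)))

    ∤4^ : ∀ k → suc N ∤ 4 ℕ.^ k
    ∤4^ k = ∤-^ k (∤-* {2} {2} ∤2 ∤2)

    ∤16^ : ∀ k → suc N ∤ 16 ℕ.^ k
    ∤16^ k = ∤-^ k (∤-* {4} {4} (∤-* {2} {2} ∤2 ∤2) (∤-* {2} {2} ∤2 ∤2))

    ν-16^ : ∀ k → ν (16 ℕ.^ k) ≈ ν (4 ℕ.^ k) * ν (4 ℕ.^ k)
    ν-16^ zero    = sym (*-identityˡ 1#)
    ν-16^ (suc k) = combine₃ 1# (ν-* 16 (16 ℕ.^ k)) (ν 16) (ν-16^ k)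
      (- (ν 4 * ν (4 ℕ.^ k) + ν (4 ℕ.* 4 ℕ.^ k))) (ν-* 4 (4 ℕ.^ k))
          (solve (ν (16 ℕ.^ suc k) ∷ ν (4 ℕ.^ suc k) ∷ ν (16 ℕ.^ k) ∷ ν (4 ℕ.^ k) ∷ []))

    termI termII : ℕ → Carrier
    termI  k = fr (+ ((2 ℕ.* k) C k)) (k ℕ.* 4 ℕ.^ k)
    termII k = fr (+ (((2 ℕ.* k) C k) ℕ.^ 2)) (k ℕ.* 16 ℕ.^ k)

    termI-rising : ∀ k → k < N → termI (suc k) ≈ rising half (suc k) * inv (suc k)
    termI-rising k k<N = fr-cancel (suc k ℕ.* 4 ℕ.^ suc k) ∤d (trans (fr-spec _ _ ∤d) (sym
      (combine₃ (rising half (suc k) * inv (suc k)) (ν-* (suc k) (4 ℕ.^ suc k))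
        (ν (4 ℕ.^ suc k) * rising half (suc k)) (inv-spec k k<N) 1# (rising-central (suc k) k<N) (rearrange _ _ _ _ _))))
      where
      ∤d : suc N ∤ suc k ℕ.* 4 ℕ.^ suc k
      ∤d = ∤-* (∤suc k<N) (∤4^ (suc k))
      rearrange : ∀ d k w x i {c} → d * (x * i) - c ≈ x * i * (d - k * w) + w * x * (k * i - 1#) + 1# * (w * x - c)
      rearrange d k w x i {c} = identity (d ∷ x ∷ i ∷ c ∷ k ∷ w ∷ [])
          (λ x y z u v w → x :* (y :* z) :- u := y :* z :* (x :- v :* w) :+ w :* y :* (v :* z :- num 1) :+ num 1 :* (w
            :* y :- u))

    termII-b : ∀ k → k < N → termII (suc k) ≈ b half (suc k) * inv (suc k)
    termII-b k k<N = fr-cancel (suc k ℕ.* 16 ℕ.^ suc k) ∤d (trans (fr-spec _ _ ∤d) (sym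
      (assemble (ν-* (suc k) (16 ℕ.^ suc k)) (ν-16^ (suc k)) (b-rising (suc k)) (inv-spec k k<N) (rising-central (suc k) k<N)
        (trans (ν-^ c 2) (*-congˡ (*-identityʳ (ν c)))))))
      where
      c : ℕ
      c = (2 ℕ.* suc k) C suc k
      ∤d : suc N ∤ suc k ℕ.* 16 ℕ.^ suc k
      ∤d = ∤-* (∤suc k<N) (∤16^ (suc k))
      assemble : ∀ {d k w v y x i c c²} → d ≈ k * w → w ≈ v * v → y ≈ x * x → k * i ≈ 1# → v * x ≈ c → c² ≈ c * c →
                 d * (y * i) ≈ c²
      assemble {d} {k} {w} {v} {y} {x} {i} {c} {c²} h₁ h₂ h₃ h₄ h₅ h₆ = begin
        d * (y * i)                  ≈⟨ *-cong (trans h₁ (*-congˡ h₂)) (*-congʳ h₃) ⟩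
        k * (v * v) * (x * x * i)    ≈⟨ combine₂ (v * x * (v * x)) h₄ (v * x + c) h₅
            (identity (k ∷ v ∷ x ∷ i ∷ c ∷ [])
            (λ x y z u v → x :* (y :* y) :* (z :* z :* u) :- v :* v := y :* z :* (y :* z) :* (x :* u :- num 1) :+ (y
              :* z :+ v) :* (y :* z :- v))) ⟩
        c * c                        ≈⟨ h₆ ⟨
        c²                           ∎

    h-cong : ∀ {a a′ : ℕ → Carrier} → (∀ k → k < N → a (suc k) ≈ a′ (suc k)) → ∀ r n → n ≤ N → h a r n ≈ h a′ r n
    h-cong eq zero    n n≤N = refl
    h-cong eq (suc r) n n≤N = Σ-cong n λ k k<n →
      *-cong (h-cong eq r (suc k) (ℕ.≤-trans k<n n≤N)) (eq k (ℕ.≤-trans k<n n≤N))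

    rec2-sq : ∀ k → k < N → rec 2 (suc k) ≈ sq (suc k)
    rec2-sq k k<N = trans (rec-inv 2 k k<N) (*-congˡ (*-identityʳ _))

    LHS-I LHS-II : ℕ → Carrier
    LHS-I  r = Σ N (λ k → termI k * h (rec 1) r k)
    LHS-II r = Σ N (λ k → termII k * h (rec 2) r k)

    LHS-I-Φ : ∀ r → LHS-I r ≈ Φ r half
    LHS-I-Φ r = Σ-cong N λ k k<N → *-congʳ (termI-rising k k<N)

    LHS-II-Ψ : ∀ r → LHS-II r ≈ Ψ r half
    LHS-II-Ψ r = Σ-cong N λ k k<N → *-cong (termII-b k k<N) (h-cong rec2-sq r (suc k) k<N)

    module I (p²≈0 : ν (suc N ℕ.^ 2) ≈ 0#) where
      open Linear
        (combine₂ (- 1#) (ν-^ (suc N) 2) 1# p²≈0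
            (solve (ν (suc N) ∷ ν (suc N ℕ.^ 2) ∷ []))) using (partI-even; partI-odd)

      even : ∀ u → let r = u ℕ.+ u in suc (suc r) < N → LHS-I r ≈ - Σ m (rec (suc r))
      even u r<N = trans (LHS-I-Φ (u ℕ.+ u)) (trans (partI-even u r<N) (-‿cong (sym (Σ-rec (suc (u ℕ.+ u))))))

      odd : ∀ u l → let r = u ℕ.+ suc u in suc (suc r) < N → suc r ℕ.+ suc l ≡ N →
            LHS-I r ≈ fr (+ (2 ℕ.^ (2 ℕ.+ r)) ℤ.- + 1) (2 ℕ.* (2 ℕ.+ r)) * fr (+ suc N) 1 * B (suc l)
      odd u l r<N eq = trans (LHS-I-Φ r) (fr-cancel (2 ℕ.* (2 ℕ.+ r)) ∤d
        (assemble (ν-* 2 (2 ℕ.+ r)) (partI-odd u l r<N eq)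
          (trans (fr-spec _ _ ∤d) (ζ-2^-1 (2 ℕ.+ r))) (fr-int (+ suc N))))
        where
        r : ℕ
        r = u ℕ.+ suc u
        ∤d : suc N ∤ 2 ℕ.* (2 ℕ.+ r)
        ∤d = ∤-* {2} ∤2 (∤suc (ℕ.<⇒≤ r<N))
        assemble : ∀ {d d′ F A p x π b} → d ≈ d′ → d′ * F ≈ A * (π * b) → d * x ≈ A → p ≈ π →
                   d * F ≈ d * (x * p * b)
        assemble {d} {d′} {F} {A} {p} {x} {π} {b} h₁ h₂ h₃ h₄ =
          combine₄ F h₁ 1# h₂ (- (p * b)) h₃ (- (A * b)) h₄ (identity (d ∷ F ∷ x ∷ p ∷ b ∷ d′ ∷ A ∷ π ∷ [])
              (λ x y z u v w p q → x :* y :- x :* (z :* u :* v) := y :* (x :- w) :+ num 1 :* (w :* y :- p :* (q :* v))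
                :+ :- (u :* v) :* (x :* z :- p) :+ :- (p :* v) :* (u :- q)))

    module II (p³≈0 : ν (suc N ℕ.^ 3) ≈ 0#) where
      open Quadratic
        (combine₂ (- 1#) (ν-^ (suc N) 3) 1# p³≈0 (solve (ν (suc N) ∷ ν (suc N ℕ.^ 3) ∷ []))) using (partII)

      congruence : ∀ r l → let s = suc (r ℕ.+ r) in suc (suc s) < N → suc s ℕ.+ suc l ≡ N →
        LHS-II r ≈ - (fr (+ 2) 1 * Σ m (rec s))
          - fr (+ r ℤ.* (+ (2 ℕ.^ suc (suc s)) ℤ.- + 1)) 2 * fr (+ (suc N ℕ.^ 2)) 1 * B (suc l)
      congruence r l r<N eq = trans (LHS-II-Ψ r) (fr-cancel 2 ∤2
        (assemble (partII r r<N l eq) (fr-int (+ 2)) (Σ-rec s) (trans (fr-spec _ 2 ∤2) (trans (ζ-* (+ r) _) (*-congˡ (ζ-2^-1 (suc (suc s))))))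
          (trans (fr-int (+ (suc N ℕ.^ 2))) (trans (ν-^ (suc N) 2) (*-congˡ (*-identityʳ _))))))
        where
        s : ℕ
        s = suc (r ℕ.+ r)
        assemble : ∀ {F Y RA p b two Y′ x p²} → ν 2 * (F + ν 2 * Y) ≈ - (RA * (p * p * b)) → two ≈ ν 2 → Y′ ≈ Y → ν 2 * x ≈ RA →
                   p² ≈ p * p → ν 2 * F ≈ ν 2 * (- (two * Y′) - x * p² * b)
        assemble {F} {Y} {RA} {p} {b} {two} {Y′} {x} {p²} h₁ h₂ h₃ h₄ h₅ = begin
          ν 2 * F
            ≈⟨ combine₂ 1# h₁ (p * p * b) h₄ (identity (F ∷ Y ∷ x ∷ p ∷ b ∷ RA ∷ [])
                (λ x y z u v w → num 2 :* x :- num 2 :* (:- (num 2 :* y) :- z :* (u :* u) :* v) := num 1 :* (num 2 :* (x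
                  :+ num 2 :* y) :- :- (w :* (u :* u :* v))) :+ u :* u :* v :* (num 2 :* z :- w))) ⟩
          ν 2 * (- (ν 2 * Y) - x * (p * p) * b)
            ≈⟨ *-congˡ (+-cong (-‿cong (*-cong h₂ h₃)) (-‿cong (*-congʳ (*-congˡ h₅)))) ⟨
          ν 2 * (- (two * Y′) - x * p² * b)
            ∎

  -- The quotient of a subring by a principal ideal

  module Quotient (P : Carrier → Set) (P-0 : P 0#) (P-1 : P 1#)
    (P-+ : ∀ {x y} → P x → P y → P (x + y)) (P-* : ∀ {x y} → P x → P y → P (x * y))
    (P-neg : ∀ {x} → P x → P (- x)) (c : Carrier) where

    record Element : Set where
      constructor element
      field
        val    : Carrier
        within : P val
    open Element public

    infixl 6 _⊕_
    infixl 7 _⊗_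
    infix  8 ⊖_

    _⊕_ _⊗_ : Element → Element → Element
    element x Px ⊕ element y Py = element (x + y) (P-+ Px Py)
    element x Px ⊗ element y Py = element (x * y) (P-* Px Py)

    ⊖_ : Element → Element
    ⊖ element x Px = element (- x) (P-neg Px)

    0ₑ 1ₑ : Element
    0ₑ = element 0# P-0
    1ₑ = element 1# P-1

    infix 4 _≋_
    -- The cofactor has to lie in the subring: in ℚ itself every difference is a multiple of pᵃ.
    record _≋_ (x y : Element) : Set where
      constructor via
      field
        quotient : Element
        equation : val x - val y ≈ c * val quotient
    open _≋_ public

    ≈⇒≋ : ∀ {x y} → val x ≈ val y → x ≋ y
    ≈⇒≋ {x} {y} eq = via 0ₑ (combine₁ 1# eq (solve (val x ∷ val y ∷ c ∷ [])))

    ≋-sym : ∀ {x y} → x ≋ y → y ≋ x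
    ≋-sym {x} {y} (via z eq) = via (⊖ z) (combine₁ (- 1#) eq (solve (val x ∷ val y ∷ c ∷ val z ∷ [])))

    ≋-trans : ∀ {x y z} → x ≋ y → y ≋ z → x ≋ z
    ≋-trans {x} {y} {z} (via u eq) (via v eq′) = via (u ⊕ v)
      (combine₂ 1# eq 1# eq′ (solve (val x ∷ val y ∷ val z ∷ c ∷ val u ∷ val v ∷ [])))

    ⊖-cong : ∀ {x y} → x ≋ y → (⊖ x) ≋ (⊖ y)
    ⊖-cong {x} {y} (via z eq) = via (⊖ z) (combine₁ (- 1#) eq (solve (val x ∷ val y ∷ c ∷ val z ∷ [])))

    ⊕-cong : ∀ {x y u v} → x ≋ y → u ≋ v → (x ⊕ u) ≋ (y ⊕ v)
    ⊕-cong {x} {y} {u} {v} (via z eq) (via z′ eq′) = via (z ⊕ z′)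
      (combine₂ 1# eq 1# eq′ (solve (val x ∷ val y ∷ val u ∷ val v ∷ c ∷ val z ∷ val z′ ∷ [])))

    ⊗-cong : ∀ {x y u v} → x ≋ y → u ≋ v → (x ⊗ u) ≋ (y ⊗ v)
    ⊗-cong {x} {y} {u} {v} (via z eq) (via z′ eq′) = via (u ⊗ z ⊕ y ⊗ z′)
      (combine₂ (val u) eq (val y) eq′ (solve (val x ∷ val u ∷ val y ∷ val v ∷ c ∷ val z ∷ val z′ ∷ [])))

    quotientRing : CommutativeRing 0ℓ 0ℓ
    quotientRing = record
      { Carrier = Element ; _≈_ = _≋_ ; _+_ = _⊕_ ; _*_ = _⊗_ ; -_ = ⊖_
      ; 0# = 0ₑ ; 1# = 1ₑ
      ; isCommutativeRing = record
        { isRing = record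
          { +-isAbelianGroup = record
            { isGroup = record
              { isMonoid = record
                { isSemigroup = record
                  { isMagma = record
                    { isEquivalence = record
                      { refl  = λ {x} → ≈⇒≋ {x} {x} refl
                      ; sym   = ≋-sym
                      ; trans = ≋-trans
                      }
                    ; ∙-cong = ⊕-cong
                    }
                  ; assoc = λ x y z → ≈⇒≋ {x ⊕ y ⊕ z} {x ⊕ (y ⊕ z)} (+-assoc _ _ _)
                  }
                ; identity = (λ x → ≈⇒≋ {0ₑ ⊕ x} {x} (+-identityˡ _)) , (λ x → ≈⇒≋ {x ⊕ 0ₑ} {x} (+-identityʳ _))
                }
              ; inverse = (λ x → ≈⇒≋ {⊖ x ⊕ x} {0ₑ} (-‿inverseˡ _)) , (λ x → ≈⇒≋ {x ⊕ ⊖ x} {0ₑ} (-‿inverseʳ _))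
              ; ⁻¹-cong = ⊖-cong
              }
            ; comm = λ x y → ≈⇒≋ {x ⊕ y} {y ⊕ x} (+-comm _ _)
            }
          ; *-cong = ⊗-cong
          ; *-assoc = λ x y z → ≈⇒≋ {x ⊗ y ⊗ z} {x ⊗ (y ⊗ z)} (*-assoc _ _ _)
          ; *-identity = (λ x → ≈⇒≋ {1ₑ ⊗ x} {x} (*-identityˡ _)) , (λ x → ≈⇒≋ {x ⊗ 1ₑ} {x} (*-identityʳ _))
          ; distrib = (λ x y z → ≈⇒≋ {x ⊗ (y ⊕ z)} {x ⊗ y ⊕ x ⊗ z} (distribˡ _ _ _)) , (λ x y z → ≈⇒≋ {(y ⊕ z) ⊗ x} {y ⊗ x ⊕ z ⊗ x} (distribʳ _ _ _))
          }
        ; *-comm = λ x y → ≈⇒≋ {x ⊗ y} {y ⊗ x} (*-comm _ _)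
        }
      }

import Data.Rational.Properties as ℚ
open import Data.Rational.Properties using (+-0-monoid)
open import Algebra.Properties.Monoid.Sum +-0-monoid using (sum-cong-≗; sum-init-last)
open import Data.Empty using (⊥-elim)
open import Data.Fin.Base using (toℕ)
open import Data.Fin.Properties using (toℕ-inject₁; toℕ-fromℕ)
open import Data.Integer.Base as ℤ using (+_)
open import Data.List.Base as List using (foldl; replicate)
open import Data.Nat.Base using (ℕ; suc; NonZero; _+_; _*_; _∸_; _^_; _<_)
open import Data.Nat.Combinatorics using (_C_)
open import Data.Nat.Coprimality using (coprime?)
open import Data.Nat.Divisibility using (_∣_; _∤_; divides; _∣0)
open import Data.Nat.DivMod as ℕ using ()
open import Data.Nat.Primality using (Prime)
open import Data.Product.Base using (_×_)
open import Data.Rational.Base as ℚ using (ℚ; _/_; ↧ₙ_; 1ℚ)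
open import Relation.Binary.PropositionalEquality.Core using (refl; sym; trans; cong; cong₂; subst)
open import Relation.Nullary.Negation.Core using (contradiction)
open import Defs
open RationalNumbers using (/1-homo-+; denominator-*-/)

-- Sums over ℚ, peeled from their last term

sumFrom1-suc : ∀ n (f : (k : ℕ) .{{_ : NonZero k}} → ℚ) → sumFrom1 (suc n) f ≡ sumFrom1 n f ℚ.+ f (suc n)
sumFrom1-suc n f = trans (sum-init-last {n} (λ i → f (suc (toℕ i))))
  (cong₂ ℚ._+_ (sum-cong-≗ {n} (λ i → cong (λ k → f (suc k)) (toℕ-inject₁ i))) (cong (λ k → f (suc k)) (toℕ-fromℕ n)))

-- A left fold consumes its first letter innermost, whereas the recursion for S removes the
-- outermost index; as all letters are equal, a step may be moved from one end to the other.
foldl-replicate : ∀ {A B : Set} (step : A → B → A) f r t →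
                  foldl step f (t List.∷ replicate r t) ≡ step (foldl step f (replicate r t)) t
foldl-replicate step f zero    t = refl
foldl-replicate step f (suc r) t = foldl-replicate step (step f t) r t

S-suc : ∀ r t n → S (replicate (suc r) t) n ≡ ∑[1≤ j ≤ n ] (S (replicate r t) j ℚ.* recipPow j t)
S-suc r t n = cong (λ f → f n)
  (foldl-replicate (λ inner t n → ∑[1≤ j ≤ n ] (inner j ℚ.* recipPow j t)) (λ _ → 1ℚ) r t)

-- The p-integral rationals modulo pᵃ

module Representation (p : ℕ) (p-prime : Prime p) (a : ℕ) where
  open RationalNumbers.Integral p p-prime
  open Over.Quotient ℚ.+-*-commutativeRing (_IntegralAt p)
    (integral-ℤ (+ 0)) (integral-ℤ (+ 1)) (λ {x} {y} → integral-+ {x} {y}) (λ {x} {y} → integral-* {x} {y})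
    (λ {x} → integral-neg {x}) (+ (p ^ a) / 1) public
    using (Element; element; val; within; 0ₑ; 1ₑ; _⊕_; _⊗_; ⊖_; ≈⇒≋; via; quotientRing)
  open Over quotientRing using (Σ)
  open Cast quotientRing using (ν; ν-suc; ζ)
  private module R = CommutativeRing quotientRing
  open R using (_≈_)

  -- Total, with default value 0, so that Bernoulli numbers have images before their integrality is
  -- known.
  embed : ℚ → Element
  embed x with coprime? (↧ₙ x) p
  ... | yes x-integral = element x x-integral
  ... | no  _          = 0ₑ

  infix 4 _⊨_
  -- Equality in ℚ and not congruence: the sums of the theorem are reproduced exactly, so their
  -- integrality can be read off from their representatives.
  _⊨_ : Element → ℚ → Set
  u ⊨ x = val u ≡ x

  embed-⊨ : ∀ x → x IntegralAt p → embed x ⊨ x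
  embed-⊨ x x-integral with coprime? (↧ₙ x) p
  ... | yes _ = refl
  ... | no ¬c = contradiction (λ {i} → x-integral {i}) ¬c

  conclude : ∀ {u v x y} → u ⊨ x → v ⊨ y → u ≈ v → x ≋ y [mod p ^ a ]
  conclude {u} {v} refl refl (via z eq) = within u , within v , val z , within z , eq

  fr : ℤ → ℕ → Element
  fr c zero    = 0ₑ
  fr c (suc d) = embed (c / suc d)

  fr-⊨ : ∀ c d .{{_ : NonZero d}} → p ∤ d → fr c d ⊨ c / d
  fr-⊨ c (suc d) p∤d = embed-⊨ (c / suc d) (integral-/ c (suc d) p∤d)

  int : ℤ → Element
  int i = element (i / 1) (integral-ℤ i)

  ν≈int : ∀ n → ν n ≈ int (+ n)
  ν≈int zero    = ≈⇒≋ {0ₑ} {int (+ 0)} refl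
  ν≈int (suc n) = R.trans (ν-suc n) (R.trans (R.+-congˡ {1ₑ} (ν≈int n))
    (≈⇒≋ {1ₑ ⊕ int (+ n)} {int (+ suc n)} (/1-homo-+ (+ 1) (+ n))))

  ζ≈int : ∀ i → ζ i ≈ int i
  ζ≈int (+ n)    = ν≈int n
  ζ≈int -[1+ n ] = R.trans (R.-‿cong (ν≈int (suc n))) (≈⇒≋ {⊖ int (+ suc n)} {int -[1+ n ]} refl)

  fr-spec : ∀ c d → p ∤ d → R._≈_ (R._*_ (ν d) (fr c d)) (ζ c)
  fr-spec c zero    p∤d = contradiction (p ∣0) p∤d
  fr-spec c (suc d) p∤d = R.trans (R.*-congʳ {fr c (suc d)} (ν≈int (suc d))) (R.trans
    (≈⇒≋ {int (+ suc d) ⊗ fr c (suc d)} {int c}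
      (trans (cong ((+ suc d / 1) ℚ.*_) (fr-⊨ c (suc d) p∤d)) (denominator-*-/ c (suc d))))
    (R.sym (ζ≈int c)))

  ν[p^a]≈0 : ν (p ^ a) ≈ R.0#
  ν[p^a]≈0 = R.trans (ν≈int (p ^ a)) (via 1ₑ (trans (ℚ.+-identityʳ (+ (p ^ a) / 1)) (sym (ℚ.*-identityʳ (+ (p ^ a) / 1)))))

  Σ-⊨ : ∀ n F (G : (k : ℕ) .{{_ : NonZero k}} → ℚ) → (∀ k → k < n → F (suc k) ⊨ G (suc k)) → Σ n F ⊨ sumFrom1 n G
  Σ-⊨ zero    F G rep = refl
  Σ-⊨ (suc n) F G rep = trans (cong₂ ℚ._+_ (Σ-⊨ n F G (λ k k<n → rep k (ℕ.m<n⇒m<1+n k<n))) (rep n (ℕ.n<1+n n)))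
    (sym (sumFrom1-suc n G))

-- Bernoulli numbers below p - 1, and the congruences over ℚ

module Congruences (m : ℕ) (p-prime : Prime (suc (m ℕ.+ m))) (1<m : 1 < m) (a : ℕ) where
  private
    N p : ℕ
    N = m ℕ.+ m
    p = suc N
  open RationalNumbers.Integral p p-prime
  open Representation p p-prime a
  open Over quotientRing using (Σ; h)
  open Cast quotientRing using (ν)
  private module R = CommutativeRing quotientRing
  open R using (_≈_)

  ∤suc : ∀ {k} → k < N → p ∤ suc k
  ∤suc k<N = <⇒∤ (s≤s k<N)

  B : ℕ → Element
  B i = embed (bernoulli i)

  next : ℕ → Element
  next n = ⊖ (fr (+ 1) (suc (suc n)) ⊗
    (fr (+ (suc (suc n) C 0)) 1 ⊗ B 0 ⊕ Σ n (λ k → fr (+ (suc (suc n) C k)) 1 ⊗ B k)))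

  next-⊨ : ∀ n → suc n < N → (∀ k → k ≤ n → B k ⊨ bernoulli k) → next n ⊨ bernoulli (suc n)
  next-⊨ n n<N ih = trans
    (cong ℚ.-_ (cong₂ ℚ._*_ (fr-⊨ (+ 1) (suc (suc n)) (∤suc n<N)) (cong₂ ℚ._+_
      (cong₂ ℚ._*_ (fr-⊨ (+ (suc (suc n) C 0)) 1 (<⇒∤ 1<p)) (ih 0 z≤n))
      (Σ-⊨ n (λ k → fr (+ (suc (suc n) C k)) 1 ⊗ B k) (λ k → (+ (suc (suc n) C k) / 1) ℚ.* bernoulli k)
        (λ k k<n → cong₂ ℚ._*_ (fr-⊨ (+ (suc (suc n) C suc k)) 1 (<⇒∤ 1<p)) (ih (suc k) k<n))))))
    (sym (bernoulli-suc n))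

  -- Integrality comes out of the recursion itself: `next k` lies in the subring because its
  -- denominator k + 2 ≤ N is prime to p, and by induction its value is the Bernoulli number, which
  -- `embed` therefore does not send to the default.
  B-⊨-below : ∀ n → n < N → ∀ k → k ≤ n → B k ⊨ bernoulli k
  B-⊨-below n       n<N zero    k≤n = embed-⊨ 1ℚ (integral-ℤ (+ 1))
  B-⊨-below (suc n) n<N (suc k) (s≤s k≤n) = embed-⊨ (bernoulli (suc k))
    (subst (_IntegralAt p) represented (within (next k)))
    where
    represented : next k ⊨ bernoulli (suc k)
    represented = next-⊨ k (ℕ.≤-<-trans (s≤s k≤n) n<N)
      (λ i i≤k → B-⊨-below n (ℕ.<⇒≤ n<N) i (ℕ.≤-trans i≤k k≤n))

  B-⊨ : ∀ n → n < N → B n ⊨ bernoulli n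
  B-⊨ n n<N = B-⊨-below n n<N n ℕ.≤-refl

  B-zero : B 0 ≈ R.1#
  B-zero = ≈⇒≋ {B 0} {1ₑ} (embed-⊨ 1ℚ (integral-ℤ (+ 1)))

  B-suc : ∀ n → suc n < N → B (suc n) ≈ next n
  B-suc n n<N = ≈⇒≋ {B (suc n)} {next n} (trans (B-⊨ (suc n) n<N)
    (sym (next-⊨ n n<N (λ k k≤n → B-⊨-below n (ℕ.<⇒≤ n<N) k k≤n))))

  open Over quotientRing using (module Fractions)
  open Fractions m p-prime 1<m fr fr-spec B B-zero B-suc public
    using (rec; termI; termII; LHS-I; LHS-II; ∤2; ∤4^; ∤16^; module I; module II)

  rec-⊨ : ∀ t k → k < N → rec t (suc k) ⊨ recipPow (suc k) t
  rec-⊨ t k k<N = fr-⊨ (+ 1) (suc k ^ t) {{ℕ.m^n≢0 (suc k) t}} (∤-^ t (∤suc k<N))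

  h-⊨ : ∀ t r n → n ≤ N → h (rec t) r n ⊨ S (replicate r t) n
  h-⊨ t zero    n n≤N = refl
  h-⊨ t (suc r) n n≤N = trans
    (Σ-⊨ n (λ j → h (rec t) r j ⊗ rec t j) (λ j → S (replicate r t) j ℚ.* recipPow j t)
      (λ k k<n → cong₂ ℚ._*_ (h-⊨ t r (suc k) (ℕ.≤-trans k<n n≤N)) (rec-⊨ t k (ℕ.≤-trans k<n n≤N))))
    (sym (S-suc r t n))

  H-⊨ : ∀ t → Σ m (rec t) ⊨ H t ((p ∸ 1) ℕ./ 2)
  H-⊨ t = trans (Σ-⊨ m (rec t) (λ j → recipPow j t) (λ k k<m → rec-⊨ t k (ℕ.≤-trans k<m (ℕ.m≤m+n m m))))
    (cong (H t) (sym (trans (cong (ℕ._/ 2) (trans (cong (m ℕ.+_) (sym (ℕ.+-identityʳ m))) (ℕ.*-comm 2 m))) (ℕ.m*n/n≡m m 2))))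

  LHS-I-⊨ : ∀ r → LHS-I r ⊨ (∑[1≤ k ≤ p ∸ 1 ] ((+ ((2 ℕ.* k) C k) /[ k * 4 ^ k ]) ℚ.* S (replicate r 1) k))
  LHS-I-⊨ r = Σ-⊨ N (λ k → termI k ⊗ h (rec 1) r k) (λ k → (+ ((2 ℕ.* k) C k) /[ k * 4 ^ k ]) ℚ.* S (replicate r 1) k)
    λ k k<N → cong₂ ℚ._*_ (fr-⊨ _ (suc k ℕ.* 4 ^ suc k) {{nonZero k}} (∤-* (∤suc k<N) (∤4^ (suc k)))) (h-⊨ 1 r (suc k) k<N)
    where
    nonZero : ∀ k → NonZero (suc k ℕ.* 4 ^ suc k)
    nonZero k = ℕ.m*n≢0 (suc k) (4 ^ suc k) {{_}} {{ℕ.m^n≢0 4 (suc k)}}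

  LHS-II-⊨ : ∀ r → LHS-II r ⊨ (∑[1≤ k ≤ p ∸ 1 ] ((+ (((2 ℕ.* k) C k) ^ 2) /[ k * 16 ^ k ]) ℚ.* S (replicate r 2) k))
  LHS-II-⊨ r = Σ-⊨ N (λ k → termII k ⊗ h (rec 2) r k) (λ k → (+ (((2 ℕ.* k) C k) ^ 2) /[ k * 16 ^ k ]) ℚ.* S (replicate r 2) k)
    λ k k<N → cong₂ ℚ._*_ (fr-⊨ _ (suc k ℕ.* 16 ^ suc k) {{nonZero k}} (∤-* (∤suc k<N) (∤16^ (suc k)))) (h-⊨ 2 r (suc k) k<N)
    where
    nonZero : ∀ k → NonZero (suc k ℕ.* 16 ^ suc k)
    nonZero k = ℕ.m*n≢0 (suc k) (16 ^ suc k) {{_}} {{ℕ.m^n≢0 16 (suc k)}}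

  -- The exponent is kept as a variable constrained by an equation, so that one module serves the
  -- moduli p² and p³.
  partI-even : a ≡ 2 → ∀ u → (u + u) + 3 < p → let r = u + u in
    (∑[1≤ k ≤ p ∸ 1 ] ((+ ((2 * k) C k) /[ k * 4 ^ k ]) ℚ.* S (replicate r 1) k))
      ≋ ℚ.- H (r + 1) ((p ∸ 1) ℕ./ 2) [mod p ^ a ]
  partI-even a≡2 u r<p = conclude {LHS-I r} {⊖ Σ m (rec (suc r))} (LHS-I-⊨ r)
    (cong ℚ.-_ (trans (H-⊨ (suc r)) (cong (λ t → H t ((p ∸ 1) ℕ./ 2)) (ℕ.+-comm 1 r))))
    (I.even (subst (λ e → ν (p ^ e) ≈ R.0#) a≡2 ν[p^a]≈0) u r<N)
    where
    r : ℕ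
    r = u + u
    r<N : suc (suc r) < N
    r<N = ℕ.≤-pred (subst (_< p) (ℕ.+-comm r 3) r<p)

  partI-odd : a ≡ 2 → ∀ u → (u + suc u) + 3 < p → let r = u + suc u in
    (∑[1≤ k ≤ p ∸ 1 ] ((+ ((2 * k) C k) /[ k * 4 ^ k ]) ℚ.* S (replicate r 1) k))
      ≋ ((+ (2 ^ (r + 2)) ℤ.- + 1) / (2 * (2 + r))) ℚ.* (+ p / 1) ℚ.* bernoulli (p ∸ (r + 2)) [mod p ^ a ]
  partI-odd a≡2 u r<p = conclude {LHS-I r} {fr (+ (2 ^ (2 + r)) ℤ.- + 1) (2 * (2 + r)) ⊗ fr (+ p) 1 ⊗ B (suc l)} (LHS-I-⊨ r)
    (trans (cong₂ ℚ._*_ (cong₂ ℚ._*_ (fr-⊨ (+ (2 ^ (2 + r)) ℤ.- + 1) (2 * (2 + r)) (∤-* {2} ∤2 (∤suc (ℕ.<⇒≤ r<N)))) (fr-⊨ (+ p) 1 (<⇒∤ 1<p)))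
        (trans (B-⊨ (suc l) l<N) (cong bernoulli suc-l)))
      (cong (λ e → ((+ (2 ^ e) ℤ.- + 1) / (2 * (2 + r))) ℚ.* (+ p / 1) ℚ.* bernoulli (p ∸ e)) (ℕ.+-comm 2 r)))
    (I.odd (subst (λ e → ν (p ^ e) ≈ R.0#) a≡2 ν[p^a]≈0) u l r<N eq)
    where
    r l : ℕ
    r = u + suc u
    l = N ∸ suc (suc r)
    r<N : suc (suc r) < N
    r<N = ℕ.≤-pred (subst (_< p) (ℕ.+-comm r 3) r<p)
    suc-l : suc l ≡ N ∸ suc r
    suc-l = sym (ℕ.+-∸-assoc 1 (ℕ.<⇒≤ r<N))
    eq : suc r + suc l ≡ N
    eq = trans (cong (λ k → suc r + k) suc-l) (ℕ.m+[n∸m]≡n (ℕ.<⇒≤ (ℕ.<⇒≤ r<N)))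
    l<N : suc l < N
    l<N = subst (suc l <_) eq (ℕ.m<n+m (suc l) (s≤s z≤n))

  partII : a ≡ 3 → ∀ r → 2 * r + 3 < p →
    (∑[1≤ k ≤ p ∸ 1 ] ((+ (((2 * k) C k) ^ 2) /[ k * 16 ^ k ]) ℚ.* S (replicate r 2) k))
      ≋ (ℚ.- ((+ 2 / 1) ℚ.* H (2 * r + 1) ((p ∸ 1) ℕ./ 2)))
        ℚ.- ((+ r ℤ.* (+ (2 ^ (2 * r + 3)) ℤ.- + 1)) / 2) ℚ.* (+ (p ^ 2) / 1) ℚ.* bernoulli (p ∸ (2 * r + 3)) [mod p ^ a ]
  partII a≡3 r r<p = conclude {LHS-II r}
    {⊖ (fr (+ 2) 1 ⊗ Σ m (rec s)) ⊕ ⊖ (fr (+ r ℤ.* (+ (2 ^ suc (suc s)) ℤ.- + 1)) 2 ⊗ fr (+ (p ^ 2)) 1 ⊗ B (suc l))} (LHS-II-⊨ r)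
    (cong₂ ℚ._-_ (cong ℚ.-_ (cong₂ ℚ._*_ (fr-⊨ (+ 2) 1 (<⇒∤ 1<p)) (trans (H-⊨ s) (cong (λ t → H t ((p ∸ 1) ℕ./ 2)) s≡))))
      (trans (cong₂ ℚ._*_ (cong₂ ℚ._*_ (fr-⊨ (+ r ℤ.* (+ (2 ^ suc (suc s)) ℤ.- + 1)) 2 ∤2) (fr-⊨ (+ (p ^ 2)) 1 (<⇒∤ 1<p)))
          (trans (B-⊨ (suc l) l<N) (cong bernoulli suc-l)))
        (cong (λ e → ((+ r ℤ.* (+ (2 ^ e) ℤ.- + 1)) / 2) ℚ.* (+ (p ^ 2) / 1) ℚ.* bernoulli (p ∸ e)) 2+s≡)))
    (II.congruence (subst (λ e → ν (p ^ e) ≈ R.0#) a≡3 ν[p^a]≈0) r l s<N eq)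
    where
    s l : ℕ
    s = suc (r + r)
    l = N ∸ suc (suc s)
    s≡ : s ≡ 2 * r + 1
    s≡ = trans (ℕ.+-comm 1 (r + r)) (cong (λ t → r + t + 1) (sym (ℕ.+-identityʳ r)))
    2+s≡ : suc (suc s) ≡ 2 * r + 3
    2+s≡ = trans (ℕ.+-comm 3 (r + r)) (cong (λ t → r + t + 3) (sym (ℕ.+-identityʳ r)))
    -- The assumption on p gives only 2r + 3 ≤ N; the strict inequality is what makes π divide
    -- H⁽²ʳ⁺³⁾.
    s<N : suc (suc s) < N
    s<N = even-bound (ℕ.≤-pred (subst (_< p) (sym 2+s≡) r<p))
      where
      -- 2 r + 3 is odd and N is even.
      even-bound : suc (suc (suc (r + r))) ≤ m + m → suc (suc (suc (r + r))) < m + m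
      even-bound h = subst (_≤ m + m) (cong (λ t → suc (suc t)) (trans (ℕ.+-suc r (suc r)) (cong suc (ℕ.+-suc r r))))
        (ℕ.+-mono-≤ r+2≤m r+2≤m)
        where
        r+2≤m : suc (suc r) ≤ m
        r+2≤m = ℕ.≰⇒> λ m≤1+r → ℕ.<⇒≱ h (ℕ.≤-trans (ℕ.+-mono-≤ m≤1+r m≤1+r) (ℕ.≤-reflexive (cong suc (ℕ.+-suc r r))))
    suc-l : suc l ≡ N ∸ suc s
    suc-l = sym (ℕ.+-∸-assoc 1 (ℕ.<⇒≤ s<N))
    eq : suc s + suc l ≡ N
    eq = trans (cong (λ k → suc s + k) suc-l) (ℕ.m+[n∸m]≡n (ℕ.<⇒≤ (ℕ.<⇒≤ s<N)))
    l<N : suc l < N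
    l<N = subst (suc l <_) eq (ℕ.m<n+m (suc l) {suc s} (s≤s z≤n))

-- Parity of p and of r, and the theorem

double-or-suc : ∀ n → ∃[ k ] (n ≡ k + k ⊎ n ≡ suc (k + k))
double-or-suc zero = 0 , inj₁ refl
double-or-suc (suc n) with double-or-suc n
... | k , inj₁ n≡ = k , inj₂ (cong suc n≡)
... | k , inj₂ n≡ = suc k , inj₁ (trans (cong suc n≡) (cong suc (sym (ℕ.+-suc k k))))

n+n≡n*2 : ∀ n → n + n ≡ n * 2
n+n≡n*2 n = trans (cong (λ k → n + k) (sym (ℕ.+-identityʳ n))) (ℕ.*-comm 2 n)

odd-prime : ∀ {p} → Prime p → 3 < p → ∃[ m ] (1 < m × p ≡ suc (m + m))
odd-prime {p} p-prime 3<p = [ even-case , odd-case ]′ (proj₂ (double-or-suc p))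
  where
  k : ℕ
  k = proj₁ (double-or-suc p)
  1<k : ∀ k → 3 < suc (k + k) → 1 < k
  1<k zero          (s≤s ())
  1<k (suc zero)    (s≤s (s≤s (s≤s ())))
  1<k (suc (suc k)) _ = s≤s (s≤s z≤n)
  odd-case : p ≡ suc (k + k) → ∃[ m ] (1 < m × p ≡ suc (m + m))
  odd-case p≡ = k , 1<k k (subst (3 <_) p≡ 3<p) , p≡
  even-case : p ≡ k + k → ∃[ m ] (1 < m × p ≡ suc (m + m))
  even-case p≡ = [ (λ ()) , (λ 2≡p → ⊥-elim (ℕ.<⇒≢ (ℕ.<-trans (ℕ.n<1+n 2) 3<p) 2≡p)) ]′
    (prime⇒irreducible p-prime (divides k (trans p≡ (n+n≡n*2 k))))

mainTheorem2 : (p : ℕ) → Prime p → (r : ℕ) →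
    (r + 3 < p →
    (2 ∣ r →
    (∑[1≤ k ≤ p ∸ 1 ] ((+ ((2 * k) C k) /[ k * 4 ^ k ]) ℚ.* S (replicate r 1) k))
    ≋ ℚ.- H (r + 1) ((p ∸ 1) ℕ./ 2) [mod p ^ 2 ]) ×
    (2 ∤ r →
    (∑[1≤ k ≤ p ∸ 1 ] ((+ ((2 * k) C k) /[ k * 4 ^ k ]) ℚ.* S (replicate r 1) k))
    ≋ ((+ (2 ^ (r + 2)) ℤ.- + 1) / (2 * (2 + r))) ℚ.* (+ p / 1) ℚ.* bernoulli (p ∸ (r + 2)) [mod p ^ 2 ])) ×
    (2 * r + 3 < p →
    (∑[1≤ k ≤ p ∸ 1 ] ((+ (((2 * k) C k) ^ 2) /[ k * 16 ^ k ]) ℚ.* S (replicate r 2) k))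
    ≋ (ℚ.- ((+ 2 / 1) ℚ.* H (2 * r + 1) ((p ∸ 1) ℕ./ 2)))
    ℚ.- ((+ r ℤ.* (+ (2 ^ (2 * r + 3)) ℤ.- + 1)) / 2) ℚ.* (+ (p ^ 2) / 1) ℚ.* bernoulli (p ∸ (2 * r + 3)) [mod p ^ 3 ])
mainTheorem2 p p-prime r = (λ r<p → even r<p , odd r<p) , squared
  where
  even : r + 3 < p → 2 ∣ r → _
  even r<p (divides u r≡) with odd-prime p-prime (ℕ.≤-<-trans (ℕ.m≤n+m 3 r) r<p) | trans r≡ (sym (n+n≡n*2 u))
  ... | m , 1<m , refl | refl = Congruences.partI-even m p-prime 1<m 2 refl u r<p
  odd : r + 3 < p → 2 ∤ r → _
  odd r<p 2∤r with odd-prime p-prime (ℕ.≤-<-trans (ℕ.m≤n+m 3 r) r<p) | double-or-suc r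
  ... | m , 1<m , refl | u , inj₁ r≡ = ⊥-elim (2∤r (divides u (trans r≡ (n+n≡n*2 u))))
  ... | m , 1<m , refl | u , inj₂ r≡ with trans r≡ (sym (ℕ.+-suc u u))
  ...   | refl = Congruences.partI-odd m p-prime 1<m 2 refl u r<p
  squared : 2 * r + 3 < p → _
  squared r<p with odd-prime p-prime (ℕ.≤-<-trans (ℕ.m≤n+m 3 (2 * r)) r<p)
  ... | m , 1<m , refl = Congruences.partII m p-prime 1<m 3 refl r r<p
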